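{- The Maximum Strong Transitivity Problem (MSTP) can be solved in linear time for trees. That is, MSTP restricted to input graphs $T=(V,E)$ that are trees is solvable by an algorithm with running time $O(|V|+|E|)$.
   Context: All graphs are finite, simple and undirected; $\deg_G(x)$ is the degree of $x$ in $G$. For disjoint $A,B\subseteq V$, $A$ strongly dominates $B$ if for every $y\in B$ there is $x\in A$ with $xy\in E$ and $\deg_G(x)\ge \deg_G(y)$. A strong transitive partition of $G$ of order (size) $k$ is a partition $\{V_1,V_2,\ldots,V_k\}$ of $V$ into nonempty (ordered) parts such that $V_i$ strongly dominates $V_j$ for all $1\le i<j\le k$. The strong transitivity $Tr_{st}(G)$ is the maximum order of a strong transitive partition of $G$. MSTP is the optimization problem whose instance is a graph $G$, whose feasible solutions are the strong transitive partitions of $G$, and whose measure, to be maximized, is the order of the partition (so that the optimum value is $Tr_{st}(G)$). -}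

module Defs where

open import Data.Bool.Base using (_∧_; if_then_else_)
open import Data.Fin.Base using (Fin; toℕ)
import Data.Fin.Base as Fin
import Data.Fin.Properties as Fin
open import Data.List.Base
  using (List; []; _∷_; _∷ʳ_; length; map; concat; take; upTo; filter; allFin; cartesianProduct)
open import Data.List.Relation.Binary.Permutation.Propositional using (_↭_)
open import Data.List.Relation.Unary.Linked using (Linked)
open import Data.List.Relation.Unary.Unique.Propositional using (Unique)
open import Data.Nat.Base using (ℕ; zero; suc; _+_; _∸_; _*_; _≤_; _≡ᵇ_; NonZero)
open import Data.Product.Base using (_×_; _,_; ∃-syntax)
open import Function.Definitions using (StrictlySurjective)
open import Level using (0ℓ)
open import Relation.Binary.Construct.Closure.ReflexiveTransitive using (Star)
open import Relation.Binary.Core using (Rel)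
open import Relation.Binary.Definitions using (Decidable; Symmetric; Irreflexive)
open import Relation.Binary.PropositionalEquality.Core using (_≡_; _≢_)
open import Relation.Nullary.Decidable.Core using (_×-dec_)
open import Relation.Nullary.Negation.Core using (¬_)
open import Relation.Unary using (Pred; _∈_)

------------------------------------------------------------------------
-- Graphs

record Graph : Set₁ where
  infix 4 _~_ _~?_
  field
    ∣V∣    : ℕ
    _~_    : Rel (Fin ∣V∣) 0ℓ
    _~?_   : Decidable _~_
    ~-sym    : Symmetric _~_
    ~-irrefl : Irreflexive _≡_ _~_

  V : Set
  V = Fin ∣V∣

  neighbours : V → List V
  neighbours x = filter (x ~?_) (allFin ∣V∣)

  deg : V → ℕ
  deg x = length (neighbours x)

  -- Each edge {x , y} is counted once, as the pair with x < y.
  ∣E∣ : ℕ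
  ∣E∣ = length (filter (λ (x , y) → (x Fin.<? y) ×-dec (x ~? y))
                       (cartesianProduct (allFin ∣V∣) (allFin ∣V∣)))

module _ (G : Graph) where
  open Graph G

  Connected : Set
  Connected = ∀ x y → Star _~_ x y

  -- A cycle  x , y₁ , … , yₘ , x  has at least three distinct vertices.
  record Cycle : Set where
    field
      start    : V
      rest     : List V
      long     : 2 ≤ length rest
      distinct : Unique (start ∷ rest)
      closed   : Linked _~_ (start ∷ rest ∷ʳ start)

  record IsTree : Set where
    field
      nonempty  : NonZero ∣V∣
      connected : Connected
      acyclic   : ¬ Cycle

------------------------------------------------------------------------
-- Strong transitive partitions

  StronglyDominates : Pred V 0ℓ → Pred V 0ℓ → Set
  StronglyDominates A B =
    ∀ {y} → y ∈ B → ∃[ x ] x ∈ A × x ~ y × deg y ≤ deg x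

  -- An ordered partition into k nonempty parts is a surjection onto Fin k;
  -- part i is the i-th fibre, counting from 0.
  record StrongTransitivePartition (k : ℕ) : Set where
    field
      class : V → Fin k

    part : Fin k → Pred V 0ℓ
    part i x = class x ≡ i

    field
      nonempty  : StrictlySurjective _≡_ class
      dominates : ∀ {i j} → i Fin.< j → StronglyDominates (part i) (part j)

  -- The strong transitivity of G is k, i.e. Tr_st(G) = k.
  record IsStrongTransitivity (k : ℕ) : Set where
    field
      partition : StrongTransitivePartition k
      maximum   : ∀ {l} → StrongTransitivePartition l → l ≤ k

------------------------------------------------------------------------
-- A random-access machine with structured control flow

-- The memory consists of arrays of natural numbers. A program refers to its
-- arrays by literal names, hence only to a fixed number of them; indices within
-- an array are computed (indirect addressing). A scalar variable is an array
-- used at index 0 only.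
Name : Set
Name = ℕ

Store : Set
Store = Name → ℕ → ℕ

infixr 9 _at_
infixl 6 _⊕_ _⊖_

data Expr : Set where
  lit     : ℕ → Expr
  _at_    : Name → Expr → Expr
  _⊕_ _⊖_ : Expr → Expr → Expr

eval : Expr → Store → ℕ
eval (lit n)   σ = n
eval (a at e)  σ = σ a (eval e σ)
eval (e ⊕ f)   σ = eval e σ + eval f σ
eval (e ⊖ f)   σ = eval e σ ∸ eval f σ

infix  5 _at_≔_
infixr 4 _⨾_

-- An expression used as a condition holds when its value is nonzero.
data Cmd : Set where
  skip          : Cmd
  _at_≔_        : Name → Expr → Expr → Cmd
  _⨾_           : Cmd → Cmd → Cmd
  If_Then_Else_ : Expr → Cmd → Cmd → Cmd
  While_Do_     : Expr → Cmd → Cmd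

write : Name → ℕ → ℕ → Store → Store
write a i v σ b j = if (a ≡ᵇ b) ∧ (i ≡ᵇ j) then v else σ b j

infix 3 _⊢⟨_,_⟩⇓⟨_,_⟩

-- W ⊢⟨ p , σ ⟩⇓⟨ σ′ , t ⟩ : on a machine whose words hold the numbers 0 , … , W,
-- the program p started in σ halts in σ′ after t steps. Storing a number or
-- addressing a target beyond W is an error: the run then has no result. A step
-- evaluates one expression of the program text (two in an assignment), so it
-- takes a number of machine instructions bounded in terms of the program alone;
-- without multiplication, intermediate results likewise exceed W by at most a
-- factor (and an additive constant) depending on the program alone.
data _⊢⟨_,_⟩⇓⟨_,_⟩ (W : ℕ) : Cmd → Store → Store → ℕ → Set where

  skip : ∀ {σ} → W ⊢⟨ skip , σ ⟩⇓⟨ σ , 1 ⟩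

  assign : ∀ {a i e σ} → eval i σ ≤ W → eval e σ ≤ W →
    W ⊢⟨ a at i ≔ e , σ ⟩⇓⟨ write a (eval i σ) (eval e σ) σ , 1 ⟩

  seq : ∀ {p q σ σ′ σ″ s t} →
    W ⊢⟨ p , σ ⟩⇓⟨ σ′ , s ⟩ → W ⊢⟨ q , σ′ ⟩⇓⟨ σ″ , t ⟩ →
    W ⊢⟨ p ⨾ q , σ ⟩⇓⟨ σ″ , s + t ⟩

  if-true : ∀ {e p q σ σ′ t} → eval e σ ≢ 0 →
    W ⊢⟨ p , σ ⟩⇓⟨ σ′ , t ⟩ →
    W ⊢⟨ If e Then p Else q , σ ⟩⇓⟨ σ′ , suc t ⟩

  if-false : ∀ {e p q σ σ′ t} → eval e σ ≡ 0 →
    W ⊢⟨ q , σ ⟩⇓⟨ σ′ , t ⟩ →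
    W ⊢⟨ If e Then p Else q , σ ⟩⇓⟨ σ′ , suc t ⟩

  while-stop : ∀ {e p σ} → eval e σ ≡ 0 →
    W ⊢⟨ While e Do p , σ ⟩⇓⟨ σ , 1 ⟩

  while-step : ∀ {e p σ σ′ σ″ s t} → eval e σ ≢ 0 →
    W ⊢⟨ p , σ ⟩⇓⟨ σ′ , s ⟩ → W ⊢⟨ While e Do p , σ′ ⟩⇓⟨ σ″ , t ⟩ →
    W ⊢⟨ While e Do p , σ ⟩⇓⟨ σ″ , suc (s + t) ⟩

------------------------------------------------------------------------
-- Input and output

record AdjacencyLists (G : Graph) : Set where
  open Graph G
  field
    adj        : V → List V
    enumerates : ∀ x → adj x ↭ neighbours x

cell : List ℕ → ℕ → ℕ
cell []       _       = 0
cell (x ∷ _)  zero    = x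
cell (_ ∷ xs) (suc i) = cell xs i

load : List (List ℕ) → Store
load []         _       = λ _ → 0
load (xs ∷ _)   zero    = cell xs
load (_  ∷ xss) (suc a) = load xss a

-- Array 0 holds the number of vertices, array 2 the concatenation of the
-- adjacency lists. The list of vertex v occupies the positions of array 2 from
-- the v-th entry of array 1 (inclusive) to the (v+1)-th (exclusive). All other
-- memory is 0.
input : ∀ {G} → AdjacencyLists G → Store
input {G} L = load ((∣V∣ ∷ []) ∷ offsets ∷ map toℕ (concat lists) ∷ [])
  where
  open Graph G
  open AdjacencyLists L

  lists : List (List V)
  lists = map adj (allFin ∣V∣)

  offsets : List ℕ
  offsets = map (λ v → length (concat (take v lists))) (upTo (suc ∣V∣))

-- The store holds an optimal solution: its order in array 3, and in array 4,
-- for each vertex, the index of the part containing it.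
record HoldsMaximumPartition (G : Graph) (σ : Store) : Set where
  open Graph G
  field
    order   : ℕ
    optimal : IsStrongTransitivity G order

  open IsStrongTransitivity optimal using (partition)
  open StrongTransitivePartition partition using (class)

  field
    order-stored : σ 3 0 ≡ order
    class-stored : ∀ x → σ 4 (toℕ x) ≡ toℕ (class x)

-- The constant c also bounds the word size, log₂ (∣V∣ + ∣E∣) + O(1) bits.
SolvesMSTPInLinearTimeOn : (Graph → Set) → Cmd → Set₁
SolvesMSTPInLinearTimeOn C p =
  ∃[ c ] ∀ (G : Graph) → C G → (L : AdjacencyLists G) →
    let open Graph G
        bound = c * (∣V∣ + ∣E∣)
    in ∃[ σ ] ∃[ t ] (bound ⊢⟨ p , input L ⟩⇓⟨ σ , t ⟩)
                     × t ≤ bound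
                     × HoldsMaximumPartition G σ

{-# OPTIONS --safe #-}
module Submission where

-- Numbering the parts from 0, a strong transitive partition is a labelling of the
-- vertices such that a vertex v with label k has, for every i < k, a neighbour of
-- label i and degree at least deg v. A vertex may use neighbours of smaller label
-- only, so in a tree the largest label best u p that u can have without using its
-- neighbour p depends only on the values best w u of the other neighbours w of u
-- with deg u ≤ deg w: sorting these values, one counts greedily how many labels
-- 0 , 1 , … they cover, where a neighbour of value d can take any label ≤ d. A
-- bottom-up pass along a breadth-first search computes best v p for the parents p,
-- and a top-down pass computes it for the children; there the effect of leaving out
-- one neighbour is read off a threshold, so that both passes take linear time. Then
-- the tree is searched again from a vertex r of maximal best r, and after a second
-- bottom-up pass every child takes the label that the greedy count of its parent
-- assigned to it, which makes this maximum the label of r.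

open import Defs
open import Algebra.Properties.CommutativeSemigroup using (interchange; x∙yz≈y∙xz)
open import Data.Bool.Base using (Bool; true; false; T; _∧_; _∨_; if_then_else_)
open import Data.Empty using (⊥; ⊥-elim)
open import Data.Fin.Base as Fin using (Fin; zero; suc; toℕ; fromℕ<)
import Data.Fin.Properties as Fin
open import Data.List.Base
  using (List; []; _∷_; _++_; _∷ʳ_; length; map; concat; take; upTo; applyUpTo; filter; allFin; tabulate)
open import Data.List.Membership.Propositional using () renaming (_∈_ to _∈ₗ_)
open import Data.List.Membership.Propositional.Properties using (∈-filter⁺; ∈-filter⁻; ∈-allFin)
open import Data.List.Properties
  using (map-tabulate; map-upTo; length-++; take-suc-tabulate; length-map; concat-++; ++-identityʳ; map-++)
open import Data.List.Relation.Binary.Permutation.Propositional using (↭-sym)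
open import Data.List.Relation.Binary.Permutation.Propositional.Properties using (↭-length; ∈-resp-↭)
open import Data.List.Relation.Unary.All as All using (All; []; _∷_)
import Data.List.Relation.Unary.All.Properties as All
open import Data.List.Relation.Unary.AllPairs using ([]; _∷_)
import Data.List.Relation.Unary.AllPairs.Properties as AllPairs
open import Data.List.Relation.Unary.Any using (here; there)
open import Data.List.Relation.Unary.Linked using (Linked; [-]; _∷_)
open import Data.List.Relation.Unary.Unique.Propositional using (Unique)
open import Data.Nat.Base
open import Data.Nat.Induction using (<-wellFounded)
open import Data.Nat.Properties
open import Data.Nat.Solver using (module +-*-Solver)
open import Data.Product.Base using (_×_; _,_; ∃-syntax; proj₁; proj₂)
open import Data.Sum.Base using (_⊎_; inj₁; inj₂; [_,_]′)
open import Data.Unit.Base using (tt)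
open import Function.Base using (_∘_; id; case_of_)
open import Induction.WellFounded using (Acc; acc)
open import Relation.Binary.Construct.Closure.ReflexiveTransitive using (Star; ε; _◅_)
import Relation.Binary.Definitions as Binary
open import Relation.Binary.Definitions using (tri<; tri≈; tri>)
open import Relation.Binary.PropositionalEquality
open import Relation.Nullary
open import Relation.Nullary.Decidable using (_×-dec_; ¬?; map′)
open import Relation.Unary using (Decidable)
open +-*-Solver using (solve; con; _:+_; _:*_) renaming (_:=_ to _⊜_)

-- Finite sums and counting

-- The neighbours that carry the labels below that of `u` are distinct, so no value above
-- `deg u ∸ 1` matters to `u`. Hence sorting becomes counting in `deg u` buckets, and the buckets of
-- all vertices fit into the space of the adjacency lists. The obstacle is the top-down pass: a new
-- count for each omitted neighbour would cost the square of the degree. But omitting one item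
-- lowers the count by at most one, and the sweep that computes the count also yields the number
-- with which to compare the omitted item. The second search starts at `r` because a label is built
-- from children alone, and only for the root are the children all the neighbours. A child for which
-- the greedy count has no label takes 0, which demands nothing. Children can be labelled without
-- knowing the final label of their parent, since surplus labels among its neighbours do no harm.
-- Steps are counted on unbounded words first. As each step raises the largest stored number by at
-- most 1, a fast run then fits into short words.

choose : ∀ {P : Set} → Dec P → ℕ → ℕ → ℕ
choose (yes _) a b = a
choose (no _)  a b = b

ind : ∀ {P : Set} → Dec P → ℕ
ind P? = choose P? 1 0

ind-yes : ∀ {P : Set} (P? : Dec P) → P → ind P? ≡ 1
ind-yes (yes _) _  = refl
ind-yes (no ¬p) p  = contradiction p ¬p

ind-no : ∀ {P : Set} (P? : Dec P) → ¬ P → ind P? ≡ 0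
ind-no (yes p) ¬p = contradiction p ¬p
ind-no (no _)  _  = refl

ind≤1 : ∀ {P : Set} (P? : Dec P) → ind P? ≤ 1
ind≤1 (yes _) = ≤-refl
ind≤1 (no _)  = z≤n

ind-mono : ∀ {P Q : Set} (P? : Dec P) (Q? : Dec Q) → (P → Q) → ind P? ≤ ind Q?
ind-mono (no _)  _       _ = z≤n
ind-mono (yes p) Q? f = ≤-reflexive (sym (ind-yes Q? (f p)))

ind-cong : ∀ {P Q : Set} (P? : Dec P) (Q? : Dec Q) → (P → Q) → (Q → P) → ind P? ≡ ind Q?
ind-cong P? Q? f g = ≤-antisym (ind-mono P? Q? f) (ind-mono Q? P? g)

sum : ℕ → (ℕ → ℕ) → ℕ
sum zero    f = 0
sum (suc n) f = f n + sum n f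

sum-mono : ∀ n {f g} → (∀ {i} → i < n → f i ≤ g i) → sum n f ≤ sum n g
sum-mono zero    h = z≤n
sum-mono (suc n) h = +-mono-≤ (h ≤-refl) (sum-mono n (h ∘ m<n⇒m<1+n))

sum-cong : ∀ n {f g} → (∀ {i} → i < n → f i ≡ g i) → sum n f ≡ sum n g
sum-cong zero    h = refl
sum-cong (suc n) h = cong₂ _+_ (h ≤-refl) (sum-cong n (h ∘ m<n⇒m<1+n))

sum-+ : ∀ n f g → sum n (λ i → f i + g i) ≡ sum n f + sum n g
sum-+ zero    f g = refl
sum-+ (suc n) f g = trans (cong (f n + g n +_) (sum-+ n f g)) (interchange +-commutativeSemigroup (f n) (g n) _ _)

sum-const : ∀ n c → sum n (λ _ → c) ≡ n * c
sum-const zero    c = refl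
sum-const (suc n) c = cong (c +_) (sum-const n c)

sum-zero : ∀ n → sum n (λ _ → 0) ≡ 0
sum-zero n = trans (sum-const n 0) (*-zeroʳ n)

sum-swap : ∀ m n (f : ℕ → ℕ → ℕ) → sum m (λ i → sum n (f i)) ≡ sum n (λ j → sum m (λ i → f i j))
sum-swap zero    n f = sym (sum-zero n)
sum-swap (suc m) n f = trans (cong (sum n (f m) +_) (sum-swap m n f))
                             (sym (sum-+ n (f m) (λ j → sum m (λ i → f i j))))

off-at : ℕ → (ℕ → ℕ) → ℕ → ℕ
off-at x f i = choose (i ≟ x) 0 (f i)

off-at-≢ : ∀ x f {i} → i ≢ x → off-at x f i ≡ f i
off-at-≢ x f {i} i≢x with i ≟ x
... | yes i≡x = contradiction i≡x i≢x
... | no _    = refl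

off-at-≡ : ∀ x f → off-at x f x ≡ 0
off-at-≡ x f with x ≟ x
... | yes _   = refl
... | no x≢x  = contradiction refl x≢x

sum-extract : ∀ n f {x} → x < n → sum n f ≡ f x + sum n (off-at x f)
sum-extract (suc n) f {x} x<1+n with x ≟ n
... | yes refl = cong (f x +_) (sym (cong₂ _+_ (off-at-≡ x f) (sum-cong x (off-at-≢ x f ∘ <⇒≢))))
... | no x≢n   = begin
  f n + sum n f                      ≡⟨ cong (f n +_) (sum-extract n f (≤∧≢⇒< (s≤s⁻¹ x<1+n) x≢n)) ⟩
  f n + (f x + sum n (off-at x f))   ≡⟨ x∙yz≈y∙xz +-commutativeSemigroup (f n) (f x) _ ⟩
  f x + (f n + sum n (off-at x f))   ≡⟨ cong (λ y → f x + (y + sum n (off-at x f))) (off-at-≢ x f (x≢n ∘ sym)) ⟨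
  f x + sum (suc n) (off-at x f)     ∎
  where open ≡-Reasoning

InjectiveBelow : ℕ → (ℕ → ℕ) → Set
InjectiveBelow k w = ∀ {i j} → i < k → j < k → w i ≡ w j → i ≡ j

-- By induction on `k`: the summand at `w k` is taken out of the right-hand sum and `f` set to 0
-- there, which by injectivity the remaining `w i` do not notice. Costs summed along the queue
-- become sums over the vertices in this way.
sum-injection : ∀ k n (w : ℕ → ℕ) f → (∀ {i} → i < k → w i < n) → InjectiveBelow k w →
                sum k (f ∘ w) ≤ sum n f
sum-injection zero    n w f w< inj = z≤n
sum-injection (suc k) n w f w< inj = begin
  f (w k) + sum k (f ∘ w)                  ≡⟨ cong (f (w k) +_) (sum-cong k (sym ∘ off-at-≢ (w k) f ∘ distinct)) ⟩
  f (w k) + sum k (off-at (w k) f ∘ w)     ≤⟨ +-monoʳ-≤ (f (w k)) (sum-injection k n w (off-at (w k) f)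
                                               (w< ∘ m<n⇒m<1+n) (λ i< j< → inj (m<n⇒m<1+n i<) (m<n⇒m<1+n j<))) ⟩
  f (w k) + sum n (off-at (w k) f)         ≡⟨ sum-extract n f (w< ≤-refl) ⟨
  sum n f                                  ∎
  where
  open ≤-Reasoning
  distinct : ∀ {i} → i < k → w i ≢ w k
  distinct i<k eq = <⇒≢ i<k (inj (m<n⇒m<1+n i<k) ≤-refl eq)

pigeonhole : ∀ k n (w : ℕ → ℕ) → (∀ {i} → i < k → w i < n) → InjectiveBelow k w → k ≤ n
pigeonhole k n w w< inj = begin
  k                   ≡⟨ trans (sum-const k 1) (*-identityʳ k) ⟨
  sum k (λ _ → 1)     ≤⟨ sum-injection k n w (λ _ → 1) w< inj ⟩
  sum n (λ _ → 1)     ≡⟨ trans (sum-const n 1) (*-identityʳ n) ⟩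
  n                   ∎
  where open ≤-Reasoning

count : ∀ n {P : ℕ → Set} → Decidable P → ℕ
count n P? = sum n (λ i → ind (P? i))

count-cong : ∀ n {P Q : ℕ → Set} (P? : Decidable P) (Q? : Decidable Q) →
             (∀ {i} → i < n → P i → Q i) → (∀ {i} → i < n → Q i → P i) → count n P? ≡ count n Q?
count-cong n P? Q? f g = sum-cong n (λ {i} i<n → ind-cong (P? i) (Q? i) (f i<n) (g i<n))

-- The extra index `x` counts only under the condition `R`, so that one statement serves whether or
-- not a vertex joins the bucket in question.
count-insert : ∀ n {P Q : ℕ → Set} (P? : Decidable P) (Q? : Decidable Q) {R : Set} (R? : Dec R) {x} → x < n →
               (∀ {i} → i < n → P i → Q i ⊎ (i ≡ x × R)) → (∀ {i} → i < n → Q i → P i) →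
               (R → P x) → ¬ Q x → count n P? ≡ ind R? + count n Q?
count-insert n {P} {Q} P? Q? (no ¬r) x<n f g _ _ =
  count-cong n P? Q? (λ i<n p → case f i<n p of λ { (inj₁ q) → q ; (inj₂ (_ , r)) → contradiction r ¬r }) g
count-insert n {P} {Q} P? Q? {R} (yes r) {x} x<n f g Px ¬Qx = begin
  sum n fP                      ≡⟨ sum-extract n fP x<n ⟩
  fP x + sum n (off-at x fP)    ≡⟨ cong₂ _+_ (ind-yes (P? x) (Px r)) (sum-cong n same) ⟩
  1 + sum n fQ                  ∎
  where
  open ≡-Reasoning
  fP fQ : ℕ → ℕ
  fP i = ind (P? i)
  fQ i = ind (Q? i)
  same : ∀ {i} → i < n → off-at x fP i ≡ fQ i
  same {i} i<n with i ≟ x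
  ... | yes refl = sym (ind-no (Q? i) ¬Qx)
  ... | no i≢x   = ind-cong (P? i) (Q? i)
    (λ p → case f i<n p of λ { (inj₁ q) → q ; (inj₂ (i≡x , _)) → contradiction i≡x i≢x }) (g i<n)

-- Greedy labelling: cnt d items may take any label ≤ d

module Greedy (cnt : ℕ → ℕ) where

  -- The number of consecutive labels 0 , 1 , … that the items of value below d can cover.
  covered : ℕ → ℕ
  covered zero    = 0
  covered (suc d) = suc d ⊓ (covered d + cnt d)

  -- Removing an item of value v lowers covered exactly if v is at least this
  -- threshold: otherwise a later bucket wastes an item that makes up for it.
  critical : ℕ → ℕ
  critical zero    = 0
  critical (suc d) = choose (suc d <? covered d + cnt d) (suc d) (critical d)

  critical≤ : ∀ m → critical m ≤ m
  critical≤ zero    = z≤n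
  critical≤ (suc m) with suc m <? covered m + cnt m
  ... | yes _ = ≤-refl
  ... | no  _ = m≤n⇒m≤1+n (critical≤ m)

  -- The labels from `covered d` up to `covered (suc d)` go to bucket `d`, and these intervals tile
  -- the range below `covered m`. The cap `suc d` in `covered` yields `i ≤ d`.
  covered-bucket : ∀ m {i} → i < covered m →
                   ∃[ d ] d < m × covered d ≤ i × i < covered d + cnt d × i ≤ d
  covered-bucket (suc m) {i} i< with i <? covered m
  ... | yes i<c = let d , d<m , rest = covered-bucket m i<c in d , m<n⇒m<1+n d<m , rest
  ... | no i≮c  = m , ≤-refl , ≮⇒≥ i≮c , <-≤-trans i< (m⊓n≤n (suc m) _) , s≤s⁻¹ (<-≤-trans i< (m⊓n≤m (suc m) _))

open Greedy

module _ {cnt cnt′ : ℕ → ℕ} where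

  covered-cong : ∀ m → (∀ {d} → d < m → cnt d ≡ cnt′ d) → covered cnt m ≡ covered cnt′ m
  covered-cong zero    eq = refl
  covered-cong (suc m) eq = cong₂ (λ a b → suc m ⊓ (a + b)) (covered-cong m (eq ∘ m<n⇒m<1+n)) (eq ≤-refl)

  critical-cong : ∀ m → (∀ {d} → d < m → cnt d ≡ cnt′ d) → critical cnt m ≡ critical cnt′ m
  critical-cong zero    eq = refl
  critical-cong (suc m) eq
    rewrite covered-cong m (eq ∘ m<n⇒m<1+n) | eq ≤-refl | critical-cong m (eq ∘ m<n⇒m<1+n) = refl

module _ {cnt cnt′ : ℕ → ℕ} {v : ℕ} where

  private
    Removal : ℕ → Set
    Removal m = (critical cnt′ m ≤ v × covered cnt′ m ≡ suc (covered cnt m)) ⊎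
                (v < critical cnt′ m × covered cnt′ m ≡ covered cnt m)

    module _ {m} (eq : ∀ {d} → d < suc m → cnt′ d ≡ ind (d ≟ m) + cnt d) where
      unchanged : ∀ {d} → d < m → cnt d ≡ cnt′ d
      unchanged {d} d<m = sym (trans (eq (m<n⇒m<1+n d<m)) (cong (_+ cnt d) (ind-no (d ≟ m) (<⇒≢ d<m))))

      one-more : covered cnt′ m + cnt′ m ≡ suc (covered cnt m + cnt m)
      one-more = trans
        (cong₂ _+_ (sym (covered-cong m unchanged)) (trans (eq ≤-refl) (cong (_+ cnt m) (ind-yes (m ≟ m) refl))))
        (+-suc _ _)

  -- Here `cnt′` has one item more than `cnt`, in bucket `v`. From `v` on the two greedy counts
  -- differ by one until a bucket of `cnt′` has a surplus; there both reach the cap and stay equal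
  -- afterwards. As `critical` is one more than the last bucket with a surplus, or 0, `critical ≤ v`
  -- says that no such bucket occurs from `v` on.
  removal : ∀ m → (∀ {d} → d < m → cnt′ d ≡ ind (d ≟ v) + cnt d) → v < m → Removal m
  removal (suc m) eq v<1+m with m ≟ v
  ... | yes refl with suc m <? covered cnt′ m + cnt′ m
  ...   | yes lt = inj₂ (≤-refl , trans (m≤n⇒m⊓n≡m (<⇒≤ lt))
                     (sym (m≤n⇒m⊓n≡m (s≤s⁻¹ (subst (suc m <_) (one-more eq) lt)))))
  ...   | no ≮   = inj₁ (critical≤ cnt′ m , trans (m≥n⇒m⊓n≡n (≮⇒≥ ≮)) (trans (one-more eq) (cong suc
                     (sym (m≥n⇒m⊓n≡n (≤-trans (n≤1+n _) (subst (_≤ suc m) (one-more eq) (≮⇒≥ ≮))))))))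
  removal (suc m) eq v<1+m | no m≢v
    with removal m (eq ∘ m<n⇒m<1+n) (≤∧≢⇒< (s≤s⁻¹ v<1+m) (m≢v ∘ sym)) | suc m <? covered cnt′ m + cnt′ m
       | trans (eq ≤-refl) (cong (_+ cnt m) (ind-no (m ≟ v) m≢v))
  ... | inj₁ (c≤v , c≡) | yes lt | cnt≡ rewrite cnt≡ | c≡ =
    inj₂ (v<1+m , trans (m≤n⇒m⊓n≡m (<⇒≤ lt)) (sym (m≤n⇒m⊓n≡m (s≤s⁻¹ lt))))
  ... | inj₁ (c≤v , c≡) | no ≮   | cnt≡ rewrite cnt≡ | c≡ =
    inj₁ (c≤v , trans (m≥n⇒m⊓n≡n (≮⇒≥ ≮)) (cong suc (sym (m≥n⇒m⊓n≡n (≤-trans (n≤1+n _) (≮⇒≥ ≮))))))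
  ... | inj₂ (v<c , c≡) | yes lt | cnt≡ rewrite cnt≡ | c≡ = inj₂ (v<1+m , refl)
  ... | inj₂ (v<c , c≡) | no ≮   | cnt≡ rewrite cnt≡ | c≡ = inj₂ (v<c , refl)

  covered-remove : ∀ m → (∀ {d} → d < m → cnt′ d ≡ ind (d ≟ v) + cnt d) → v < m →
                   covered cnt m ≡ covered cnt′ m ∸ ind (critical cnt′ m ≤? v)
  covered-remove m eq v<m with removal m eq v<m
  ... | inj₁ (≤v , c≡) rewrite ind-yes (critical cnt′ m ≤? v) ≤v | c≡ = refl
  ... | inj₂ (v< , c≡) rewrite ind-no (critical cnt′ m ≤? v) (<⇒≱ v<) | c≡ = refl

module _ {n} {cnt : ℕ → ℕ} {P : ℕ → ℕ → Set} (P? : ∀ d → Decidable (P d)) {m}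
         (cnt≡ : ∀ {d} → d < m → cnt d ≡ count n (P? d)) where

  -- Optimality of the greedy count, where label `i` is carried by the item `w i`. By induction on
  -- `d`, at most `covered d` of these items have value below `d`: those of value at most `d` carry
  -- labels at most `d`, hence are at most `suc d` many, and at most `cnt d` of them lie in bucket
  -- `d` itself.
  covered-lower : ∀ j (w val : ℕ → ℕ) → (∀ {i} → i < j → w i < n) → InjectiveBelow j w →
                  (∀ {i} → i < j → P (val i) (w i)) → (∀ {i} → i < j → i ≤ val i) →
                  (∀ {i} → i < j → val i < m) → j ≤ covered cnt m
  covered-lower j w val w< inj Pw ≤val val< = begin
    j                  ≡⟨ trans (sum-const j 1) (*-identityʳ j) ⟨
    sum j (λ _ → 1)    ≡⟨ sum-cong j (λ {i} i<j → ind-yes (val i <? m) (val< i<j)) ⟨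
    below m            ≤⟨ bound m ≤-refl ⟩
    covered cnt m      ∎
    where
    open ≤-Reasoning
    below : ℕ → ℕ
    below d = count j (λ i → val i <? d)

    split : ∀ d i → ind (val i <? suc d) ≤ ind (val i ≟ d) + ind (val i <? d)
    split d i with val i ≟ d
    ... | yes _  = ≤-trans (ind≤1 (val i <? suc d)) (s≤s z≤n)
    ... | no ≢d = ind-mono (val i <? suc d) (val i <? d) (λ lt → ≤∧≢⇒< (s≤s⁻¹ lt) ≢d)

    initial : ∀ k d → count k (λ i → i ≤? d) ≤ suc d
    initial zero    d = z≤n
    initial (suc k) d with k ≤? d
    ... | yes k≤d = s≤s (≤-trans (≤-trans (sum-mono k (λ {i} _ → ind≤1 (i ≤? d)))
                                          (≤-reflexive (trans (sum-const k 1) (*-identityʳ k)))) k≤d)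
    ... | no _    = initial k d

    bound : ∀ d → d ≤ m → below d ≤ covered cnt d
    bound zero    _   = ≤-reflexive (trans (sum-cong j (λ {i} _ → ind-no (val i <? 0) λ ())) (sum-zero j))
    bound (suc d) d<m = ⊓-glb
      (≤-trans (sum-mono j (λ {i} i<j → ind-mono (val i <? suc d) (i ≤? d) (λ lt → ≤-trans (≤val i<j) (s≤s⁻¹ lt))))
               (initial j d))
      (begin
        below (suc d)
          ≤⟨ sum-mono j (λ {i} _ → split d i) ⟩
        sum j (λ i → ind (val i ≟ d) + ind (val i <? d))
          ≡⟨ sum-+ j _ _ ⟩
        count j (λ i → val i ≟ d) + below d
          ≤⟨ +-mono-≤ (sum-mono j (λ {i} i<j → ind-mono (val i ≟ d) (P? d (w i)) (λ { refl → Pw i<j })))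
                      (bound d (<⇒≤ d<m)) ⟩
        count j (λ i → P? d (w i)) + covered cnt d
          ≤⟨ +-monoˡ-≤ _ (sum-injection j n w (λ i → ind (P? d i)) w< inj) ⟩
        count n (P? d) + covered cnt d
          ≡⟨ cong (_+ covered cnt d) (cnt≡ d<m) ⟨
        cnt d + covered cnt d
          ≡⟨ +-comm (cnt d) _ ⟩
        covered cnt d + cnt d
          ∎)

-- Programs on a machine with unbounded words

data Run : Cmd → Store → Store → ℕ → Set where
  skip : ∀ {σ} → Run skip σ σ 1
  assign : ∀ {a i e σ} → Run (a at i ≔ e) σ (write a (eval i σ) (eval e σ) σ) 1
  seq : ∀ {p q σ σ′ σ″ s t} → Run p σ σ′ s → Run q σ′ σ″ t → Run (p ⨾ q) σ σ″ (s + t)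
  if-true : ∀ {e p q σ σ′ t} → eval e σ ≢ 0 → Run p σ σ′ t → Run (If e Then p Else q) σ σ′ (suc t)
  if-false : ∀ {e p q σ σ′ t} → eval e σ ≡ 0 → Run q σ σ′ t → Run (If e Then p Else q) σ σ′ (suc t)
  while-stop : ∀ {e p σ} → eval e σ ≡ 0 → Run (While e Do p) σ σ 1
  while-step : ∀ {e p σ σ′ σ″ s t} → eval e σ ≢ 0 → Run p σ σ′ s → Run (While e Do p) σ′ σ″ t →
               Run (While e Do p) σ σ″ (suc (s + t))

-- Coefficients of a linear bound on the value in terms of the largest number in memory. A
-- difference is bounded by its left operand.
slope offset : Expr → ℕ
slope (lit n)  = 0
slope (a at e) = 1
slope (e ⊕ f)  = slope e + slope f
slope (e ⊖ f)  = slope e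
offset (lit n)  = n
offset (a at e) = 0
offset (e ⊕ f)  = offset e + offset f
offset (e ⊖ f)  = offset e

-- Every step of a gentle program increases the largest number in memory by at
-- most 1, so that a fast run needs only short words.
Gentle : Cmd → Bool
Gentle skip = true
Gentle (a at i ≔ e) = ((slope i ≤ᵇ 2) ∧ (offset i ≤ᵇ 1)) ∧ ((slope e ≤ᵇ 1) ∧ (offset e ≤ᵇ 1))
Gentle (p ⨾ q) = Gentle p ∧ Gentle q
Gentle (If e Then p Else q) = Gentle p ∧ Gentle q
Gentle (While e Do p) = Gentle p

Bounded : ℕ → Store → Set
Bounded m σ = ∀ a i → σ a i ≤ m

eval-bound : ∀ e {m σ} → Bounded m σ → eval e σ ≤ slope e * m + offset e
eval-bound (lit n)  b = ≤-refl
eval-bound (a at e) {m} b = ≤-trans (b a _) (≤-reflexive (sym (trans (+-identityʳ _) (+-identityʳ m))))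
eval-bound (e ⊕ f) {m} b = ≤-trans (+-mono-≤ (eval-bound e b) (eval-bound f b)) (≤-reflexive
  (trans (interchange +-commutativeSemigroup (slope e * m) (offset e) _ _)
         (cong (_+ (offset e + offset f)) (sym (*-distribʳ-+ m (slope e) (slope f))))))
eval-bound (e ⊖ f) {m} {σ} b = ≤-trans (m∸n≤m (eval e σ) (eval f σ)) (eval-bound e b)

write-bounded : ∀ {m a i v σ} → v ≤ m → Bounded m σ → Bounded m (write a i v σ)
write-bounded {a = a} {i} v≤ b c k with (a ≡ᵇ c) ∧ (i ≡ᵇ k)
... | true  = v≤
... | false = b c k

T-∧⁻ : ∀ {x y} → T (x ∧ y) → T x × T y
T-∧⁻ {true} h = tt , h

module _ {W : ℕ} where

  private
    shrink : ∀ {x y} → x ≤ y → 2 * y + 1 ≤ W → 2 * x + 1 ≤ W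
    shrink le = ≤-trans (+-monoˡ-≤ 1 (*-monoʳ-≤ 2 le))

  -- Everything stored during the run is at most `m + t`. A gentle index adds at most two stored
  -- numbers and 1, hence the demand on `W`.
  fits : ∀ {p σ σ′ t} m → Run p σ σ′ t → T (Gentle p) → Bounded m σ → 2 * (m + t) + 1 ≤ W →
         (W ⊢⟨ p , σ ⟩⇓⟨ σ′ , t ⟩) × Bounded (m + t) σ′
  fits m skip g b ≤W = skip , λ a i → ≤-trans (b a i) (m≤m+n m 1)
  fits m (assign {a} {i} {e} {σ}) g b ≤W =
    assign (≤-trans index≤ (≤-trans (+-monoˡ-≤ 1 (*-monoʳ-≤ 2 (m≤m+n m 1))) ≤W))
           (≤-trans value≤ (≤-trans (≤-trans (m≤m+n (m + 1) _) (m≤m+n (2 * (m + 1)) 1)) ≤W)) ,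
    write-bounded {a = a} {eval i σ} value≤ (λ c k → ≤-trans (b c k) (m≤m+n m 1))
    where
    gᵢ : T (slope i ≤ᵇ 2) × T (offset i ≤ᵇ 1)
    gᵢ = T-∧⁻ {slope i ≤ᵇ 2} (proj₁ (T-∧⁻ {(slope i ≤ᵇ 2) ∧ (offset i ≤ᵇ 1)} g))
    gₑ : T (slope e ≤ᵇ 1) × T (offset e ≤ᵇ 1)
    gₑ = T-∧⁻ {slope e ≤ᵇ 1} (proj₂ (T-∧⁻ {(slope i ≤ᵇ 2) ∧ (offset i ≤ᵇ 1)} g))
    index≤ : eval i σ ≤ 2 * m + 1
    index≤ = ≤-trans (eval-bound i b) (+-mono-≤ (*-monoˡ-≤ m (≤ᵇ⇒≤ (slope i) 2 (proj₁ gᵢ)))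
                                                (≤ᵇ⇒≤ (offset i) 1 (proj₂ gᵢ)))
    value≤ : eval e σ ≤ m + 1
    value≤ = ≤-trans (eval-bound e b) (+-mono-≤
      (≤-trans (*-monoˡ-≤ m (≤ᵇ⇒≤ (slope e) 1 (proj₁ gₑ))) (≤-reflexive (*-identityˡ m)))
      (≤ᵇ⇒≤ (offset e) 1 (proj₂ gₑ)))
  fits m (seq {p} {s = s} {t} r r′) g b ≤W =
    let gp , gq = T-∧⁻ {Gentle p} g
        run , b′  = fits m r gp b (shrink (+-monoʳ-≤ m (m≤m+n s t)) ≤W)
        run′ , b″ = fits (m + s) r′ gq b′ (shrink (≤-reflexive (+-assoc m s t)) ≤W)
    in seq run run′ , λ a i → ≤-trans (b″ a i) (≤-reflexive (+-assoc m s t))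
  fits m (if-true {p = p} {t = t} ne r) g b ≤W =
    let run , b′ = fits m r (proj₁ (T-∧⁻ {Gentle p} g)) b (shrink (+-monoʳ-≤ m (n≤1+n t)) ≤W)
    in if-true ne run , λ a i → ≤-trans (b′ a i) (+-monoʳ-≤ m (n≤1+n t))
  fits m (if-false {p = p} {t = t} eq r) g b ≤W =
    let run , b′ = fits m r (proj₂ (T-∧⁻ {Gentle p} g)) b (shrink (+-monoʳ-≤ m (n≤1+n t)) ≤W)
    in if-false eq run , λ a i → ≤-trans (b′ a i) (+-monoʳ-≤ m (n≤1+n t))
  fits m (while-stop eq) g b ≤W = while-stop eq , λ a i → ≤-trans (b a i) (m≤m+n m 1)
  fits m (while-step {s = s} {t} ne r r′) g b ≤W =
    let run , b′  = fits m r g b (shrink (+-monoʳ-≤ m (≤-trans (m≤m+n s t) (n≤1+n _))) ≤W)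
        run′ , b″ = fits (m + s) r′ g b′ (shrink le ≤W)
    in while-step ne run run′ , λ a i → ≤-trans (b″ a i) le
    where
    le : m + s + t ≤ m + suc (s + t)
    le = ≤-trans (≤-reflexive (+-assoc m s t)) (+-monoʳ-≤ m (n≤1+n _))

-- Framing and weakest preconditions

assigns : Name → Cmd → Bool
assigns b skip = false
assigns b (a at i ≔ e) = a ≡ᵇ b
assigns b (p ⨾ q) = assigns b p ∨ assigns b q
assigns b (If e Then p Else q) = assigns b p ∨ assigns b q
assigns b (While e Do p) = assigns b p

∨-false : ∀ {x y} → x ∨ y ≡ false → x ≡ false × y ≡ false
∨-false {false} eq = refl , eq

frame : ∀ {p σ σ′ t} → Run p σ σ′ t → ∀ b → assigns b p ≡ false → ∀ i → σ′ b i ≡ σ b i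
frame skip b eq i = refl
frame (assign {a} {k}) b eq i rewrite eq = refl
frame (seq {p} r r′) b eq i =
  let eq₁ , eq₂ = ∨-false {assigns b p} eq in trans (frame r′ b eq₂ i) (frame r b eq₁ i)
frame (if-true {p = p} _ r) b eq i = frame r b (proj₁ (∨-false {assigns b p} eq)) i
frame (if-false {p = p} _ r) b eq i = frame r b (proj₂ (∨-false {assigns b p} eq)) i
frame (while-stop _) b eq i = refl
frame (while-step _ r r′) b eq i = trans (frame r′ b eq i) (frame r b eq i)

-- Weakest preconditions of total correctness; the last argument and that of Q
-- count the steps elapsed so far.
wp : Cmd → (Store → ℕ → Set) → Store → ℕ → Set
wp skip Q σ t = Q σ (suc t)
wp (a at i ≔ e) Q σ t = Q (write a (eval i σ) (eval e σ) σ) (suc t)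
wp (p ⨾ q) Q σ t = wp p (wp q Q) σ t
wp (If e Then p Else q) Q σ t = (eval e σ ≢ 0 → wp p Q σ (suc t)) × (eval e σ ≡ 0 → wp q Q σ (suc t))
wp (While e Do p) Q σ t = ∃[ σ′ ] ∃[ t′ ] Run (While e Do p) σ σ′ t′ × Q σ′ (t′ + t)

wp-sound : ∀ p {Q σ t} → wp p Q σ t → ∃[ σ′ ] ∃[ t′ ] Run p σ σ′ t′ × Q σ′ (t′ + t)
wp-sound skip h = _ , _ , skip , h
wp-sound (a at i ≔ e) h = _ , _ , assign , h
wp-sound (p ⨾ q) {Q} {t = t} h =
  let σ₁ , t₁ , r , h₁ = wp-sound p h
      σ₂ , t₂ , s , h₂ = wp-sound q h₁
  in σ₂ , t₁ + t₂ , seq r s , subst (Q σ₂) (trans (sym (+-assoc t₂ t₁ t)) (cong (_+ t) (+-comm t₂ t₁))) h₂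
wp-sound (If e Then p Else q) {Q} {σ} {t} (h₁ , h₂) with eval e σ ≟ 0
... | yes eq = let σ₁ , t₁ , r , h = wp-sound q (h₂ eq) in σ₁ , _ , if-false eq r , subst (Q σ₁) (+-suc t₁ t) h
... | no ne  = let σ₁ , t₁ , r , h = wp-sound p (h₁ ne) in σ₁ , _ , if-true ne r , subst (Q σ₁) (+-suc t₁ t) h
wp-sound (While e Do p) h = h

-- A run established separately stands for its program inside a larger precondition; thus `Scan`,
-- which both passes share, is verified only once.
call : ∀ p {Q σ σ′ s t} → Run p σ σ′ s → Q σ′ (s + t) → wp p Q σ t
call skip skip h = h
call (a at i ≔ e) assign h = h
call (p ⨾ q) {Q} {t = t} (seq {σ″ = σ″} {s = a} {b} r r′) h =
  call p r (call q r′ (subst (Q σ″) (trans (cong (_+ t) (+-comm a b)) (+-assoc b a t)) h))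
call (If e Then p Else q) {Q} {σ′ = σ′} (if-true {t = s} ne r) h =
  (λ _ → call p r (subst (Q σ′) (sym (+-suc s _)) h)) , λ eq → contradiction eq ne
call (If e Then p Else q) {Q} {σ′ = σ′} (if-false {t = s} eq r) h =
  (λ ne → contradiction eq ne) , λ _ → call q r (subst (Q σ′) (sym (+-suc s _)) h)
call (While e Do p) r h = _ , _ , r , h

Halts : Cmd → Store → (Store → ℕ → Set) → Set
Halts p σ Q = ∃[ σ′ ] ∃[ t ] Run p σ σ′ t × Q σ′ t

verify : ∀ p (Q : Store → ℕ → Set) {σ} → wp p Q σ 0 → Halts p σ Q
verify p Q h = let σ′ , t , r , q = wp-sound p h in σ′ , t , r , subst (Q σ′) (+-identityʳ t) q

Keeps : Cmd → Store → Store → Set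
Keeps p σ σ′ = ∀ b → assigns b p ≡ false → ∀ i → σ′ b i ≡ σ b i

-- `wp` asks a loop for a complete run, which is built here from an invariant when the number of
-- iterations is known beforehand. Through `Keeps` the arrays that the body never assigns stay
-- available, so `I` mentions only the changing ones. The extra step in the resulting `suc t′`,
-- which `I` does not see, is the failing last test.
for-loop : ∀ {e p} N (I : ℕ → Store → ℕ → Set) {σ t} →
           (∀ {i σ′ t′} → i < N → Keeps p σ σ′ → I i σ′ t′ → eval e σ′ ≢ 0 × wp p (I (suc i)) σ′ (suc t′)) →
           (∀ {σ′ t′} → Keeps p σ σ′ → I N σ′ t′ → eval e σ′ ≡ 0) →
           I 0 σ t →
           ∃[ σ′ ] ∃[ t′ ] Run (While e Do p) σ σ′ (suc t′) × I N σ′ (t′ + t)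
for-loop {e} {p} N I {σ₀} step stop = go N 0 (+-identityʳ N) (λ _ _ _ → refl)
  where
  go : ∀ k i → k + i ≡ N → ∀ {σ t} → Keeps p σ₀ σ → I i σ t →
       ∃[ σ′ ] ∃[ t′ ] Run (While e Do p) σ σ′ (suc t′) × I N σ′ (t′ + t)
  go zero    i refl {σ} keep h = σ , 0 , while-stop (stop keep h) , h
  go (suc k) i refl {t = t} keep h =
    let ne , b = step (m<n+m i z<s) keep h
        σ₁ , t₁ , r , h₁ = wp-sound p b
        σ₂ , t₂ , s , h₂ = go k (suc i) (+-suc k i) (λ b eq i → trans (frame r b eq i) (keep b eq i)) h₁
    in σ₂ , suc (t₁ + t₂) , subst (Run _ _ _) (cong suc (+-suc t₁ t₂)) (while-step ne r s) ,
       subst (I N σ₂) (time t₁ t₂ t) h₂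
    where
    time : ∀ a b c → b + (a + suc c) ≡ suc (a + b) + c
    time a b c = begin
      b + (a + suc c)   ≡⟨ +-assoc b a (suc c) ⟨
      b + a + suc c     ≡⟨ +-suc (b + a) c ⟩
      suc (b + a + c)   ≡⟨ cong (λ x → suc (x + c)) (+-comm b a) ⟩
      suc (a + b + c)   ∎
      where open ≡-Reasoning

≡ᵇ-refl : ∀ n → (n ≡ᵇ n) ≡ true
≡ᵇ-refl zero    = refl
≡ᵇ-refl (suc n) = ≡ᵇ-refl n

update : (ℕ → ℕ) → ℕ → ℕ → ℕ → ℕ
update f i v k = if i ≡ᵇ k then v else f k

update-same : ∀ f i v → update f i v i ≡ v
update-same f i v rewrite ≡ᵇ-refl i = refl

update-other : ∀ f {i k} v → i ≢ k → update f i v k ≡ f k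
update-other f {i} {k} v i≢k with i ≡ᵇ k in eq
... | true  = contradiction (≡ᵇ⇒≡ i k (subst T (sym eq) tt)) i≢k
... | false = refl

-- Labellings of trees

-- Vertices are naturals because the machine addresses them as such; only those below `n` have
-- edges.
record Network : Set₁ where
  infix 4 _~_ _~?_
  field
    n    : ℕ
    _~_  : ℕ → ℕ → Set
    _~?_ : Binary.Decidable _~_
    ~-sym : ∀ {u v} → u ~ v → v ~ u
    ~-<   : ∀ {u v} → u ~ v → u < n
    deg   : ℕ → ℕ
    deg≡  : ∀ {u} → u < n → deg u ≡ count n (u ~?_)

module _ (N : Network) where
  open Network N

  -- A label of u is below deg u, hence larger values need not be distinguished.
  clip : ℕ → ℕ → ℕ
  clip u m = m ⊓ (deg u ∸ 1)

  deg>0 : ∀ {u v} → u ~ v → 0 < deg u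
  deg>0 {u} {v} e = begin
    1                        ≡⟨ ind-yes (u ~? v) e ⟨
    ind (u ~? v)             ≤⟨ m≤m+n _ _ ⟩
    ind (u ~? v) + _         ≡⟨ sum-extract n (λ w → ind (u ~? w)) (~-< (~-sym e)) ⟨
    count n (u ~?_)          ≡⟨ deg≡ (~-< e) ⟨
    deg u                    ∎
    where open ≤-Reasoning

  clip< : ∀ {u} m → 0 < deg u → clip u m < deg u
  clip< {u} m deg>0 = ≤-<-trans (m⊓n≤n m _) (∸-monoʳ-< z<s deg>0)

  -- The values are the indices of the parts. Nonemptiness is implicit, since a vertex brings along
  -- vertices of all smaller labels.
  Labelling : (ℕ → ℕ) → Set
  Labelling f = ∀ {u} → u < n → ∀ {i} → i < f u → ∃[ w ] w ~ u × f w ≡ i × deg u ≤ deg w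

  module _ (μ : ℕ → ℕ → ℕ) where

    -- `μ w u` is the message from `w` to `u`, meant as the largest label of `w` that does not use
    -- `u`.
    Offers : ℕ → ℕ → ℕ → ℕ → Set
    Offers u p d w = (w ~ u × w ≢ p) × deg u ≤ deg w × clip u (μ w u) ≡ d

    offers? : ∀ u p d → Decidable (Offers u p d)
    offers? u p d w = ((w ~? u) ×-dec ¬? (w ≟ p)) ×-dec ((deg u ≤? deg w) ×-dec (clip u (μ w u) ≟ d))

    offers : ℕ → ℕ → ℕ → ℕ
    offers u p d = count n (offers? u p d)

    -- The largest label of u that does not use p.
    best : ℕ → ℕ → ℕ
    best u p = covered (offers u p) (deg u)

    -- Since n is not a vertex, best v n uses all neighbours of v.
    top : ℕ → ℕ
    top v = best v n

    -- A hypothesis about an arbitrary `μ`: this separates optimality from the order in which the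
    -- passes compute the messages, and lets messages found on one search tree be used on another.
    Messages : Set
    Messages = ∀ {u p} → u ~ p → μ u p ≡ best u p

    module _ (msg : Messages) {f} (lab : Labelling f) where

      -- Induction on the label of `u`. The neighbour `w i` that carries `i < f u` has a smaller
      -- label, hence does not use `u`, and the induction hypothesis bounds `i` by its message to
      -- `u`. These neighbours are distinct, so `f u ≤ deg u` and clipping does not push any value
      -- below its `i`; `covered-lower` concludes.
      label≤best : ∀ {u p} → u < n → (∀ {w} → w ~ u → f w < f u → w ≢ p) → f u ≤ best u p
      label≤best {u} = go (<-wellFounded (f u)) refl
        where
        go : ∀ {k u p} → Acc _<_ k → f u ≡ k → u < n → (∀ {w} → w ~ u → f w < f u → w ≢ p) → f u ≤ best u p
        go {u = u} {p} (acc rs) refl u<n avoid = covered-lower (offers? u p) {deg u} (λ _ → refl) (f u) w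
          (λ i → clip u (μ (w i) u)) (λ i< → ~-< (w~ i<)) w-inj
          (λ {i} i< → (w~ i< , avoid (w~ i<) (subst (_< f u) (sym (fw i<)) i<)) , w-deg i< , refl)
          (λ {i} i< → ⊓-glb (i≤μ i<) (∸-monoˡ-≤ 1 (≤-trans i< f≤deg)))
          (λ {i} i< → clip< (μ (w i) u) (<-≤-trans (≤-<-trans z≤n i<) f≤deg))
          where
          w : ℕ → ℕ
          w i with i <? f u
          ... | yes i< = proj₁ (lab u<n i<)
          ... | no _   = 0
          spec : ∀ {i} → i < f u → w i ~ u × f (w i) ≡ i × deg u ≤ deg (w i)
          spec {i} i<f with i <? f u
          ... | yes i< = proj₂ (lab u<n i<)
          ... | no i≮  = contradiction i<f i≮
          w~ : ∀ {i} → i < f u → w i ~ u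
          w~ = proj₁ ∘ spec
          fw : ∀ {i} → i < f u → f (w i) ≡ i
          fw = proj₁ ∘ proj₂ ∘ spec
          w-deg : ∀ {i} → i < f u → deg u ≤ deg (w i)
          w-deg = proj₂ ∘ proj₂ ∘ spec
          w-inj : InjectiveBelow (f u) w
          w-inj i< j< eq = trans (sym (fw i<)) (trans (cong f eq) (fw j<))
          f≤deg : f u ≤ deg u
          f≤deg = begin
            f u                                  ≡⟨ trans (sum-const (f u) 1) (*-identityʳ _) ⟨
            sum (f u) (λ _ → 1)                  ≡⟨ sum-cong (f u) (λ i< → sym (ind-yes (u ~? _) (~-sym (w~ i<)))) ⟩
            sum (f u) (λ i → ind (u ~? w i))     ≤⟨ sum-injection (f u) n w (λ v → ind (u ~? v)) (~-< ∘ w~) w-inj ⟩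
            count n (u ~?_)                      ≡⟨ deg≡ u<n ⟨
            deg u                                ∎
            where open ≤-Reasoning
          i≤μ : ∀ {i} → i < f u → i ≤ μ (w i) u
          i≤μ {i} i< = begin
            i                   ≡⟨ fw i< ⟨
            f (w i)             ≤⟨ go (rs fw<) refl (~-< (w~ i<)) (λ _ lt w′≡u → <-asym lt (subst (λ x → f (w i) < f x) (sym w′≡u) fw<)) ⟩
            best (w i) u        ≡⟨ msg (w~ i<) ⟨
            μ (w i) u           ∎
            where
            open ≤-Reasoning
            fw< : f (w i) < f u
            fw< = subst (_< f u) (sym (fw i<)) i<

      label≤top : ∀ {v} → v < n → f v ≤ top v
      label≤top v<n = label≤best v<n (λ w~ _ → <⇒≢ (~-< w~))

  -- `rank` increases from parents to children and drives the inductions over the tree. Acyclicity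
  -- enters through `edge`.
  record RootedTree : Set where
    field
      root   : ℕ
      root<n : root < n
      par    : ℕ → ℕ
      rank   : ℕ → ℕ

    Child : ℕ → ℕ → Set
    Child v w = w ≢ root × par w ≡ v

    field
      rank<n   : ∀ {v} → v < n → rank v < n
      par~     : ∀ {v} → v < n → v ≢ root → par v ~ v
      rank-par : ∀ {v} → v < n → v ≢ root → rank (par v) < rank v
      edge     : ∀ {u v} → u ~ v → Child u v ⊎ Child v u

    child~ : ∀ {v w} → w < n → Child v w → w ~ v
    child~ w<n (w≢r , refl) = ~-sym (par~ w<n w≢r)

    child-asym : ∀ {u v} → u < n → v < n → Child u v → ¬ Child v u
    child-asym {v = v} u<n v<n (v≢r , refl) (u≢r , eq) =
      <-asym (rank-par v<n v≢r) (subst (λ x → rank x < rank (par v)) eq (rank-par u<n u≢r))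

    Gives : (ℕ → ℕ) → ℕ → ℕ → ℕ → Set
    Gives D v d w = Child v w × deg v ≤ deg w × clip v (D w) ≡ d

    child? : ∀ v → Decidable (Child v)
    child? v w = ¬? (w ≟ root) ×-dec (par w ≟ v)

    gives? : ∀ D v d → Decidable (Gives D v d)
    gives? D v d w = child? v w ×-dec ((deg v ≤? deg w) ×-dec (clip v (D w) ≟ d))

  -- The result of the bottom-up pass: D v is the largest label of v within its
  -- subtree, and rk numbers the children of v with the same clipped value.
  record Gathered (T : RootedTree) : Set where
    open RootedTree T
    field
      D   : ℕ → ℕ
      rk  : ℕ → ℕ
      cnt : ℕ → ℕ → ℕ
      cnt≡    : ∀ {v} → v < n → ∀ {d} → d < deg v → cnt v d ≡ count n (gives? D v d)
      D≡      : ∀ {v} → v < n → D v ≡ covered (cnt v) (deg v)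
      rk-onto : ∀ {v} → v < n → ∀ {d} → d < deg v → ∀ {k} → k < cnt v d →
                ∃[ w ] w < n × Gives D v d w × rk w ≡ k

  module _ {T : RootedTree} (Γ : Gathered T) (M S : ℕ → ℕ) where
    open RootedTree T
    open Gathered Γ

    -- The first condition makes `v` an item for its parent at all. Given it, and with `S` holding
    -- the critical values, the second is by `removal` equivalent to the loss of a label when `v` is
    -- left out.
    Drops : ℕ → Set
    Drops v = deg (par v) ≤ deg v × S (par v) ≤ clip (par v) (D v)

    drops? : Decidable Drops
    drops? v = (deg (par v) ≤? deg v) ×-dec (S (par v) ≤? clip (par v) (D v))

    -- The largest label of the parent of v that does not use v.
    above : ℕ → ℕ
    above v = M (par v) ∸ ind (drops? v)

    Up : ℕ → ℕ → Set
    Up v d = v ≢ root × deg v ≤ deg (par v) × clip v (above v) ≡ d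

    up? : ∀ v d → Dec (Up v d)
    up? v d = ¬? (v ≟ root) ×-dec ((deg v ≤? deg (par v)) ×-dec (clip v (above v) ≟ d))

  record Spread {T : RootedTree} (Γ : Gathered T) : Set where
    open Gathered Γ
    field
      M S  : ℕ → ℕ
      cnt′ : ℕ → ℕ → ℕ
      cnt′≡ : ∀ {v} → v < n → ∀ {d} → d < deg v → cnt′ v d ≡ ind (up? Γ M S v d) + cnt v d
      M≡    : ∀ {v} → v < n → M v ≡ covered (cnt′ v) (deg v)
      S≡    : ∀ {v} → v < n → S v ≡ critical (cnt′ v) (deg v)

  module _ {T : RootedTree} {Γ : Gathered T} (Σp : Spread Γ) where
    open RootedTree T
    open Gathered Γ
    open Spread Σp

    -- From `w` to `u`. In the second case `u` is the child, and what its parent sends is stored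
    -- under `u`.
    message : ℕ → ℕ → ℕ
    message w u = choose (child? u w) (D w) (above Γ M S u)

    message-up : ∀ {u w} → Child u w → message w u ≡ D w
    message-up {u} {w} c with child? u w
    ... | yes _ = refl
    ... | no ¬c = contradiction c ¬c

    message-down : ∀ {u w} → u < n → w < n → Child w u → message w u ≡ above Γ M S u
    message-down {u} {w} u<n w<n c with child? u w
    ... | yes c′ = contradiction c (child-asym u<n w<n c′)
    ... | no _   = refl

    offers-parent : ∀ {v} → v < n → ∀ {d} → d < deg v → ∀ {p} → Child p v → offers message v p d ≡ cnt v d
    offers-parent {v} v<n {d} d< {p} v∈p@(v≢r , pv≡p) = trans
      (count-cong n (offers? message v p d) (gives? D v d) to from) (sym (cnt≡ v<n d<))
      where
      to : ∀ {w} → w < n → Offers message v p d w → Gives D v d w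
      to w<n ((w~v , w≢p) , le , eq) with edge w~v
      ... | inj₁ (_ , pv≡w) = contradiction (trans (sym pv≡w) pv≡p) w≢p
      ... | inj₂ c = c , le , trans (cong (clip v) (sym (message-up c))) eq
      from : ∀ {w} → w < n → Gives D v d w → Offers message v p d w
      from w<n (c , le , eq) =
        (child~ w<n c , λ { refl → child-asym v<n w<n c v∈p }) , le , trans (cong (clip v) (message-up c)) eq

    offers-all : ∀ {v} → v < n → ∀ {d} → d < deg v → offers message v n d ≡ cnt′ v d
    offers-all {v} v<n {d} d< = trans (count-insert n (offers? message v n d) (gives? D v d) (up? Γ M S v d)
        par< to from up par∉) (trans (cong (ind (up? Γ M S v d) +_) (sym (cnt≡ v<n d<))) (sym (cnt′≡ v<n d<)))
      where
      -- `count-insert` needs a vertex even if `v` is the root and has no parent; `root` serves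
      -- then, because it is nobody's child.
      x : ℕ
      x with v ≟ root
      ... | yes _ = root
      ... | no _  = par v
      x≡ : v ≢ root → x ≡ par v
      x≡ v≢r with v ≟ root
      ... | yes v≡r = contradiction v≡r v≢r
      ... | no _    = refl
      par< : x < n
      par< with v ≟ root
      ... | yes _  = root<n
      ... | no v≢r = ~-< (par~ v<n v≢r)
      to : ∀ {w} → w < n → Offers message v n d w → Gives D v d w ⊎ (w ≡ x × Up Γ M S v d)
      to w<n ((w~v , _) , le , eq) with edge w~v
      ... | inj₁ c@(v≢r , refl) = inj₂ (sym (x≡ v≢r) , v≢r , le , trans (cong (clip v) (sym (message-down v<n w<n c))) eq)
      ... | inj₂ c = inj₁ (c , le , trans (cong (clip v) (sym (message-up c))) eq)
      from : ∀ {w} → w < n → Gives D v d w → Offers message v n d w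
      from w<n (c , le , eq) = (child~ w<n c , <⇒≢ w<n) , le , trans (cong (clip v) (message-up c)) eq
      up : Up Γ M S v d → Offers message v n d x
      up (v≢r , le , eq) = subst (Offers message v n d) (sym (x≡ v≢r))
        ((par~ v<n v≢r , <⇒≢ p<n) , le , trans (cong (clip v) (message-down v<n p<n (v≢r , refl))) eq)
        where p<n = ~-< (par~ v<n v≢r)
      par∉ : ¬ Gives D v d x
      par∉ ((x≢r , eq) , _) with v ≟ root
      ... | yes _  = contradiction refl x≢r
      ... | no v≢r = child-asym v<n (~-< (par~ v<n v≢r)) (x≢r , eq) (v≢r , refl)

    top≡ : ∀ {v} → v < n → top message v ≡ M v
    top≡ {v} v<n = trans (covered-cong (deg v) (offers-all v<n)) (sym (M≡ v<n))

    -- Towards a parent, leaving it out leaves exactly the children. Towards a child `p` of `u`,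
    -- either the degree of `p` is too small for it to be an item and nothing is lost, or
    -- `covered-remove` takes the item of `p` out of the full count.
    messages : Messages message
    messages {u} {p} u~p with edge (~-sym u~p)
    ... | inj₁ c = begin
      message u p                        ≡⟨ message-up c ⟩
      D u                                ≡⟨ D≡ (~-< u~p) ⟩
      covered (cnt u) (deg u)            ≡⟨ covered-cong (deg u) (λ d< → offers-parent (~-< u~p) d< c) ⟨
      best message u p                   ∎
      where open ≡-Reasoning
    ... | inj₂ c@(p≢r , refl) = down (deg u ≤? deg p)
      where
      open ≡-Reasoning
      p<n = ~-< (~-sym u~p)
      u<n = ~-< u~p
      insert : ∀ {d} → deg u ≤ deg p → d < deg u → cnt′ u d ≡ ind (d ≟ clip u (D p)) + offers message u p d
      insert {d} le d< = trans (sym (offers-all u<n d<)) (count-insert n (offers? message u n d) (offers? message u p d)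
        (d ≟ clip u (D p)) p<n
        (λ {w} _ → λ { ((w~ , _) , le , eq) → case w ≟ p of λ
          { (yes refl) → inj₂ (refl , trans (sym eq) (cong (clip u) (message-up c)))
          ; (no w≢p)   → inj₁ ((w~ , w≢p) , le , eq) } })
        (λ { w<n ((w~ , _) , le , eq) → (w~ , <⇒≢ w<n) , le , eq })
        (λ eq → (~-sym u~p , <⇒≢ p<n) , le , trans (cong (clip u) (message-up c)) (sym eq))
        (λ ((_ , p≢p) , _) → p≢p refl))
      down : Dec (deg u ≤ deg p) → message u p ≡ best message u p
      down (no ≰) = begin
        message u p                        ≡⟨ message-down p<n u<n c ⟩
        M u ∸ ind (drops? Γ M S p)               ≡⟨ cong (M u ∸_) (ind-no (drops? Γ M S p) (≰ ∘ proj₁)) ⟩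
        M u                                ≡⟨ top≡ u<n ⟨
        top message u                      ≡⟨ covered-cong (deg u) (λ {d} d< → count-cong n (offers? message u n d) (offers? message u p d)
                                                (λ { _ ((w~ , _) , le , eq) → (w~ , λ { refl → ≰ le }) , le , eq })
                                                (λ { w<n ((w~ , _) , le , eq) → (w~ , <⇒≢ w<n) , le , eq })) ⟩
        best message u p                   ∎
      down (yes le) = begin
        message u p                        ≡⟨ message-down p<n u<n c ⟩
        M u ∸ ind (drops? Γ M S p)               ≡⟨ cong₂ _∸_ (M≡ u<n) (ind-cong (drops? Γ M S p) (_ ≤? _)
                                                (λ (_ , h) → subst (_≤ clip u (D p)) (S≡ u<n) h)
                                                (λ h → le , subst (_≤ clip u (D p)) (sym (S≡ u<n)) h)) ⟩
        covered (cnt′ u) (deg u) ∸ ind (critical (cnt′ u) (deg u) ≤? clip u (D p))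
                                           ≡⟨ covered-remove (deg u) (insert le) (clip< (D p) (deg>0 u~p)) ⟨
        best message u p                   ∎

  module _ {μ : ℕ → ℕ → ℕ} (msg : Messages μ) {T : RootedTree} (Γ : Gathered T) where
    open RootedTree T
    open Gathered Γ

    -- Induction from the leaves, on `n ∸ rank v`. The messages may come from another rooted tree:
    -- those of the first search thereby predict the outcome of the second bottom-up pass, in
    -- particular its value at the new root.
    gathered≡best : ∀ {v p} → v < n → Child p v ⊎ (v ≡ root × p ≡ n) → D v ≡ best μ v p
    gathered≡best {v} = go (<-wellFounded (n ∸ rank v)) refl
      where
      go : ∀ {k v p} → Acc _<_ k → n ∸ rank v ≡ k → v < n → Child p v ⊎ (v ≡ root × p ≡ n) → D v ≡ best μ v p
      go {v = v} {p} (acc rs) refl v<n v∈p = trans (D≡ v<n) (covered-cong (deg v) (λ {d} d< →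
          trans (cnt≡ v<n d<) (count-cong n (gives? D v d) (offers? μ v p d) to from)))
        where
        D≡μ : ∀ {w} → w < n → Child v w → D w ≡ μ w v
        D≡μ w<n c@(w≢r , refl) = trans (go (rs (∸-monoʳ-< (rank-par w<n w≢r) (<⇒≤ (rank<n w<n)))) refl w<n (inj₁ c))
                                       (sym (msg (child~ w<n c)))
        to : ∀ {d w} → w < n → Gives D v d w → Offers μ v p d w
        to w<n (c , le , eq) = (child~ w<n c , w≢p v∈p) , le , trans (cong (clip v) (sym (D≡μ w<n c))) eq
          where
          w≢p : Child p v ⊎ (v ≡ root × p ≡ n) → _ ≢ p
          w≢p (inj₁ c′) refl = child-asym v<n w<n c c′
          w≢p (inj₂ (_ , refl)) = <⇒≢ w<n
        from : ∀ {d w} → w < n → Offers μ v p d w → Gives D v d w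
        from {d} {w} w<n ((w~v , w≢p) , le , eq) = down (edge w~v) v∈p
          where
          down : Child w v ⊎ Child v w → Child p v ⊎ (v ≡ root × p ≡ n) → Gives D v d w
          down (inj₁ (_ , pv≡w)) (inj₁ (_ , pv≡p)) = contradiction (trans (sym pv≡w) pv≡p) w≢p
          down (inj₁ (v≢r , _))  (inj₂ (v≡r , _))  = contradiction v≡r v≢r
          down (inj₂ c)          _                 = c , le , trans (cong (clip v) (D≡μ w<n c)) eq

    gathered-root : D root ≡ top μ root
    gathered-root = gathered≡best root<n (inj₂ (refl , refl))

  module _ {T : RootedTree} (Γ : Gathered T) where
    open RootedTree T
    open Gathered Γ

    bucket : ℕ → ℕ
    bucket w = clip (par w) (D w)

    -- The label that the greedy count of the parent has for `w`: lower buckets come first, then the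
    -- items of the same bucket in the order of `rk`. A value above `bucket w` marks a surplus item.
    place : ℕ → ℕ
    place w = covered (cnt (par w)) (bucket w) + rk w

    record Assigned (L : ℕ → ℕ) : Set where
      field
        at-root : L root ≡ D root
        placed  : ∀ {w} → w < n → w ≢ root → deg (par w) ≤ deg w → place w ≤ bucket w → L w ≡ place w
        unused  : ∀ {w} → w < n → w ≢ root → ¬ (deg (par w) ≤ deg w × place w ≤ bucket w) → L w ≡ 0

    module _ {L} (A : Assigned L) where
      open Assigned A

      assigned≤ : ∀ {v} → v < n → L v ≤ D v
      assigned≤ {v} v<n with v ≟ root
      ... | yes refl = ≤-reflexive at-root
      ... | no v≢r with (deg (par v) ≤? deg v) ×-dec (place v ≤? bucket v)
      ...   | yes (le , h) = ≤-trans (≤-reflexive (placed v<n v≢r le h)) (≤-trans h (m⊓n≤m (D v) _))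
      ...   | no ¬h = ≤-trans (≤-reflexive (unused v<n v≢r ¬h)) z≤n

      -- As `L u ≤ D u`, a label `i < L u` falls into the interval of some bucket `d`, and the child
      -- numbered `i ∸ covered (cnt u) d` in that bucket is placed exactly at `i`.
      assigned-labelling : Labelling L
      assigned-labelling {u} u<n {i} i<L =
        let d , d< , lo , hi , i≤d = covered-bucket (cnt u) (deg u)
                                       (<-≤-trans i<L (≤-trans (assigned≤ u<n) (≤-reflexive (D≡ u<n))))
            w , w<n , (c@(w≢r , pw) , le , eq) , rk≡ = rk-onto u<n d< (+-cancelˡ-< (covered (cnt u) d) _ _
                                                       (subst (_< covered (cnt u) d + cnt u d) (sym (m+[n∸m]≡n lo)) hi))
        in w , child~ w<n c , good w w<n w≢r pw le eq rk≡ lo i≤d , le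
        where
        good : ∀ {d} w → w < n → w ≢ root → par w ≡ u → deg u ≤ deg w → clip u (D w) ≡ d →
               rk w ≡ i ∸ covered (cnt u) d → covered (cnt u) d ≤ i → i ≤ d → L w ≡ i
        good w w<n w≢r refl le refl rk≡ lo i≤d = trans (placed w<n w≢r le (subst (_≤ bucket w) (sym place≡) i≤d)) place≡
          where
          place≡ : place w ≡ i
          place≡ = trans (cong (covered (cnt u) (bucket w) +_) rk≡) (m+[n∸m]≡n lo)

-- The algorithm

-- CNT and LOW have one cell for each bucket (v , d) with d < deg v, at the address
-- of the d-th neighbour of v in ADJ. In Gather, CNT counts the children in a
-- bucket, LOW is the first label for them, and RNK numbers them.
infix 5 _:=_
_:=_ : Name → Expr → Cmd
x := e = x at lit 0 ≔ e

! : Name → Expr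
! x = x at lit 0

-- `VAL`, `TOP` and `CRIT` hold `D`, `M` and `S`; `QUE` lists the vertices in the order of the
-- search.
N OFF ADJ ORDER LABEL VIS PAR QUE CNT LOW VAL RNK TOP CRIT : Name
N = 0 ; OFF = 1 ; ADJ = 2 ; ORDER = 3 ; LABEL = 4 ; VIS = 5 ; PAR = 6 ; QUE = 7
CNT = 8 ; LOW = 9 ; VAL = 10 ; RNK = 11 ; TOP = 12 ; CRIT = 13

hd tl jj vv uu cc ss rt pp xx : Name
hd = 14 ; tl = 15 ; jj = 16 ; vv = 17 ; uu = 18 ; cc = 19 ; ss = 20 ; rt = 21 ; pp = 22 ; xx = 23

-- `lit 1` always stands on the left of a sum, since `1 + x` reduces to `suc x`.
degree : Expr → Expr
degree v = (OFF at (lit 1 ⊕ v)) ⊖ (OFF at v)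

-- Its `slope` is that of the first argument alone, so an assignment stays gentle although the
-- second is a sum.
minimum : Expr → Expr → Expr
minimum e f = e ⊖ (e ⊖ f)

clipped : Expr → Expr → Expr
clipped v m = minimum (degree v ⊖ lit 1) m

entry : Expr → Expr → Expr
entry v d = OFF at v ⊕ d

leq : Expr → Expr → Expr
leq e f = (lit 1 ⊕ f) ⊖ e

ScanStep Scan ClearMarks ClearCounts Visit BfsStep Bfs GatherUpdate GatherStep Gather : Cmd
PushUp SpreadUpdate SpreadStep Spreading BestStep Best LabelStep Label Pass Main : Cmd

ScanStep =
  -- `cc` runs through the values of `covered` and `ss` through those of `critical`.
  LOW at entry (! uu) (! jj) ≔ ! cc ⨾
  (If (! cc ⊕ CNT at entry (! uu) (! jj)) ⊖ (lit 1 ⊕ ! jj) Then ss := lit 1 ⊕ ! jj Else skip) ⨾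
  cc := minimum (lit 1 ⊕ ! jj) (! cc ⊕ CNT at entry (! uu) (! jj)) ⨾
  jj := lit 1 ⊕ ! jj

Scan =
  jj := lit 0 ⨾
  cc := lit 0 ⨾
  ss := lit 0 ⨾
  While degree (! uu) ⊖ ! jj Do ScanStep

ClearMarks =
  jj := lit 0 ⨾
  While ! N ⊖ ! jj Do (VIS at ! jj ≔ lit 0 ⨾ jj := lit 1 ⊕ ! jj)

ClearCounts =
  jj := lit 0 ⨾
  While OFF at ! N ⊖ ! jj Do (CNT at ! jj ≔ lit 0 ⨾ jj := lit 1 ⊕ ! jj)

Visit =
  vv := ADJ at entry (! uu) (! jj) ⨾
  (If VIS at ! vv Then skip Else (
    VIS at ! vv ≔ lit 1 ⨾
    PAR at ! vv ≔ ! uu ⨾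
    QUE at ! tl ≔ ! vv ⨾
    tl := lit 1 ⊕ ! tl)) ⨾
  jj := lit 1 ⊕ ! jj

BfsStep =
  uu := QUE at ! hd ⨾
  jj := lit 0 ⨾
  (While degree (! uu) ⊖ ! jj Do Visit) ⨾
  hd := lit 1 ⊕ ! hd

Bfs =
  QUE at lit 0 ≔ ! rt ⨾
  VIS at ! rt ≔ lit 1 ⨾
  tl := lit 1 ⨾
  hd := lit 0 ⨾
  -- There is no test for an empty queue: in a connected graph it does not run empty before `N`
  -- vertices have left it, by `queue-nonempty`.
  While ! N ⊖ ! hd Do BfsStep

GatherUpdate =
  VAL at ! uu ≔ ! cc ⨾
  -- Position 0 belongs to the root alone, so the test selects the vertices that have a parent.
  (If ! hd Then (
    pp := PAR at ! uu ⨾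
    (If leq (degree (! pp)) (degree (! uu)) Then (
      xx := clipped (! pp) (! cc) ⨾
      RNK at ! uu ≔ CNT at entry (! pp) (! xx) ⨾
      CNT at entry (! pp) (! xx) ≔ lit 1 ⊕ CNT at entry (! pp) (! xx))
    Else skip))
  Else skip)

GatherStep =
  hd := ! hd ⊖ lit 1 ⨾
  uu := QUE at ! hd ⨾
  Scan ⨾
  GatherUpdate

Gather =
  hd := ! N ⨾
  While ! hd Do GatherStep

PushUp =
  xx := clipped (! uu) (! xx) ⨾
  CNT at entry (! uu) (! xx) ≔ lit 1 ⊕ CNT at entry (! uu) (! xx)

SpreadUpdate =
  Scan ⨾
  TOP at ! uu ≔ ! cc ⨾
  CRIT at ! uu ≔ ! ss ⨾
  hd := lit 1 ⊕ ! hd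

SpreadStep =
  uu := QUE at ! hd ⨾
  (If ! hd Then (
    pp := PAR at ! uu ⨾
    (If leq (degree (! uu)) (degree (! pp)) Then (
      xx := TOP at ! pp ⨾
      (If leq (degree (! pp)) (degree (! uu)) Then
        (If leq (CRIT at ! pp) (clipped (! pp) (VAL at ! uu)) Then xx := ! xx ⊖ lit 1 Else skip)
      Else skip) ⨾
      PushUp)
    Else skip))
  Else skip) ⨾
  SpreadUpdate

Spreading =
  hd := lit 0 ⨾
  While ! N ⊖ ! hd Do SpreadStep

BestStep =
  (If TOP at ! vv ⊖ TOP at ! rt Then rt := ! vv Else skip) ⨾
  vv := lit 1 ⊕ ! vv

Best =
  rt := lit 0 ⨾
  vv := lit 0 ⨾
  While ! N ⊖ ! vv Do BestStep

LabelStep =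
  uu := QUE at ! hd ⨾
  pp := PAR at ! uu ⨾
  xx := clipped (! pp) (VAL at ! uu) ⨾
  LABEL at ! uu ≔ lit 0 ⨾
  (If leq (degree (! pp)) (degree (! uu)) Then
    (If leq (LOW at entry (! pp) (! xx) ⊕ RNK at ! uu) (! xx) Then
      -- After the test this minimum equals its second argument. The bare sum would have slope 2 and
      -- not be gentle.
      LABEL at ! uu ≔ minimum (! xx) (LOW at entry (! pp) (! xx) ⊕ RNK at ! uu)
    Else skip)
  Else skip) ⨾
  hd := lit 1 ⊕ ! hd

Label =
  LABEL at ! rt ≔ VAL at ! rt ⨾
  hd := lit 1 ⨾
  While ! N ⊖ ! hd Do LabelStep

-- The second pass meets the marks of the first, and counts to which `Spreading` has added the
-- parents; hence the clearing.
Pass = ClearMarks ⨾ ClearCounts ⨾ Bfs ⨾ Gather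

Main =
  rt := lit 0 ⨾
  Pass ⨾
  Spreading ⨾
  Best ⨾
  Pass ⨾
  Label ⨾
  ORDER at lit 0 ≔ lit 1 ⊕ VAL at ! rt

main-gentle : T (Gentle Main)
main-gentle = tt

-- Memory layout and the sweep over the buckets of a vertex

minimum≡ : ∀ a b → a ∸ (a ∸ b) ≡ a ⊓ b
minimum≡ a b with ≤-total b a
... | inj₁ b≤a = trans (m∸[m∸n]≡n b≤a) (sym (m≥n⇒m⊓n≡n b≤a))
... | inj₂ a≤b = trans (cong (a ∸_) (m≤n⇒m∸n≡0 a≤b)) (sym (m≤n⇒m⊓n≡m a≤b))

-- A branch of `k` steps is charged the budget `K` of one iteration; the comparison of the two
-- literals is settled by computation.
later : ∀ k K {t X} {k≤K : T (k ≤ᵇ K)} → t ≤ X → k + t ≤ K + X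
later k K {k≤K = k≤K} = +-mono-≤ (≤ᵇ⇒≤ k K k≤K)

module _ (Net : Network) where
  open Network Net

  -- What the verification uses of the input. The order within an adjacency list stays open.
  record Layout (off adj : ℕ → ℕ) : Set where
    field
      off-zero : off 0 ≡ 0
      off-suc  : ∀ {v} → v < n → off (suc v) ≡ off v + deg v
      slot     : ∀ {v} → v < n → ∀ {d} → d < deg v → v ~ adj (off v + d)
      slot-of  : ∀ {u v} → v ~ u → ∃[ d ] d < deg v × adj (off v + d) ≡ u

    off-mono : ∀ {u v} → u < v → v ≤ n → off u + deg u ≤ off v
    off-mono {u} {suc v} u<v v<n with u ≟ v
    ... | yes refl = ≤-reflexive (sym (off-suc v<n))
    ... | no u≢v   = ≤-trans (off-mono (≤∧≢⇒< (s≤s⁻¹ u<v) u≢v) (<⇒≤ v<n))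
                             (≤-trans (m≤m+n _ _) (≤-reflexive (sym (off-suc v<n))))

    -- The lists follow one another without overlap. Thus writing to a bucket of one vertex leaves
    -- the buckets of all others intact.
    disjoint : ∀ {u v d e} → u < n → v < n → d < deg u → e < deg v → off u + d ≡ off v + e → u ≡ v
    disjoint {u} {v} {d} {e} u<n v<n d< e< eq with <-cmp u v
    ... | tri≈ _ u≡v _ = u≡v
    ... | tri< u<v _ _ = contradiction eq
      (<⇒≢ (<-≤-trans (+-monoʳ-< (off u) d<) (≤-trans (off-mono u<v (<⇒≤ v<n)) (m≤m+n _ e))))
    ... | tri> _ _ v<u = contradiction (sym eq)
      (<⇒≢ (<-≤-trans (+-monoʳ-< (off v) e<) (≤-trans (off-mono v<u (<⇒≤ u<n)) (m≤m+n _ d))))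

    off-total : ∀ {v} → v ≤ n → off v ≡ sum v deg
    off-total {zero}  _   = off-zero
    off-total {suc v} v<n = trans (off-suc v<n) (trans (cong (_+ deg v) (off-total (<⇒≤ v<n))) (+-comm _ (deg v)))

module _ {Net : Network} {off adj : ℕ → ℕ} (Lay : Layout Net off adj) where
  open Network Net
  open Layout Lay

  record Loaded (σ : Store) : Set where
    field
      size : σ N 0 ≡ n
      off≡ : ∀ i → σ OFF i ≡ off i
      adj≡ : ∀ i → σ ADJ i ≡ adj i

    degree≡ : ∀ {x v} → σ x 0 ≡ v → v < n → eval (degree (! x)) σ ≡ deg v
    degree≡ {v = v} refl v<n = trans (cong₂ _∸_ (trans (off≡ _) (off-suc v<n)) (off≡ v)) (m+n∸m≡n (off v) (deg v))

    entry≡ : ∀ {x v} → σ x 0 ≡ v → ∀ {y d} → σ y 0 ≡ d → eval (entry (! x) (! y)) σ ≡ off v + d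
    entry≡ refl refl = cong (_+ _) (off≡ _)

  open Loaded

  loaded-keep : ∀ {σ σ′} → (∀ i → σ′ N i ≡ σ N i) → (∀ i → σ′ OFF i ≡ σ OFF i) → (∀ i → σ′ ADJ i ≡ σ ADJ i) →
                Loaded σ → Loaded σ′
  loaded-keep eN eO eA L = record
    { size = trans (eN 0) (L .size)
    ; off≡ = λ i → trans (eO i) (L .off≡ i)
    ; adj≡ = λ i → trans (eA i) (L .adj≡ i)
    }

  loaded-run : ∀ {p σ σ′ t} → Run p σ σ′ t → assigns N p ≡ false → assigns OFF p ≡ false → assigns ADJ p ≡ false →
               Loaded σ → Loaded σ′
  loaded-run r f₀ f₁ f₂ = loaded-keep (frame r N f₀) (frame r OFF f₁) (frame r ADJ f₂)

  region : (ℕ → ℕ) → ℕ → ℕ → ℕ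
  region cnt v d = cnt (off v + d)

  record Scanned (σ : Store) (u : ℕ) (σ′ : Store) : Set where
    field
      total     : σ′ cc 0 ≡ covered (region (σ CNT) u) (deg u)
      threshold : σ′ ss 0 ≡ critical (region (σ CNT) u) (deg u)
      lows      : ∀ {d} → d < deg u → σ′ LOW (off u + d) ≡ covered (region (σ CNT) u) d
      elsewhere : ∀ {a} → (∀ {d} → d < deg u → a ≢ off u + d) → σ′ LOW a ≡ σ LOW a

  -- Six steps per bucket: the loop test, three assignments, and the conditional with its branch.
  -- The initial assignments and the last test make up the 4.
  scan : ∀ {σ u} → Loaded σ → u < n → σ uu 0 ≡ u →
         Halts Scan σ (λ σ′ s → Scanned σ u σ′ × s ≤ 4 + deg u * 6)
  scan {σ} {u} L u<n refl = verify Scan (λ σ′ s → Scanned σ u σ′ × s ≤ 4 + deg u * 6) (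
      let σ′ , t , r , (j≡ , c≡ , s≡ , lo , el , t≤) =
            for-loop {degree (! uu) ⊖ ! jj} (deg u) I {σ₁} {3} step stop (refl , refl , refl , (λ ()) , (λ _ → refl) , ≤-refl)
      in σ′ , suc t , r , record { total = c≡ ; threshold = s≡ ; lows = lo ; elsewhere = el } , s≤s (≤-trans t≤ (≤-reflexive (+-comm _ 3))))
    where
    k : ℕ → ℕ
    k = region (σ CNT) u

    σ₁ : Store
    σ₁ = write ss 0 0 (write cc 0 0 (write jj 0 0 σ))

    I : ℕ → Store → ℕ → Set
    I i σ′ t = σ′ jj 0 ≡ i × σ′ cc 0 ≡ covered k i × σ′ ss 0 ≡ critical k i ×
               (∀ {d} → d < i → σ′ LOW (off u + d) ≡ covered k d) ×
               (∀ {a} → (∀ {d} → d < deg u → a ≢ off u + d) → σ′ LOW a ≡ σ LOW a) × t ≤ i * 6 + 3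

    module _ {σ′} (keep : Keeps ScanStep σ₁ σ′) where
      L′ : Loaded σ′
      L′ = loaded-keep (keep N refl) (keep OFF refl) (keep ADJ refl) L
      u≡ : σ′ uu 0 ≡ u
      u≡ = keep uu refl 0

    step : ∀ {i σ′ t′} → i < deg u → Keeps ScanStep σ₁ σ′ → I i σ′ t′ →
           eval (degree (! uu) ⊖ ! jj) σ′ ≢ 0 × wp ScanStep (I (suc i)) σ′ (suc t′)
    step {i} {σ′} {t′} i< keep (refl , c≡ , s≡ , lo , el , t≤) =
      m>n⇒m∸n≢0 (subst (i <_) (sym (degree≡ (L′ keep) {uu} (u≡ keep) u<n)) i<) ,
      (λ ne → refl , c′ , sym (yes-crit ne) , lo′ , el′ , later 6 6 t≤) ,
      (λ eq → refl , c′ , trans s≡ (sym (no-crit eq)) , lo′ , el′ , later 6 6 t≤)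
      where
      a≡ : σ′ OFF (σ′ uu 0) + i ≡ off u + i
      a≡ = entry≡ (L′ keep) {uu} (u≡ keep) {jj} refl
      x : ℕ
      x = σ′ cc 0 + σ′ CNT (σ′ OFF (σ′ uu 0) + i)
      x≡ : x ≡ covered k i + k i
      x≡ = cong₂ _+_ c≡ (trans (keep CNT refl _) (cong (σ CNT) a≡))
      c′ : suc i ∸ (suc i ∸ x) ≡ covered k (suc i)
      c′ = trans (minimum≡ (suc i) x) (cong (suc i ⊓_) x≡)
      yes-crit : x ∸ suc i ≢ 0 → critical k (suc i) ≡ suc i
      yes-crit ne with suc i <? covered k i + k i
      ... | yes _ = refl
      ... | no ≮  = contradiction (m≤n⇒m∸n≡0 (≤-trans (≤-reflexive x≡) (≮⇒≥ ≮))) ne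
      no-crit : x ∸ suc i ≡ 0 → critical k (suc i) ≡ critical k i
      no-crit eq with suc i <? covered k i + k i
      ... | yes lt = contradiction (m∸n≡0⇒m≤n eq) (<⇒≱ (<-≤-trans lt (≤-reflexive (sym x≡))))
      ... | no _   = refl
      lo′ : ∀ {d} → d < suc i → update (σ′ LOW) (σ′ OFF (σ′ uu 0) + i) (σ′ cc 0) (off u + d) ≡ covered k d
      lo′ {d} d< rewrite a≡ with d ≟ i
      ... | yes refl = trans (update-same (σ′ LOW) _ _) c≡
      ... | no d≢i   = trans (update-other (σ′ LOW) _ (λ eq → d≢i (sym (+-cancelˡ-≡ (off u) _ _ eq))))
                             (lo (≤∧≢⇒< (s≤s⁻¹ d<) d≢i))
      el′ : ∀ {a} → (∀ {d} → d < deg u → a ≢ off u + d) →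
            update (σ′ LOW) (σ′ OFF (σ′ uu 0) + i) (σ′ cc 0) a ≡ σ LOW a
      el′ out rewrite a≡ = trans (update-other (σ′ LOW) _ (λ eq → out i< (sym eq))) (el out)

    stop : ∀ {σ′ t′} → Keeps ScanStep σ₁ σ′ → I (deg u) σ′ t′ → eval (degree (! uu) ⊖ ! jj) σ′ ≡ 0
    stop {σ′} keep (j≡ , _) = trans (cong₂ _∸_ (degree≡ (L′ keep) {uu} (u≡ keep) u<n) j≡) (n∸n≡0 (deg u))

-- Breadth-first search

module _ (Net : Network) where
  open Network Net

  work : ℕ → ℕ → ℕ
  work α β = sum n (λ v → α + β * deg v)

  -- Connectivity as an induction principle. Applied to the property of being marked, it replaces
  -- any reasoning about walks.
  ReachesAll : ℕ → Set₁
  ReachesAll r = ∀ (P : ℕ → Set) → P r → (∀ {u v} → P u → u ~ v → P v) → ∀ {v} → v < n → P v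

  -- `h` vertices have left the queue and `t` have entered it. By `queued` and `done`, the marked
  -- set is closed under adjacency once `h` has reached `t`.
  record Queue (root h : ℕ) (vis par que : ℕ → ℕ) (t : ℕ) : Set where
    field
      que<   : ∀ {i} → i < t → que i < n
      inj    : InjectiveBelow t que
      first  : que 0 ≡ root
      some   : 0 < t
      marked : ∀ {i} → i < t → vis (que i) ≢ 0
      queued : ∀ {v} → v < n → vis v ≢ 0 → ∃[ i ] i < t × que i ≡ v
      parent : ∀ {i} → i < t → 0 < i → ∃[ k ] k < i × par (que i) ≡ que k × que k ~ que i
      done   : ∀ {i} → i < h → i < t → ∀ {w} → que i ~ w → vis w ≢ 0

  open Queue

  queue-start : ∀ {root vis par que} → root < n → (∀ {v} → v < n → vis v ≡ 0) →
                Queue root 0 (update vis root 1) par (update que 0 root) 1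
  queue-start {root} {vis} {par} {que} r<n clear = record
    { que<   = λ { (s≤s z≤n) → r<n }
    ; inj    = λ { (s≤s z≤n) (s≤s z≤n) _ → refl }
    ; first  = refl
    ; some   = s≤s z≤n
    ; marked = λ { (s≤s z≤n) eq → 1+n≢0 (trans (sym (update-same vis root 1)) eq) }
    ; queued = λ {v} v<n ne → 0 , s≤s z≤n , (case root ≟ v of λ
        { (yes eq) → eq
        ; (no r≢v) → contradiction (trans (update-other vis 1 r≢v) (clear v<n)) ne })
    ; parent = λ { (s≤s z≤n) () }
    ; done   = λ ()
    }

  queue-extend : ∀ {root h vis par que t w} → Queue root h vis par que t → h < t →
                 que h ~ w → vis w ≡ 0 →
                 Queue root h (update vis w 1) (update par w (que h)) (update que t w) (suc t)
  queue-extend {root} {h} {vis} {par} {que} {t} {w} Q h<t e fresh = record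
    { que<   = λ {i} i< → [ (λ i<t → subst (_< n) (sym (old i<t)) (Q .que< i<t)) , (λ { refl → subst (_< n) (sym new) (~-< (~-sym e)) }) ]′ (last i<)
    ; inj    = λ {i} {j} i< j< eq → inj′ (last i<) (last j<) eq
    ; first  = trans (old (Q .some)) (Q .first)
    ; some   = z<s
    ; marked = λ {i} i< → mark ([ (λ i<t → inj₁ (subst (λ x → vis x ≢ 0) (sym (old i<t)) (Q .marked i<t)))
                                , (λ { refl → inj₂ new }) ]′ (last i<))
    ; queued = λ {v} v<n ne → case w ≟ v of λ
        { (yes refl) → t , ≤-refl , new
        ; (no w≢v) → let i , i<t , eq = Q .queued v<n (ne ∘ trans (update-other vis 1 w≢v))
                     in i , m<n⇒m<1+n i<t , trans (old i<t) eq }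
    ; parent = λ {i} i< 0<i → [ (λ i<t → let k , k<i , p≡ , e = Q .parent i<t 0<i in k , k<i ,
                                   trans (trans (cong (update par w (que h)) (old i<t))
                                            (update-other par _ (fresh≢ i<t ∘ sym)))
                                         (trans p≡ (sym (old (<-trans k<i i<t)))) ,
                                   subst₂ _~_ (sym (old (<-trans k<i i<t))) (sym (old i<t)) e)
                              , (λ { refl → h , h<t , trans (trans (cong (update par w (que h)) new) (update-same par w _))
                                         (sym (old h<t)) ,
                                   subst₂ _~_ (sym (old h<t)) (sym new) e }) ]′ (last i<)
    ; done   = λ {i} i<h i< {x} e′ → mark (inj₁ (Q .done i<h (<-trans i<h h<t) (subst (_~ x) (old (<-trans i<h h<t)) e′)))
    }
    where
    last : ∀ {i} → i < suc t → i < t ⊎ i ≡ t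
    last = m≤n⇒m<n∨m≡n ∘ s≤s⁻¹
    old : ∀ {i} → i < t → update que t w i ≡ que i
    old i<t = update-other que w (<⇒≢ i<t ∘ sym)
    new : update que t w t ≡ w
    new = update-same que t w
    fresh≢ : ∀ {i} → i < t → que i ≢ w
    fresh≢ i<t eq = Q .marked i<t (trans (cong vis eq) fresh)
    inj′ : ∀ {i j} → i < t ⊎ i ≡ t → j < t ⊎ j ≡ t → update que t w i ≡ update que t w j → i ≡ j
    inj′ (inj₁ i<) (inj₁ j<) eq = Q .inj i< j< (trans (sym (old i<)) (trans eq (old j<)))
    inj′ (inj₁ i<) (inj₂ refl) eq = contradiction (trans (sym (old i<)) (trans eq new)) (fresh≢ i<)
    inj′ (inj₂ refl) (inj₁ j<) eq = contradiction (trans (sym (old j<)) (trans (sym eq) new)) (fresh≢ j<)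
    inj′ (inj₂ i≡) (inj₂ j≡) _ = trans i≡ (sym j≡)
    mark : ∀ {v} → vis v ≢ 0 ⊎ v ≡ w → update vis w 1 v ≢ 0
    mark {v} h eq with w ≟ v
    ... | yes refl = 1+n≢0 (trans (sym (update-same vis w 1)) eq)
    mark {v} (inj₁ ne) eq | no w≢v = ne (trans (sym (update-other vis 1 w≢v)) eq)
    mark {v} (inj₂ v≡w) eq | no w≢v = w≢v (sym v≡w)

  queue-next : ∀ {root h vis par que t} → Queue root h vis par que t →
               (∀ {w} → que h ~ w → vis w ≢ 0) → Queue root (suc h) vis par que t
  queue-next {h = h} Q all = record
    { que< = Q .que< ; inj = Q .inj ; first = Q .first ; some = Q .some ; marked = Q .marked
    ; queued = Q .queued ; parent = Q .parent
    ; done = λ {i} i< i<t → case i ≟ h of λ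
        { (yes refl) → all
        ; (no i≢h) → Q .done (≤∧≢⇒< (s≤s⁻¹ i<) i≢h) i<t }
    }

  module _ {root h vis par que t} (Q : Queue root h vis par que t) (reach : ReachesAll root) where

    private
      all-marked : t ≤ h → ∀ {v} → v < n → vis v ≢ 0
      all-marked t≤h = reach (λ v → vis v ≢ 0) (subst (λ v → vis v ≢ 0) (Q .first) (Q .marked (Q .some)))
        (λ {u} ne e → let i , i<t , eq = Q .queued (~-< e) ne
                      in Q .done (<-≤-trans i<t t≤h) i<t (subst (_~ _) (sym eq) e))

    queue-all : t ≤ h → ∀ {v} → v < n → ∃[ i ] i < t × que i ≡ v
    queue-all t≤h v<n = Q .queued v<n (all-marked t≤h v<n)

    module _ (t≤h : t ≤ h) where
      position : ℕ → ℕ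
      position v with v <? n
      ... | yes v<n = proj₁ (queue-all t≤h v<n)
      ... | no _    = 0

      position< : ∀ {v} → v < n → position v < t
      position< {v} v<n with v <? n
      ... | yes v<n′ = proj₁ (proj₂ (queue-all t≤h v<n′))
      ... | no v≮n   = contradiction v<n v≮n

      que-position : ∀ {v} → v < n → que (position v) ≡ v
      que-position {v} v<n with v <? n
      ... | yes v<n′ = proj₂ (proj₂ (queue-all t≤h v<n′))
      ... | no v≮n   = contradiction v<n v≮n

      position-que : ∀ {i} → i < t → position (que i) ≡ i
      position-que i<t = Q .inj (position< (Q .que< i<t)) i<t (que-position (Q .que< i<t))

      queue-full : n ≤ t
      queue-full = pigeonhole n t position position< (λ i< j< eq →
        trans (sym (que-position i<)) (trans (cong que eq) (que-position j<)))

    queue-length : t ≤ n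
    queue-length = pigeonhole t n que (Q .que<) (Q .inj)

    -- Had the head caught up with the tail, the queue would contain all `n` vertices, so at least
    -- `n` would have left it.
    queue-nonempty : h < n → h < t
    queue-nonempty h<n with h <? t
    ... | yes h<t = h<t
    ... | no h≮t  = contradiction (queue-full (≮⇒≥ h≮t)) (<⇒≱ (≤-<-trans (≮⇒≥ h≮t) h<n))

  record Traversal (root : ℕ) (par que : ℕ → ℕ) : Set where
    field
      root<n   : root < n
      rank     : ℕ → ℕ
      rank<n   : ∀ {v} → v < n → rank v < n
      que<n    : ∀ {i} → i < n → que i < n
      rank-que : ∀ {i} → i < n → rank (que i) ≡ i
      que-rank : ∀ {v} → v < n → que (rank v) ≡ v
      que-root : que 0 ≡ root
      par~     : ∀ {v} → v < n → v ≢ root → par v ~ v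
      rank-par : ∀ {v} → v < n → v ≢ root → rank (par v) < rank v

    que-injective : InjectiveBelow n que
    que-injective i< j< eq = trans (sym (rank-que i<)) (trans (cong rank eq) (rank-que j<))

  traversal : ∀ {root vis par que t} → Queue root n vis par que t → ReachesAll root → Traversal root par que
  traversal {root} {vis} {par} {que} {t} Q reach = record
    { root<n   = subst (_< n) (Q .first) (Q .que< (Q .some))
    ; rank     = pos
    ; rank<n   = λ v<n → <-≤-trans (position< Q reach t≤n v<n) t≤n
    ; que<n    = λ i<n → Q .que< (<-≤-trans i<n n≤t)
    ; rank-que = λ i<n → position-que Q reach t≤n (<-≤-trans i<n n≤t)
    ; que-rank = que-position Q reach t≤n
    ; que-root = Q .first
    ; par~     = λ v<n v≢r → proj₁ (up v<n v≢r)
    ; rank-par = λ v<n v≢r → proj₂ (up v<n v≢r)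
    }
    where
    t≤n = queue-length Q reach
    n≤t = queue-full Q reach t≤n
    pos = position Q reach t≤n
    up : ∀ {v} → v < n → v ≢ root → par v ~ v × pos (par v) < pos v
    up {v} v<n v≢r =
      let q≡v = que-position Q reach t≤n v<n
          pos<t = position< Q reach t≤n v<n
          k , k<i , p≡ , e = Q .parent pos<t
            (n≢0⇒n>0 (λ eq → v≢r (trans (sym q≡v) (trans (cong que eq) (Q .first)))))
          p≡′ = trans (cong par (sym q≡v)) p≡
      in subst₂ _~_ (sym p≡′) q≡v e ,
         subst (_< pos v) (sym (trans (cong pos p≡′) (position-que Q reach t≤n (<-trans k<i pos<t)))) k<i

module _ {Net : Network} {off adj : ℕ → ℕ} (Lay : Layout Net off adj) where
  open Network Net
  open Layout Lay
  open Loaded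

  module _ {σ root} (L : Loaded Lay σ) (rt≡ : σ rt 0 ≡ root) (root<n : root < n) (reach : ReachesAll Net root)
           (clear : ∀ {v} → v < n → σ VIS v ≡ 0) where

    private
      Costs : (ℕ → ℕ) → ℕ → ℕ
      -- Eight steps for an adjacency entry: the loop test and the longer branch through `Visit`.
      -- The five further steps per vertex are rounded up to six.
      Costs que h = sum h (λ i → 6 + 8 * deg (que i))

      Queued : ℕ → Store → Set
      Queued h σ′ = Queue Net root h (σ′ VIS) (σ′ PAR) (σ′ QUE) (σ′ tl 0)

      I : ℕ → Store → ℕ → Set
      I h σ′ t = σ′ hd 0 ≡ h × Queued h σ′ × t ≤ Costs (σ′ QUE) h + 4

      module _ {σ₀} (L : Loaded Lay σ₀) (u<n : σ₀ uu 0 < n) where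
        u : ℕ
        u = σ₀ uu 0

        target : ℕ → ℕ
        target d = adj (off u + d)

        Inner : ℕ → ℕ → ℕ → Store → ℕ → Set
        -- New entries go to `QUE` beyond position `h`, so the current vertex and the costs already
        -- summed stay fixed.
        Inner h t₀ d σ′ t = σ′ jj 0 ≡ d × Queued h σ′ × h < σ′ tl 0 × (∀ {i} → i ≤ h → σ′ QUE i ≡ σ₀ QUE i) ×
                   (∀ {e} → e < d → σ′ VIS (target e) ≢ 0) × t ≤ d * 8 + t₀

        module _ {σ′} (keep : Keeps Visit σ₀ σ′) where
          loaded-kept : Loaded Lay σ′
          loaded-kept = loaded-keep Lay (keep N refl) (keep OFF refl) (keep ADJ refl) L

          degree-kept : σ′ OFF (suc (σ′ uu 0)) ∸ σ′ OFF (σ′ uu 0) ≡ deg u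
          degree-kept = degree≡ loaded-kept {uu} (keep uu refl 0) u<n

          target-kept : ∀ d → σ′ ADJ (σ′ OFF (σ′ uu 0) + d) ≡ target d
          target-kept d = trans (adj≡ loaded-kept _) (cong (λ x → adj (x + d)) (trans (off≡ loaded-kept _) (cong off (keep uu refl 0))))

        visit : ∀ {h t₀} → σ₀ QUE h ≡ u → ∀ {d σ′ t} → d < deg u → Keeps Visit σ₀ σ′ → Inner h t₀ d σ′ t →
                eval (degree (! uu) ⊖ ! jj) σ′ ≢ 0 × wp Visit (Inner h t₀ (suc d)) σ′ (suc t)
        visit {h} {t₀} q≡u {d} {σ′} {t} d< keep (refl , Q , h<t , same , seen , t≤) =
          m>n⇒m∸n≢0 (subst (d <_) (sym (degree-kept keep)) d<) ,
          (λ ne → refl , Q , h<t , same ,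
            (λ {e} e< → case e ≟ d of λ
              { (yes refl) → ne ∘ trans (cong (σ′ VIS) (target-kept keep d))
              ; (no e≢d) → seen (≤∧≢⇒< (s≤s⁻¹ e<) e≢d) }) , later 5 8 t≤) ,
          (λ eq →
            let q≡ = trans (same ≤-refl) q≡u
                w≡ = target-kept keep d
            in refl ,
               subst (λ x → Queue Net root h (update (σ′ VIS) w 1) (update (σ′ PAR) w x) (update (σ′ QUE) (σ′ tl 0) w) (suc (σ′ tl 0)))
                     (trans q≡ (sym (keep uu refl 0)))
                     (queue-extend Net Q h<t (subst₂ _~_ (sym q≡) (sym w≡) (slot u<n d<)) eq) ,
               m<n⇒m<1+n h<t ,
               (λ i≤h → trans (update-other (σ′ QUE) w (<⇒≢ (≤-<-trans i≤h h<t) ∘ sym)) (same i≤h)) ,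
               (λ {e} e< → case w ≟ target e of λ
                 { (yes w≡e) eq′ → 1+n≢0 (trans (sym (trans (cong (update (σ′ VIS) w 1) (sym w≡e)) (update-same (σ′ VIS) w 1))) eq′)
                 ; (no w≢e) eq′ → seen (≤∧≢⇒< (s≤s⁻¹ e<) (λ { refl → w≢e w≡ })) (trans (sym (update-other (σ′ VIS) 1 w≢e)) eq′) }) ,
               later 8 8 t≤)
          where
          w : ℕ
          w = σ′ ADJ (σ′ OFF (σ′ uu 0) + d)

      σ₁ : Store
      σ₁ = write hd 0 0 (write tl 0 1 (write VIS (σ rt 0) 1 (write QUE 0 (σ rt 0) σ)))

      step : ∀ {h σ′ t} → h < n → Keeps BfsStep σ₁ σ′ → I h σ′ t →
             eval (! N ⊖ ! hd) σ′ ≢ 0 × wp BfsStep (I (suc h)) σ′ (suc t)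
      step {h} {σ′} {t} h<n keep (refl , Q , t≤) =
        m>n⇒m∸n≢0 (subst (h <_) (sym (trans (keep N refl 0) (size L))) h<n) ,
        (let u<n = Queue.que< Q h<t
             σ″ , t″ , r , (j≡ , Q′ , h<t′ , same , seen , t≤′) =
               for-loop {degree (! uu) ⊖ ! jj} {Visit} (deg (σ′ QUE h)) (Inner L′ u<n h (3 + t)) {σ₂} {3 + t} (visit L′ u<n refl)
                 (λ {σ″} keep′ (j≡ , _) → trans (cong₂ _∸_ (degree-kept L′ u<n keep′) j≡) (n∸n≡0 (deg (σ′ QUE h))))
                 (refl , Q , h<t , (λ _ → refl) , (λ ()) , ≤-refl)
         in σ″ , suc t″ , r ,
            cong suc (frame r hd refl 0) ,
            queue-next Net Q′ (λ {w} e → let d , d< , eq = slot-of (subst (_~ w) (same ≤-refl) e) in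
              subst (λ x → σ″ VIS x ≢ 0) eq (seen d<)) ,
            cost {σ″} same t≤′)
        where
        h<t : h < σ′ tl 0
        h<t = queue-nonempty Net Q reach h<n
        σ₂ : Store
        σ₂ = write jj 0 0 (write uu 0 (σ′ QUE h) σ′)
        L′ : Loaded Lay σ₂
        L′ = loaded-keep Lay (keep N refl) (keep OFF refl) (keep ADJ refl) L
        cost : ∀ {σ″ t″} → (∀ {i} → i ≤ h → σ″ QUE i ≡ σ′ QUE i) →
               t″ + (3 + t) ≤ deg (σ′ QUE h) * 8 + (3 + t) →
               2 + (t″ + (3 + t)) ≤ Costs (σ″ QUE) (suc h) + 4
        cost {σ″} {t″} same t≤′ = begin
          2 + (t″ + (3 + t))                                       ≤⟨ +-monoʳ-≤ 2 t≤′ ⟩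
          2 + (deg (σ′ QUE h) * 8 + (3 + t))                       ≤⟨ +-monoʳ-≤ 2 (+-monoʳ-≤ (deg (σ′ QUE h) * 8) (+-monoʳ-≤ 3 t≤)) ⟩
          2 + (deg (σ′ QUE h) * 8 + (3 + (Costs (σ′ QUE) h + 4)))  ≤⟨ +-monoʳ-≤ 2 (≤-reflexive rearrange) ⟩
          5 + 8 * deg (σ′ QUE h) + Costs (σ′ QUE) h + 4            ≤⟨ n≤1+n _ ⟩
          6 + 8 * deg (σ′ QUE h) + Costs (σ′ QUE) h + 4            ≡⟨ cong (_+ 4) (cong₂ _+_ (cong (λ x → 6 + 8 * deg x) (same ≤-refl))
                                                                       (sum-cong h (λ i<h → cong (λ x → 6 + 8 * deg x) (same (<⇒≤ i<h))))) ⟨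
          Costs (σ″ QUE) (suc h) + 4                               ∎
          where
          open ≤-Reasoning
          rearrange : deg (σ′ QUE h) * 8 + (3 + (Costs (σ′ QUE) h + 4)) ≡ 3 + 8 * deg (σ′ QUE h) + Costs (σ′ QUE) h + 4
          rearrange = solve 2 (λ a b → a :* con 8 :+ (con 3 :+ (b :+ con 4)) ⊜ con 3 :+ con 8 :* a :+ b :+ con 4)
                        refl (deg (σ′ QUE h)) (Costs (σ′ QUE) h)

    bfs : Halts Bfs σ (λ σ′ t → Traversal Net root (σ′ PAR) (σ′ QUE) × t ≤ 5 + work Net 6 8)
    bfs = verify Bfs (λ σ′ t → Traversal Net root (σ′ PAR) (σ′ QUE) × t ≤ 5 + work Net 6 8) (
      let σ′ , t , r , (h≡ , Q , t≤) = for-loop n I {σ₁} {4} step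
            (λ keep (h≡ , _) → trans (cong₂ _∸_ (trans (keep N refl 0) (size L)) h≡) (n∸n≡0 n))
            (refl , start , ≤-refl)
          T = traversal Net Q reach
      in σ′ , suc t , r , T ,
         s≤s (≤-trans t≤ (≤-trans (+-monoˡ-≤ 4 (sum-injection n n (σ′ QUE) _ (Traversal.que<n T) (Traversal.que-injective T)))
                                  (≤-reflexive (+-comm _ 4)))))
      where
      start : Queued 0 σ₁
      start rewrite rt≡ = queue-start Net root<n clear

-- The bottom-up pass

-- Quantified over all parent functions with decreasing ranks, because the two search trees are
-- known only after the runs that build them.
Treelike : Network → Set
Treelike Net = ∀ root (par rank : ℕ → ℕ) → (∀ {v} → v < n → v ≢ root → par v ~ v) →
               (∀ {v} → v < n → v ≢ root → rank (par v) < rank v) →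
               ∀ {u v} → u ~ v → (v ≢ root × par v ≡ u) ⊎ (u ≢ root × par u ≡ v)
  where open Network Net

spanning : ∀ {Net root par que} → Treelike Net → Traversal Net root par que → RootedTree Net
spanning {root = root} {par} treelike Tr = record
  { root = root ; root<n = root<n ; par = par ; rank = rank ; rank<n = rank<n
  ; par~ = par~ ; rank-par = rank-par ; edge = treelike root par rank par~ rank-par }
  where open Traversal Tr

clipped≡ : ∀ {Net : Network} {v d c m} → d ≡ Network.deg Net v → c ≡ m → (d ∸ 1) ∸ ((d ∸ 1) ∸ c) ≡ clip Net v m
clipped≡ {Net} {v} {m = m} refl refl = trans (minimum≡ (Network.deg Net v ∸ 1) m) (⊓-comm _ m)

leq-true : ∀ {a b} → suc b ∸ a ≢ 0 → a ≤ b
leq-true {a} {b} ne = s≤s⁻¹ (m∸n≢0⇒n<m ne)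

leq-false : ∀ {a b} → suc b ∸ a ≡ 0 → ¬ a ≤ b
leq-false {a} {b} eq = <⇒≱ (m∸n≡0⇒m≤n eq)

module _ {Net : Network} {off adj : ℕ → ℕ} (Lay : Layout Net off adj) where
  open Network Net
  open Layout Lay
  open Loaded

  clear-marks : ∀ {σ} → Loaded Lay σ → Halts ClearMarks σ (λ σ′ t → (∀ {v} → v < n → σ′ VIS v ≡ 0) × t ≤ 2 + n * 3)
  clear-marks {σ} L = verify ClearMarks (λ σ′ t → (∀ {v} → v < n → σ′ VIS v ≡ 0) × t ≤ 2 + n * 3) (
    let σ′ , t , r , (_ , z , t≤) = for-loop n I {write jj 0 0 σ} {1}
          (λ { {i} {σ′} i<n keep (refl , z , t≤) →
            m>n⇒m∸n≢0 (subst (i <_) (sym (trans (keep N refl 0) (size L))) i<n) , refl ,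
            (λ {v} v< → case i ≟ v of λ
              { (yes refl) → update-same (σ′ VIS) i 0
              ; (no i≢v) → trans (update-other (σ′ VIS) 0 i≢v) (z (≤∧≢⇒< (s≤s⁻¹ v<) (i≢v ∘ sym))) }) ,
            later 3 3 t≤ })
          (λ keep (j≡ , _) → trans (cong₂ _∸_ (trans (keep N refl 0) (size L)) j≡) (n∸n≡0 n))
          (refl , (λ ()) , ≤-refl)
    in σ′ , suc t , r , z , s≤s (≤-trans t≤ (≤-reflexive (+-comm _ 1))))
    where
    I : ℕ → Store → ℕ → Set
    I i σ′ t = σ′ jj 0 ≡ i × (∀ {v} → v < i → σ′ VIS v ≡ 0) × t ≤ i * 3 + 1

  clear-counts : ∀ {σ} → Loaded Lay σ → Halts ClearCounts σ (λ σ′ t → (∀ {i} → i < off n → σ′ CNT i ≡ 0) × t ≤ 2 + off n * 3)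
  clear-counts {σ} L = verify ClearCounts (λ σ′ t → (∀ {i} → i < off n → σ′ CNT i ≡ 0) × t ≤ 2 + off n * 3) (
    let σ′ , t , r , (_ , z , t≤) = for-loop (off n) I {write jj 0 0 σ} {1}
          (λ { {i} {σ′} i<n keep (refl , z , t≤) →
            m>n⇒m∸n≢0 (subst (i <_) (sym (end keep)) i<n) , refl ,
            (λ {v} v< → case i ≟ v of λ
              { (yes refl) → update-same (σ′ CNT) i 0
              ; (no i≢v) → trans (update-other (σ′ CNT) 0 i≢v) (z (≤∧≢⇒< (s≤s⁻¹ v<) (i≢v ∘ sym))) }) ,
            later 3 3 t≤ })
          (λ keep (j≡ , _) → trans (cong₂ _∸_ (end keep) j≡) (n∸n≡0 (off n)))
          (refl , (λ ()) , ≤-refl)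
    in σ′ , suc t , r , z , s≤s (≤-trans t≤ (≤-reflexive (+-comm _ 1))))
    where
    I : ℕ → Store → ℕ → Set
    I i σ′ t = σ′ jj 0 ≡ i × (∀ {v} → v < i → σ′ CNT v ≡ 0) × t ≤ i * 3 + 1
    end : ∀ {σ′} → Keeps (CNT at ! jj ≔ lit 0 ⨾ jj := lit 1 ⊕ ! jj) (write jj 0 0 σ) σ′ → σ′ OFF (σ′ N 0) ≡ off n
    end keep = trans (keep OFF refl _) (trans (off≡ L _) (cong off (trans (keep N refl 0) (size L))))

  module _ (treelike : Treelike Net) {root par que} (Tr : Traversal Net root par que) where
    open Traversal Tr

    tree : RootedTree Net
    tree = spanning treelike Tr

    open RootedTree tree using (Child; Gives; gives?; edge)

    below : ∀ {v w} → w < n → Child v w → rank v < rank w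
    below w<n (w≢r , refl) = rank-par w<n w≢r

    Pending : ℕ → (ℕ → ℕ) → ℕ → ℕ → ℕ → Set
    Pending h D v d w = h ≤ rank w × Gives D v d w

    pending? : ∀ h D v d → Decidable (Pending h D v d)
    pending? h D v d w = (h ≤? rank w) ×-dec gives? D v d w

    -- The state of the bottom-up pass when the vertices of rank ≥ h are done.
    record Gathering (h : ℕ) (cnt low val rk : ℕ → ℕ) : Set where
      field
        counts : ∀ {v} → v < n → ∀ {d} → d < deg v → cnt (off v + d) ≡ count n (pending? h val v d)
        vals   : ∀ {v} → v < n → h ≤ rank v → val v ≡ covered (region Lay cnt v) (deg v)
        lows   : ∀ {v} → v < n → h ≤ rank v → ∀ {d} → d < deg v → low (off v + d) ≡ covered (region Lay cnt v) d
        onto   : ∀ {v} → v < n → ∀ {d} → d < deg v → ∀ {k} → k < cnt (off v + d) →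
                 ∃[ w ] w < n × Pending h val v d w × rk w ≡ k

    open Gathering

    gathering-start : ∀ {cnt low val rk} → (∀ {i} → i < off n → cnt i ≡ 0) → Gathering n cnt low val rk
    gathering-start {cnt} {val = val} z = record
      { counts = λ {v} v<n {d} d< → trans (zero′ v<n d<)
          (sym (trans (sum-cong n (λ {w} w<n → ind-no (pending? n val v d w) (λ (n≤ , _) → <⇒≱ (rank<n w<n) n≤))) (sum-zero n)))
      ; vals = λ v<n n≤ → contradiction n≤ (<⇒≱ (rank<n v<n))
      ; lows = λ v<n n≤ → contradiction n≤ (<⇒≱ (rank<n v<n))
      ; onto = λ v<n d< k< → contradiction (subst (_ <_) (zero′ v<n d<) k<) n≮0
      }
      where
      zero′ : ∀ {v} → v < n → ∀ {d} → d < deg v → cnt (off v + d) ≡ 0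
      zero′ v<n d< = z (<-≤-trans (+-monoʳ-< _ d<) (off-mono v<n ≤-refl))

    -- A scan preserves these arrays only pointwise, so the invariant is carried over entry by
    -- entry.
    gathering-cong : ∀ {h cnt cnt′ low val val′ rk rk′} → (∀ i → cnt′ i ≡ cnt i) → (∀ i → val′ i ≡ val i) → (∀ i → rk′ i ≡ rk i) →
                     Gathering h cnt low val rk → Gathering h cnt′ low val′ rk′
    gathering-cong {h} {val = val} {val′} ec ev er G = record
      { counts = λ v<n d< → trans (ec _) (trans (G .counts v<n d<)
          (count-cong n (pending? h val _ _) (pending? h val′ _ _) (λ _ → pending) (λ _ (h≤ , ch , le , eq) →
            h≤ , ch , le , trans (cong (clip Net _) (sym (ev _))) eq)))
      ; vals = λ v<n h≤ → trans (ev _) (trans (G .vals v<n h≤) (covered-cong (deg _) (λ {e} _ → sym (ec (off _ + e)))))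
      ; lows = λ {v} v<n h≤ {d} d< → trans (G .lows v<n h≤ d<)
          (covered-cong d (λ {e} _ → sym (ec (off v + e))))
      ; onto = λ v<n d< k< → let w , w<n , p , eq = G .onto v<n d< (subst (_ <_) (ec _) k<)
                             in w , w<n , pending p , trans (er w) eq
      }
      where
      pending : ∀ {v d w} → Pending h val v d w → Pending h val′ v d w
      pending (h≤ , ch , le , eq) = h≤ , ch , le , trans (cong (clip Net _) (ev _)) eq

    module _ {h : ℕ} {cnt low val rk : ℕ → ℕ} (h<n : h < n) (G : Gathering (suc h) cnt low val rk)
             {u c : ℕ} {cnt′ low′ rk′ : ℕ → ℕ} (u≡ : que h ≡ u)
             (c≡ : c ≡ covered (region Lay cnt u) (deg u))
             (lows-u : ∀ {d} → d < deg u → low′ (off u + d) ≡ covered (region Lay cnt u) d)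
             (lows-else : ∀ {a} → (∀ {d} → d < deg u → a ≢ off u + d) → low′ a ≡ low a)
             -- One indicator covers all outcomes: `u` is the root, `u` is no item for its parent,
             -- or one bucket of the parent grows by one.
             (cnt′≡ : ∀ {v} → v < n → ∀ {d} → d < deg v →
                      cnt′ (off v + d) ≡ ind (gives? (update val u c) v d u) + cnt (off v + d))
             (rk-else : ∀ {w} → w ≢ u → rk′ w ≡ rk w)
             (rk-u : ∀ {v d} → Gives (update val u c) v d u → rk′ u ≡ cnt (off v + d)) where

      private
        val′ : ℕ → ℕ
        val′ = update val u c

        u<n : u < n
        u<n = subst (_< n) u≡ (que<n h<n)

        rank-u : rank u ≡ h
        rank-u = trans (cong rank (sym u≡)) (rank-que h<n)

        val-else : ∀ {w} → w ≢ u → val′ w ≡ val w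
        val-else w≢u = update-other val c (w≢u ∘ sym)

        above≢ : ∀ {w} → suc h ≤ rank w → w ≢ u
        above≢ lt refl = <⇒≢ lt (sym rank-u)

        ≢above : ∀ {w} → w < n → h ≤ rank w → w ≢ u → suc h ≤ rank w
        ≢above w<n h≤ w≢u = ≤∧≢⇒< h≤ (λ eq → w≢u (trans (sym (que-rank w<n)) (trans (cong que (sym eq)) u≡)))

        change : ∀ {v d w} → w ≢ u → Gives val v d w → Gives val′ v d w
        change w≢u (ch , le , eq) = ch , le , trans (cong (clip Net _) (val-else w≢u)) eq

        change⁻ : ∀ {v d w} → w ≢ u → Gives val′ v d w → Gives val v d w
        change⁻ w≢u (ch , le , eq) = ch , le , trans (cong (clip Net _) (sym (val-else w≢u))) eq

        same : ∀ {v} → v < n → h ≤ rank v → ∀ {d} → d < deg v → region Lay cnt′ v d ≡ region Lay cnt v d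
        same {v} v<n h≤ {d} d< = trans (cnt′≡ v<n d<) (cong (_+ cnt (off v + d))
          (ind-no (gives? val′ v d u) (λ g → <⇒≱ (below u<n (proj₁ g)) (subst (_≤ rank v) (sym rank-u) h≤))))

      -- The vertex `u` of rank `h` can be completed because its children have larger rank and have
      -- all been counted. As `u` is counted only at its parent, of smaller rank, no completed
      -- vertex changes.
      gathering-step : Gathering h cnt′ low′ val′ rk′
      gathering-step .counts {v} v<n {d} d< = trans (cnt′≡ v<n d<) (trans (cong (_ +_) (G .counts v<n d<)) (sym
        (count-insert n (pending? h val′ v d) (pending? (suc h) val v d) (gives? val′ v d u) u<n
          (λ {w} w<n (h≤ , g) → case w ≟ u of λ
            { (yes refl) → inj₂ (refl , g)
            ; (no w≢u) → inj₁ (≢above w<n h≤ w≢u , change⁻ w≢u g) })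
          (λ _ (h< , g) → <⇒≤ h< , change (above≢ h<) g)
          (λ g → ≤-reflexive (sym rank-u) , g)
          (λ (h< , _) → above≢ h< refl))))
      gathering-step .vals {v} v<n h≤ with v ≟ u
      ... | yes refl = trans (update-same val v c) (trans c≡ (covered-cong (deg v) (sym ∘ same v<n h≤)))
      ... | no v≢u   = trans (val-else v≢u) (trans (G .vals v<n (≢above v<n h≤ v≢u)) (covered-cong (deg v) (sym ∘ same v<n h≤)))
      gathering-step .lows {v} v<n h≤ {d} d< with v ≟ u
      ... | yes refl = trans (lows-u d<) (covered-cong d (λ e< → sym (same v<n h≤ (<-trans e< d<))))
      ... | no v≢u   = trans (lows-else (λ e< eq → v≢u (disjoint v<n u<n d< e< eq)))
                             (trans (G .lows v<n (≢above v<n h≤ v≢u) d<) (covered-cong d (λ e< → sym (same v<n h≤ (<-trans e< d<)))))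
      gathering-step .onto {v} v<n {d} d< {k} k< = go (gives? val′ v d u) (subst (k <_) (cnt′≡ v<n d<) k<)
        where
        old : k < cnt (off v + d) → ∃[ w ] w < n × Pending h val′ v d w × rk′ w ≡ k
        old k<c = let w , w<n , (h< , g) , eq = G .onto v<n d< k<c
                  in w , w<n , (<⇒≤ h< , change (above≢ h<) g) , trans (rk-else (above≢ h<)) eq
        go : (R? : Dec (Gives val′ v d u)) → k < ind R? + cnt (off v + d) → ∃[ w ] w < n × Pending h val′ v d w × rk′ w ≡ k
        go (no _)  lt = old lt
        go (yes g) lt with k <? cnt (off v + d)
        ... | yes k<c = old k<c
        -- The newest item of the bucket is `u`, and its number is the old count.
        ... | no k≮c  = u , u<n , (≤-reflexive (sym rank-u) , g) , trans (rk-u g) (≤-antisym (≮⇒≥ k≮c) (s≤s⁻¹ lt))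

    gathered : ∀ {cnt low val rk} → Gathering 0 cnt low val rk → Gathered Net tree
    gathered {cnt} {low} {val} {rk} G = record
      { D = val ; rk = rk ; cnt = region Lay cnt
      ; cnt≡ = λ v<n d< → trans (G .counts v<n d<) (count-cong n (pending? 0 val _ _) (gives? val _ _) (λ _ → proj₂) (λ _ g → z≤n , g))
      ; D≡ = λ v<n → G .vals v<n z≤n
      ; rk-onto = λ v<n d< k< → let w , w<n , (_ , g) , eq = G .onto v<n d< k< in w , w<n , g , eq
      }

    GatherResult : Store → Store → Set
    GatherResult σ σ′ = Gathering 0 (σ′ CNT) (σ′ LOW) (σ′ VAL) (σ′ RNK)

    module _ {σ} (L : Loaded Lay σ) (par≡ : ∀ v → σ PAR v ≡ par v) (que≡ : ∀ i → σ QUE i ≡ que i)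
             (clear : ∀ {i} → i < off n → σ CNT i ≡ 0) where

      private
        cost : ℕ → ℕ
        -- Three steps before the scan, four in it apart from the buckets, and at most seven in
        -- `GatherUpdate`.
        cost i = 14 + 6 * deg (que i)

        σ₁ : Store
        σ₁ = write hd 0 (σ N 0) σ

        I : ℕ → Store → ℕ → Set
        -- As `hd` counts down, the costs of the `h` vertices still to come appear on the left as
        -- unspent budget.
        I i σ′ t = ∃[ h ] h + i ≡ n × σ′ hd 0 ≡ h × Gathering h (σ′ CNT) (σ′ LOW) (σ′ VAL) (σ′ RNK) ×
                   t + sum h cost ≤ sum n cost + 1

        module _ {h σ′} (h<n : h < n) (keep : Keeps GatherStep σ₁ σ′) (hd≡ : σ′ hd 0 ≡ suc h)
                 (G : Gathering (suc h) (σ′ CNT) (σ′ LOW) (σ′ VAL) (σ′ RNK)) where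

          u : ℕ
          u = que h

          σ₂ : Store
          σ₂ = write uu 0 (σ′ QUE (σ′ hd 0 ∸ 1)) (write hd 0 (σ′ hd 0 ∸ 1) σ′)

          L₂ : Loaded Lay σ₂
          L₂ = loaded-keep Lay (keep N refl) (keep OFF refl) (keep ADJ refl) L

          hd₂ : σ₂ hd 0 ≡ h
          hd₂ = cong (_∸ 1) hd≡

          uu₂ : σ₂ uu 0 ≡ u
          uu₂ = trans (cong (σ′ QUE) hd₂) (trans (keep QUE refl h) (que≡ h))

          u<n : u < n
          u<n = que<n h<n

          module _ {σ₃ s} (r : Run Scan σ₂ σ₃ s) (sc : Scanned Lay σ₂ u σ₃) where
            open Scanned sc

            L₃ : Loaded Lay σ₃
            L₃ = loaded-run Lay r refl refl refl L₂

            hd₃ : σ₃ hd 0 ≡ h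
            hd₃ = trans (frame r hd refl 0) hd₂

            uu₃ : σ₃ uu 0 ≡ u
            uu₃ = trans (frame r uu refl 0) uu₂

            Next : (cnt′ rk′ : ℕ → ℕ) → Set
            Next cnt′ rk′ = Gathering h cnt′ (σ₃ LOW) (update (σ₃ VAL) (σ₃ uu 0) (σ₃ cc 0)) rk′

            D′ : ℕ → ℕ
            D′ = update (σ₃ VAL) u (σ₃ cc 0)

            G₃ : Gathering (suc h) (σ₃ CNT) (σ₂ LOW) (σ₃ VAL) (σ₃ RNK)
            G₃ = gathering-cong (frame r CNT refl) (frame r VAL refl) (frame r RNK refl) G

            c≡ : σ₃ cc 0 ≡ covered (region Lay (σ₃ CNT) u) (deg u)
            c≡ = trans total (covered-cong (deg u) (λ _ → sym (frame r CNT refl _)))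

            next : ∀ {cnt′ rk′} → (∀ {v} → v < n → ∀ {d} → d < deg v → cnt′ (off v + d) ≡ ind (gives? D′ v d u) + σ₃ CNT (off v + d)) →
                   (∀ {w} → w ≢ u → rk′ w ≡ σ₃ RNK w) → (∀ {v d} → Gives D′ v d u → rk′ u ≡ σ₃ CNT (off v + d)) → Next cnt′ rk′
            next {cnt′} {rk′} e₁ e₂ e₃ = subst (λ x → Gathering h cnt′ (σ₃ LOW) (update (σ₃ VAL) x (σ₃ cc 0)) rk′) (sym uu₃)
              (gathering-step h<n G₃ refl c≡
                (λ {d} d< → trans (Scanned.lows sc d<) (covered-cong d (λ {e} _ → sym (frame r CNT refl (off u + e)))))
                elsewhere e₁ e₂ e₃)

            idle : (∀ {v d} → ¬ Gives D′ v d u) → Next (σ₃ CNT) (σ₃ RNK)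
            idle no-gift = next (λ {v} _ {d} _ → cong (_+ _) (sym (ind-no (gives? D′ v d u) no-gift)))
                                (λ _ → refl) (λ g → contradiction g no-gift)

            add : u ≢ root → ∀ {p x a v} → p ≡ par u → x ≡ clip Net p (σ₃ cc 0) → a ≡ off p + x → v ≡ u → deg p ≤ deg u →
                  Next (update (σ₃ CNT) a (suc (σ₃ CNT a))) (update (σ₃ RNK) v (σ₃ CNT a))
            add u≢r {p} {x} refl x≡ refl refl le = next
              (λ {v} v<n {d} d< → count′ v<n d< (gives? D′ v d u))
              (λ w≢u → update-other (σ₃ RNK) _ (w≢u ∘ sym))
              (λ { ((_ , refl) , _ , refl) → trans (update-same (σ₃ RNK) u _) (cong (λ y → σ₃ CNT (off p + y)) (trans x≡ D′u)) })
              where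
              D′u : clip Net p (σ₃ cc 0) ≡ clip Net p (D′ u)
              D′u = cong (clip Net p) (sym (update-same (σ₃ VAL) u _))
              p~u : p ~ u
              p~u = par~ u<n u≢r
              x< : x < deg p
              x< = subst (_< deg p) (sym x≡) (clip< Net (σ₃ cc 0) (deg>0 Net p~u))
              count′ : ∀ {v} → v < n → ∀ {d} → d < deg v → (R? : Dec (Gives D′ v d u)) →
                       update (σ₃ CNT) (off p + x) (suc (σ₃ CNT (off p + x))) (off v + d) ≡ ind (gives? D′ v d u) + σ₃ CNT (off v + d)
              count′ {v} v<n {d} d< (yes g@((_ , refl) , _ , refl)) rewrite trans x≡ D′u = trans
                (update-same (σ₃ CNT) (off p + d) _) (cong (_+ σ₃ CNT (off p + d)) (sym (ind-yes (gives? D′ p d u) g)))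
              count′ {v} v<n {d} d< (no ¬g) = trans
                (update-other (σ₃ CNT) _ (λ eq → ¬g (gift (disjoint (~-< p~u) v<n x< d< eq) eq)))
                (cong (_+ σ₃ CNT (off v + d)) (sym (ind-no (gives? D′ v d u) ¬g)))
                where
                gift : p ≡ v → off p + x ≡ off v + d → Gives D′ v d u
                gift refl eq = (u≢r , refl) , le , trans (sym (trans x≡ D′u)) (+-cancelˡ-≡ (off p) _ _ eq)

        step : ∀ {i σ′ t} → i < n → Keeps GatherStep σ₁ σ′ → I i σ′ t →
               eval (! hd) σ′ ≢ 0 × wp GatherStep (I (suc i)) σ′ (suc t)
        step i<n keep (zero , refl , _) = contradiction i<n (<-irrefl refl)
        step {i} {σ′} {t} i<n keep (suc h , h+i≡n , hd≡ , G , t≤) =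
          (λ eq → 1+n≢0 (trans (sym hd≡) eq)) ,
          (let σ₃ , s , r , sc , s≤ = scan Lay (L₂ h<n keep hd≡ G) (u<n h<n keep hd≡ G) (uu₂ h<n keep hd≡ G)
           in call Scan {wp GatherUpdate (I (suc i))} {t = 3 + t} r (finish r sc s≤))
          where
          h<n : h < n
          h<n = subst (suc h ≤_) h+i≡n (m≤m+n (suc h) i)
          time : ∀ {s k} → s ≤ 4 + deg (que h) * 6 → k ≤ 7 → k + (s + (3 + t)) + sum h cost ≤ sum n cost + 1
          time {s} {k} s≤ k≤ = begin
            k + (s + (3 + t)) + sum h cost                          ≤⟨ +-monoˡ-≤ (sum h cost) (+-mono-≤ k≤ (+-monoˡ-≤ (3 + t) s≤)) ⟩
            7 + (4 + deg (que h) * 6 + (3 + t)) + sum h cost        ≡⟨ solve 3 (λ d t S → con 7 :+ (con 4 :+ d :* con 6 :+ (con 3 :+ t)) :+ S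
                                                                         ⊜ t :+ (con 14 :+ con 6 :* d :+ S))
                                                                         refl (deg (que h)) t (sum h cost) ⟩
            t + sum (suc h) cost                                    ≤⟨ t≤ ⟩
            sum n cost + 1                                          ∎
            where open ≤-Reasoning
          finish : ∀ {σ₃ s} (r : Run Scan (σ₂ h<n keep hd≡ G) σ₃ s) → Scanned Lay (σ₂ h<n keep hd≡ G) (que h) σ₃ →
                   s ≤ 4 + deg (que h) * 6 → wp GatherUpdate (I (suc i)) σ₃ (s + (3 + t))
          finish {σ₃} {s} r sc s≤ =
            (λ ne →
              let u≢r : que h ≢ root
                  u≢r eq = ne (trans (hd₃ h<n keep hd≡ G r sc) (que-injective h<n (≤-<-trans z≤n h<n) (trans eq (sym que-root))))
                  p≡ : σ₃ PAR (σ₃ uu 0) ≡ par (que h)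
                  p≡ = trans (cong (σ₃ PAR) (uu₃ h<n keep hd≡ G r sc)) (trans (frame r PAR refl _) (trans (keep PAR refl _) (par≡ _)))
                  L₄ : Loaded Lay (write pp 0 (σ₃ PAR (σ₃ uu 0)) (write VAL (σ₃ uu 0) (σ₃ cc 0) σ₃))
                  L₄ = loaded-keep Lay (λ _ → refl) (λ _ → refl) (λ _ → refl) (L₃ h<n keep hd≡ G r sc)
                  dp≡ = degree≡ L₄ {pp} p≡ (~-< (par~ (que<n h<n) u≢r))
                  du≡ = degree≡ L₄ {uu} (uu₃ h<n keep hd≡ G r sc) (que<n h<n)
              in (λ ne′ → h , trans (+-suc h i) h+i≡n , hd₃ h<n keep hd≡ G r sc ,
                   add h<n keep hd≡ G r sc u≢r refl (clipped≡ {Net} dp≡ refl)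
                     (cong₂ _+_ (trans (off≡ (L₃ h<n keep hd≡ G r sc) _) (cong off p≡)) refl)
                     (uu₃ h<n keep hd≡ G r sc) (subst₂ _≤_ dp≡ du≡ (leq-true ne′)) ,
                   time s≤ ≤-refl) ,
                 (λ eq′ → h , trans (+-suc h i) h+i≡n , hd₃ h<n keep hd≡ G r sc ,
                   idle h<n keep hd≡ G r sc (λ { ((_ , refl) , le , _) → leq-false eq′ (subst₂ _≤_ (sym dp≡) (sym du≡) le) }) ,
                   time {k = 5} s≤ (≤ᵇ⇒≤ 5 7 _))) ,
            (λ eq → h , trans (+-suc h i) h+i≡n , hd₃ h<n keep hd≡ G r sc ,
              idle h<n keep hd≡ G r sc (λ { ((u≢r , _) , _) →
                u≢r (trans (cong que (trans (sym (hd₃ h<n keep hd≡ G r sc)) eq)) que-root) }) ,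
              time {k = 3} s≤ (≤ᵇ⇒≤ 3 7 _))

      gather : Halts Gather σ (λ σ′ t → GatherResult σ σ′ × t ≤ 3 + work Net 14 6)
      gather = verify Gather (λ σ′ t → GatherResult σ σ′ × t ≤ 3 + work Net 14 6) (
        let σ′ , t , r , (h , h+n≡n , hd≡ , G , t≤) = for-loop n I {σ₁} {1} step
              (λ _ (h , eq , hd≡ , _) → trans hd≡ (m+n≡n⇒m≡0 h eq))
              (n , +-identityʳ n , size L , gathering-start clear , ≤-reflexive (+-comm 1 _))
        in σ′ , suc t , r , subst (λ h → Gathering h (σ′ CNT) (σ′ LOW) (σ′ VAL) (σ′ RNK)) (m+n≡n⇒m≡0 h h+n≡n) G ,
           s≤s (≤-trans (m≤m+n (t + 1) _) (≤-trans t≤ (≤-trans (+-monoˡ-≤ 1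
             (sum-injection n n que (λ v → 14 + 6 * deg v) que<n que-injective)) (≤-trans (≤-reflexive (+-comm _ 1)) (n≤1+n _))))))
        where
        m+n≡n⇒m≡0 : ∀ m {k} → m + k ≡ k → m ≡ 0
        m+n≡n⇒m≡0 m eq = +-cancelʳ-≡ _ m 0 eq

-- The top-down pass

module _ {Net : Network} {off adj : ℕ → ℕ} (Lay : Layout Net off adj)
         (treelike : Treelike Net) {root par que} (Tr : Traversal Net root par que) where
  open Network Net
  open Layout Lay
  open Loaded
  open Traversal Tr

  private
    rooted : RootedTree Net
    rooted = tree Lay treelike Tr

  rank< : ∀ {v h} → v < n → que h ≢ v → rank v < suc h → rank v < h
  rank< v<n q≢v lt = ≤∧≢⇒< (s≤s⁻¹ lt) (λ eq → q≢v (trans (cong que (sym eq)) (que-rank v<n)))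

  que≢root : ∀ {h} → h < n → h ≢ 0 → que h ≢ root
  que≢root h<n h≢0 eq = h≢0 (que-injective h<n (≤-<-trans z≤n h<n) (trans eq (sym que-root)))

  module _ (Γ : Gathered Net rooted) where
    open Gathered Γ renaming (cnt to cnt₀)

    record Pushing (h : ℕ) (cnt top crit : ℕ → ℕ) : Set where
      field
        fresh  : ∀ {v} → v < n → h ≤ rank v → ∀ {d} → d < deg v → cnt (off v + d) ≡ cnt₀ v d
        pushed : ∀ {v} → v < n → rank v < h → ∀ {d} → d < deg v →
                 cnt (off v + d) ≡ ind (up? Net Γ top crit v d) + cnt₀ v d
        tops   : ∀ {v} → v < n → rank v < h → top v ≡ covered (region Lay cnt v) (deg v)
        crits  : ∀ {v} → v < n → rank v < h → crit v ≡ critical (region Lay cnt v) (deg v)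

    open Pushing

    up-cong : ∀ M M′ S S′ {v d} → (v ≢ root → M (par v) ≡ M′ (par v)) → (v ≢ root → S (par v) ≡ S′ (par v)) →
              ind (up? Net Γ M S v d) ≡ ind (up? Net Γ M′ S′ v d)
    up-cong M M′ S S′ {v} {d} eM eS = ind-cong (up? Net Γ M S v d) (up? Net Γ M′ S′ v d)
      (λ (v≢r , le , eq) → v≢r , le , trans (cong (clip Net v) (sym (above≡ v≢r))) eq)
      (λ (v≢r , le , eq) → v≢r , le , trans (cong (clip Net v) (above≡ v≢r)) eq)
      where
      above≡ : v ≢ root → above Net Γ M S v ≡ above Net Γ M′ S′ v
      above≡ v≢r = cong₂ _∸_ (eM v≢r) (ind-cong (drops? Net Γ M S v) (drops? Net Γ M′ S′ v)
        (λ (a , b) → a , subst (_≤ clip Net (par v) (D v)) (eS v≢r) b)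
        (λ (a , b) → a , subst (_≤ clip Net (par v) (D v)) (sym (eS v≢r)) b))

    module _ {h : ℕ} {cnt top crit : ℕ → ℕ} (h<n : h < n) (P : Pushing h cnt top crit)
             {u : ℕ} {cnt′ top′ crit′ : ℕ → ℕ} (u≡ : que h ≡ u)
             (cnt-else : ∀ {v} → v < n → v ≢ u → ∀ {d} → d < deg v → cnt′ (off v + d) ≡ cnt (off v + d))
             (cnt-u : ∀ {d} → d < deg u → cnt′ (off u + d) ≡ ind (up? Net Γ top crit u d) + cnt (off u + d))
             (top-else : ∀ {v} → v ≢ u → top′ v ≡ top v)
             (top-u : top′ u ≡ covered (region Lay cnt′ u) (deg u))
             (crit-else : ∀ {v} → v ≢ u → crit′ v ≡ crit v)
             (crit-u : crit′ u ≡ critical (region Lay cnt′ u) (deg u)) where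

      private
        rank-u : rank u ≡ h
        rank-u = trans (cong rank (sym u≡)) (rank-que h<n)

        lower : ∀ {v} → v < n → v ≢ u → rank v < suc h → rank v < h
        lower v<n v≢u = rank< v<n (λ eq → v≢u (trans (sym eq) u≡))

        par≢u : ∀ {v} → v < n → v ≢ root → rank v < suc h → par v ≢ u
        par≢u v<n v≢r lt eq = <⇒≱ (rank-par v<n v≢r) (≤-trans (s≤s⁻¹ lt) (≤-reflexive (trans (sym rank-u) (cong rank (sym eq)))))

        up≡ : ∀ {v} → v < n → rank v < suc h → ∀ {d} → ind (up? Net Γ top crit v d) ≡ ind (up? Net Γ top′ crit′ v d)
        up≡ v<n lt = up-cong top top′ crit crit′ (λ v≢r → sym (top-else (par≢u v<n v≢r lt))) (λ v≢r → sym (crit-else (par≢u v<n v≢r lt)))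

      -- No vertex of rank at most `h` has `u` as its parent, so the new entries of `top` and `crit`
      -- at `u` do not affect the parent items counted so far.
      pushing-step : Pushing (suc h) cnt′ top′ crit′
      pushing-step .fresh v<n h< d< =
        trans (cnt-else v<n (λ { refl → <⇒≢ h< (sym rank-u) }) d<) (P .fresh v<n (<⇒≤ h<) d<)
      pushing-step .pushed {v} v<n lt {d} d< with v ≟ u
      ... | yes refl = trans (cnt-u d<) (cong₂ _+_ (up≡ v<n lt) (P .fresh v<n (≤-reflexive (sym rank-u)) d<))
      ... | no v≢u   = trans (cnt-else v<n v≢u d<) (trans (P .pushed v<n (lower v<n v≢u lt) d<) (cong (_+ cnt₀ v d) (up≡ v<n lt)))
      pushing-step .tops {v} v<n lt with v ≟ u
      ... | yes refl = top-u
      ... | no v≢u   = trans (top-else v≢u) (trans (P .tops v<n (lower v<n v≢u lt)) (covered-cong (deg v) (sym ∘ cnt-else v<n v≢u)))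
      pushing-step .crits {v} v<n lt with v ≟ u
      ... | yes refl = crit-u
      ... | no v≢u   = trans (crit-else v≢u) (trans (P .crits v<n (lower v<n v≢u lt)) (critical-cong (deg v) (sym ∘ cnt-else v<n v≢u)))

    spread : ∀ {cnt top crit} → Pushing n cnt top crit → Spread Net Γ
    spread {cnt} {top} {crit} P = record
      { M = top ; S = crit ; cnt′ = region Lay cnt
      ; cnt′≡ = λ v<n → P .pushed v<n (rank<n v<n)
      ; M≡ = λ v<n → P .tops v<n (rank<n v<n)
      ; S≡ = λ v<n → P .crits v<n (rank<n v<n)
      }

    module _ {σ} (L : Loaded Lay σ) (par≡ : ∀ v → σ PAR v ≡ par v) (que≡ : ∀ i → σ QUE i ≡ que i)
             (val≡ : ∀ v → σ VAL v ≡ D v)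
             (cnt≡′ : ∀ {v} → v < n → ∀ {d} → d < deg v → σ CNT (off v + d) ≡ cnt₀ v d) where

      private
        cost : ℕ → ℕ
        -- At most eleven steps before the scan, four in it apart from the buckets, and three after
        -- it.
        cost i = 18 + 6 * deg (que i)

        σ₁ : Store
        σ₁ = write hd 0 0 σ

        I : ℕ → Store → ℕ → Set
        I h σ′ t = σ′ hd 0 ≡ h × Pushing h (σ′ CNT) (σ′ TOP) (σ′ CRIT) × t ≤ sum h cost + 1

        module _ {h σ′ t} (h<n : h < n) (keep : Keeps SpreadStep σ₁ σ′) (hd≡ : σ′ hd 0 ≡ h)
                 (P : Pushing h (σ′ CNT) (σ′ TOP) (σ′ CRIT)) (t≤ : t ≤ sum h cost + 1) where

          u : ℕ
          u = que h

          u<n : u < n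
          u<n = que<n h<n

          uu≡ : σ′ QUE (σ′ hd 0) ≡ u
          uu≡ = trans (cong (σ′ QUE) hd≡) (trans (keep QUE refl h) (que≡ h))

          L′ : Loaded Lay σ′
          L′ = loaded-keep Lay (keep N refl) (keep OFF refl) (keep ADJ refl) L

          time : ∀ {s k} → s ≤ 4 + deg u * 6 → k ≤ 11 → 3 + (s + (k + t)) ≤ sum (suc h) cost + 1
          time {s} {k} s≤ k≤ = begin
            3 + (s + (k + t))                                  ≤⟨ +-monoʳ-≤ 3 (+-mono-≤ s≤ (+-mono-≤ k≤ t≤)) ⟩
            3 + (4 + deg u * 6 + (11 + (sum h cost + 1)))      ≡⟨ solve 2 (λ d S → con 3 :+ (con 4 :+ d :* con 6 :+ (con 11 :+ (S :+ con 1)))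
                                                                    ⊜ con 18 :+ con 6 :* d :+ S :+ con 1) refl (deg u) (sum h cost) ⟩
            sum (suc h) cost + 1                               ∎
            where open ≤-Reasoning

          finish : ∀ {σ₂ k} → k ≤ 11 → Loaded Lay σ₂ → σ₂ uu 0 ≡ u → σ₂ hd 0 ≡ h →
                   (∀ v → σ₂ TOP v ≡ σ′ TOP v) → (∀ v → σ₂ CRIT v ≡ σ′ CRIT v) →
                   (∀ {v} → v < n → v ≢ u → ∀ {d} → d < deg v → σ₂ CNT (off v + d) ≡ σ′ CNT (off v + d)) →
                   (∀ {d} → d < deg u → σ₂ CNT (off u + d) ≡ ind (up? Net Γ (σ′ TOP) (σ′ CRIT) u d) + σ′ CNT (off u + d)) →
                   wp SpreadUpdate (I (suc h)) σ₂ (k + t)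
          finish {σ₂} {k} k≤ L₂ uu₂ hd₂ top₂ crit₂ else₂ u₂ =
            let σ₃ , s , r , sc , s≤ = scan Lay L₂ u<n uu₂ in
            call Scan {wp (TOP at ! uu ≔ ! cc ⨾ CRIT at ! uu ≔ ! ss ⨾ hd := lit 1 ⊕ ! hd) (I (suc h))} {t = k + t} r
              (scanned r sc s≤)
            where
            scanned : ∀ {σ₃ s} → Run Scan σ₂ σ₃ s → Scanned Lay σ₂ u σ₃ → s ≤ 4 + deg u * 6 →
                      wp (TOP at ! uu ≔ ! cc ⨾ CRIT at ! uu ≔ ! ss ⨾ hd := lit 1 ⊕ ! hd) (I (suc h)) σ₃ (s + (k + t))
            scanned {σ₃} {s} r sc s≤ = cong suc (trans (frame r hd refl 0) hd₂) ,
              pushing-step h<n P refl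
                (λ v<n v≢u d< → trans (frame r CNT refl _) (else₂ v<n v≢u d<))
                (λ d< → trans (frame r CNT refl _) (u₂ d<))
                (λ v≢u → trans (update-other (σ₃ TOP) _ (λ eq → v≢u (trans (sym eq) uu₃))) (trans (frame r TOP refl _) (top₂ _)))
                (trans (trans (cong (λ x → update (σ₃ TOP) x (σ₃ cc 0) u) uu₃) (update-same (σ₃ TOP) u _))
                       (trans (Scanned.total sc) (covered-cong (deg u) (λ _ → sym (frame r CNT refl (off u + _))))))
                (λ v≢u → trans (update-other (σ₃ CRIT) _ (λ eq → v≢u (trans (sym eq) uu₃))) (trans (frame r CRIT refl _) (crit₂ _)))
                (trans (trans (cong (λ x → update (σ₃ CRIT) x (σ₃ ss 0) u) uu₃) (update-same (σ₃ CRIT) u _))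
                       (trans (Scanned.threshold sc) (critical-cong (deg u) (λ _ → sym (frame r CNT refl (off u + _)))))) ,
              time s≤ k≤
              where
              uu₃ : σ₃ uu 0 ≡ u
              uu₃ = trans (frame r uu refl 0) uu₂

          idle : ∀ {σ₂ k} → k ≤ 11 → Loaded Lay σ₂ → σ₂ uu 0 ≡ u → σ₂ hd 0 ≡ h →
                 (∀ v → σ₂ TOP v ≡ σ′ TOP v) → (∀ v → σ₂ CRIT v ≡ σ′ CRIT v) → (∀ i → σ₂ CNT i ≡ σ′ CNT i) →
                 (∀ {d} → ¬ Up Net Γ (σ′ TOP) (σ′ CRIT) u d) → wp SpreadUpdate (I (suc h)) σ₂ (k + t)
          idle k≤ L₂ uu₂ hd₂ top₂ crit₂ cnt₂ no-up = finish k≤ L₂ uu₂ hd₂ top₂ crit₂ (λ _ _ _ → cnt₂ _)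
            (λ {d} _ → trans (cnt₂ _) (cong (_+ σ′ CNT (off u + d)) (sym (ind-no (up? Net Γ (σ′ TOP) (σ′ CRIT) u d) no-up))))

          push : ∀ {σ₂ k} → k ≤ 9 → Loaded Lay σ₂ → σ₂ uu 0 ≡ u → σ₂ hd 0 ≡ h →
                 (∀ v → σ₂ TOP v ≡ σ′ TOP v) → (∀ v → σ₂ CRIT v ≡ σ′ CRIT v) → (∀ i → σ₂ CNT i ≡ σ′ CNT i) →
                 u ≢ root → deg u ≤ deg (par u) → σ₂ xx 0 ≡ above Net Γ (σ′ TOP) (σ′ CRIT) u →
                 wp PushUp (wp SpreadUpdate (I (suc h))) σ₂ (k + t)
          push {σ₂} {k} k≤ L₂ uu₂ hd₂ top₂ crit₂ cnt₂ u≢r le xx₂ = finish (+-monoʳ-≤ 2 k≤)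
            (loaded-keep Lay (λ _ → refl) (λ _ → refl) (λ _ → refl) L₂) uu₂ hd₂ top₂ crit₂
            (λ v<n v≢u {d} d< → trans (update-other (σ₂ CNT) _ (λ eq → v≢u (disjoint v<n u<n d< x< (trans (sym eq) a≡)))) (cnt₂ _))
            (λ {d} d< → at-u d (up? Net Γ (σ′ TOP) (σ′ CRIT) u d))
            where
            x : ℕ
            x = clip Net u (above Net Γ (σ′ TOP) (σ′ CRIT) u)
            x< : x < deg u
            x< = clip< Net _ (deg>0 Net (~-sym (par~ u<n u≢r)))
            a : ℕ
            a = σ₂ OFF (σ₂ uu 0) + eval (clipped (! uu) (! xx)) σ₂
            a≡ : a ≡ off u + x
            a≡ = cong₂ _+_ (trans (off≡ L₂ _) (cong off uu₂)) (clipped≡ {Net} (degree≡ L₂ {uu} uu₂ u<n) xx₂)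
            at-u : ∀ d → (R? : Dec (Up Net Γ (σ′ TOP) (σ′ CRIT) u d)) →
                   update (σ₂ CNT) a (suc (σ₂ CNT a)) (off u + d) ≡ ind R? + σ′ CNT (off u + d)
            at-u d (yes (_ , _ , refl)) rewrite a≡ = trans (update-same (σ₂ CNT) (off u + d) _) (cong suc (cnt₂ _))
            at-u d (no ¬up) = trans (update-other (σ₂ CNT) _ (λ eq → ¬up (u≢r , le , +-cancelˡ-≡ (off u) _ _ (trans (sym a≡) eq)))) (cnt₂ _)

          body : wp SpreadStep (I (suc h)) σ′ (suc t)
          body =
            (λ ne →
              let u≢r : u ≢ root
                  u≢r = que≢root h<n (λ { refl → ne hd≡ })
                  σ₂ : Store
                  σ₂ = write uu 0 (σ′ QUE (σ′ hd 0)) σ′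
                  σ₃ : Store
                  σ₃ = write pp 0 (σ′ PAR (σ′ QUE (σ′ hd 0))) σ₂
                  L₃ : Loaded Lay σ₃
                  L₃ = loaded-keep Lay (λ _ → refl) (λ _ → refl) (λ _ → refl) L′
                  p≡ : σ₃ pp 0 ≡ par u
                  p≡ = trans (cong (σ′ PAR) uu≡) (trans (keep PAR refl _) (par≡ _))
                  p<n : par u < n
                  p<n = ~-< (par~ u<n u≢r)
                  du≡ : eval (degree (! uu)) σ₃ ≡ deg u
                  du≡ = degree≡ L₃ {uu} uu≡ u<n
                  dp≡ : eval (degree (! pp)) σ₃ ≡ deg (par u)
                  dp≡ = degree≡ L₃ {pp} p≡ p<n
                  val₃ : σ₃ VAL (σ₃ uu 0) ≡ D u
                  val₃ = trans (cong (σ′ VAL) uu≡) (trans (keep VAL refl _) (val≡ _))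
                  clip₃ : eval (clipped (! pp) (VAL at ! uu)) σ₃ ≡ clip Net (par u) (D u)
                  clip₃ = clipped≡ {Net} dp≡ val₃
                  crit₃ : σ₃ CRIT (σ₃ pp 0) ≡ σ′ CRIT (par u)
                  crit₃ = cong (σ′ CRIT) p≡
                  top₃ : σ₃ TOP (σ₃ pp 0) ≡ σ′ TOP (par u)
                  top₃ = cong (σ′ TOP) p≡
                  stay : ¬ Drops Net Γ (σ′ TOP) (σ′ CRIT) u → σ₃ TOP (σ₃ pp 0) ≡ above Net Γ (σ′ TOP) (σ′ CRIT) u
                  stay ¬d = trans top₃ (cong (σ′ TOP (par u) ∸_) (sym (ind-no (drops? Net Γ (σ′ TOP) (σ′ CRIT) u) ¬d)))
              in
              (λ small → let le = subst₂ _≤_ du≡ dp≡ (leq-true small) in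
                (λ back →
                  (λ crit → push (≤ᵇ⇒≤ 9 9 _) (loaded-keep Lay (λ _ → refl) (λ _ → refl) (λ _ → refl) L′)
                    uu≡ hd≡ (λ _ → refl) (λ _ → refl) (λ _ → refl) u≢r le
                    (cong₂ _∸_ top₃ (sym (ind-yes (drops? Net Γ (σ′ TOP) (σ′ CRIT) u)
                      (subst₂ _≤_ dp≡ du≡ (leq-true back) , subst₂ _≤_ crit₃ clip₃ (leq-true crit)))))) ,
                  (λ crit → push (≤ᵇ⇒≤ 9 9 _) (loaded-keep Lay (λ _ → refl) (λ _ → refl) (λ _ → refl) L′)
                    uu≡ hd≡ (λ _ → refl) (λ _ → refl) (λ _ → refl) u≢r le
                    (stay (λ (_ , c) → leq-false crit (subst₂ _≤_ (sym crit₃) (sym clip₃) c))))) ,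
                (λ back → push (≤ᵇ⇒≤ 8 9 _) (loaded-keep Lay (λ _ → refl) (λ _ → refl) (λ _ → refl) L′)
                    uu≡ hd≡ (λ _ → refl) (λ _ → refl) (λ _ → refl) u≢r le
                    (stay (λ (b , _) → leq-false back (subst₂ _≤_ (sym dp≡) (sym du≡) b))))) ,
              (λ small → idle (≤ᵇ⇒≤ 6 11 _) (loaded-keep Lay (λ _ → refl) (λ _ → refl) (λ _ → refl) L′)
                    uu≡ hd≡ (λ _ → refl) (λ _ → refl) (λ _ → refl)
                (λ (_ , le , _) → leq-false small (subst₂ _≤_ (sym du≡) (sym dp≡) le)))) ,
            (λ eq → idle (≤ᵇ⇒≤ 4 11 _) (loaded-keep Lay (λ _ → refl) (λ _ → refl) (λ _ → refl) L′)
                    uu≡ hd≡ (λ _ → refl) (λ _ → refl) (λ _ → refl)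
              (λ (u≢r , _) → u≢r (trans (cong que (trans (sym hd≡) eq)) que-root)))

      spreading : Halts Spreading σ (λ σ′ t → Pushing n (σ′ CNT) (σ′ TOP) (σ′ CRIT) × t ≤ 2 + work Net 18 6)
      spreading = verify Spreading (λ σ′ t → Pushing n (σ′ CNT) (σ′ TOP) (σ′ CRIT) × t ≤ 2 + work Net 18 6) (
        let σ′ , t , r , (_ , P , t≤) = for-loop n I {σ₁} {1}
              (λ { {h} {σ′} h<n keep (hd≡ , P , t≤) →
                subst (λ x → x ∸ σ′ hd 0 ≢ 0) (sym (trans (keep N refl 0) (size L))) (m>n⇒m∸n≢0 (subst (_< n) (sym hd≡) h<n)) ,
                body h<n keep hd≡ P t≤ })
              (λ keep (hd≡ , _) → trans (cong₂ _∸_ (trans (keep N refl 0) (size L)) hd≡) (n∸n≡0 n))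
              (refl , record { fresh = λ v<n _ d< → cnt≡′ v<n d< ; pushed = λ _ () ; tops = λ _ () ; crits = λ _ () } , ≤-refl)
        in σ′ , suc t , r , P , s≤s (≤-trans t≤ (≤-trans (+-monoˡ-≤ 1 (sum-injection n n que (λ v → 18 + 6 * deg v) que<n que-injective))
                                                         (≤-reflexive (+-comm _ 1)))))

-- The main program

module _ {Net : Network} {off adj : ℕ → ℕ} (Lay : Layout Net off adj) where
  open Network Net
  open Layout Lay
  open Loaded

  best-vertex : ∀ {σ} → Loaded Lay σ → 0 < n →
         Halts Best σ (λ σ′ t → (σ′ rt 0 < n × (∀ {v} → v < n → σ TOP v ≤ σ TOP (σ′ rt 0))) × t ≤ 3 + n * 4)
  best-vertex {σ} L 0<n = verify Best (λ σ′ t → (σ′ rt 0 < n × (∀ {v} → v < n → σ TOP v ≤ σ TOP (σ′ rt 0))) × t ≤ 3 + n * 4) (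
    let σ′ , t , r , (_ , b<n , max , t≤) = for-loop n I {write vv 0 0 (write rt 0 0 σ)} {2}
          (λ { {i} {σ′} i<n keep (refl , b<n , max , t≤) →
            m>n⇒m∸n≢0 (subst (i <_) (sym (trans (keep N refl 0) (size L))) i<n) ,
            (λ ne → refl , i<n ,
              (let lt = subst₂ _<_ (keep TOP refl _) (keep TOP refl _) (m∸n≢0⇒n<m ne) in λ {v} v< → case v ≟ i of λ
              { (yes refl) → ≤-refl
              ; (no v≢i) → ≤-trans (max (≤∧≢⇒< (s≤s⁻¹ v<) v≢i)) (<⇒≤ lt) }) , later 4 4 t≤) ,
            (λ eq → refl , b<n ,
              (let le = subst₂ _≤_ (keep TOP refl _) (keep TOP refl _) (m∸n≡0⇒m≤n eq) in λ {v} v< → case v ≟ i of λ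
              { (yes refl) → le
              ; (no v≢i) → max (≤∧≢⇒< (s≤s⁻¹ v<) v≢i) }) , later 4 4 t≤) })
          (λ keep (v≡ , _) → trans (cong₂ _∸_ (trans (keep N refl 0) (size L)) v≡) (n∸n≡0 n))
          (refl , 0<n , (λ ()) , ≤-refl)
    in σ′ , suc t , r , (b<n , max) , s≤s (≤-trans t≤ (≤-reflexive (+-comm _ 2))))
    where
    I : ℕ → Store → ℕ → Set
    I i σ′ t = σ′ vv 0 ≡ i × σ′ rt 0 < n × (∀ {v} → v < i → σ TOP v ≤ σ TOP (σ′ rt 0)) × t ≤ i * 4 + 2

  module _ (treelike : Treelike Net) {root par que} (Tr : Traversal Net root par que) where
    open Traversal Tr

    module _ {σ} (L : Loaded Lay σ) (rt≡ : σ rt 0 ≡ root) (par≡ : ∀ v → σ PAR v ≡ par v) (que≡ : ∀ i → σ QUE i ≡ que i)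
             (G : Gathering Lay treelike Tr 0 (σ CNT) (σ LOW) (σ VAL) (σ RNK)) where

      private
        Γ : Gathered Net (tree Lay treelike Tr)
        Γ = gathered Lay treelike Tr G

        D : ℕ → ℕ
        D = σ VAL

        Fits : ℕ → Set
        Fits w = deg (par w) ≤ deg w × place Net Γ w ≤ bucket Net Γ w

        Good : (ℕ → ℕ) → ℕ → Set
        Good lab w = (Fits w → lab w ≡ place Net Γ w) × (¬ Fits w → lab w ≡ 0)

        Labelled : ℕ → (ℕ → ℕ) → Set
        Labelled h lab = lab root ≡ D root × (∀ {w} → w < n → w ≢ root → rank w < h → Good lab w)

        I : ℕ → Store → ℕ → Set
        I i σ′ t = σ′ hd 0 ≡ suc i × Labelled (suc i) (σ′ LABEL) × t ≤ i * 9 + 2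

        σ₁ : Store
        σ₁ = write hd 0 1 (write LABEL (σ rt 0) (σ VAL (σ rt 0)) σ)

        module _ {i σ′ t} (h<n : suc i < n) (keep : Keeps LabelStep σ₁ σ′) (hd≡ : σ′ hd 0 ≡ suc i)
                 (ok : Labelled (suc i) (σ′ LABEL)) (t≤ : t ≤ i * 9 + 2) where

          u p : ℕ
          u = que (suc i)
          p = par u

          u<n : u < n
          u<n = que<n h<n

          u≢r : u ≢ root
          u≢r eq = contradiction (que-injective h<n (≤-<-trans z≤n h<n) (trans eq (sym que-root))) 1+n≢0

          settle : ∀ {lab} → (∀ {w} → w ≢ u → lab w ≡ σ′ LABEL w) → Good lab u → Labelled (suc (suc i)) lab
          settle else-same good-u = trans (else-same (u≢r ∘ sym)) (proj₁ ok) ,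
            λ {w} w<n w≢r lt → case w ≟ u of λ
              { (yes refl) → good-u
              ; (no w≢u) → let f , g = proj₂ ok w<n w≢r (rank< Lay treelike Tr w<n (w≢u ∘ sym) lt)
                           in (λ fits → trans (else-same w≢u) (f fits)) , (λ ¬fits → trans (else-same w≢u) (g ¬fits)) }

          σ₃ : Store
          σ₃ = write pp 0 (σ′ PAR (σ′ QUE (σ′ hd 0))) (write uu 0 (σ′ QUE (σ′ hd 0)) σ′)

          σ₄ : Store
          σ₄ = write xx 0 (eval (clipped (! pp) (VAL at ! uu)) σ₃) σ₃

          L₃ : Loaded Lay σ₃
          L₃ = loaded-keep Lay (keep N refl) (keep OFF refl) (keep ADJ refl) L

          uu≡ : σ′ QUE (σ′ hd 0) ≡ u
          uu≡ = trans (cong (σ′ QUE) hd≡) (trans (keep QUE refl _) (que≡ _))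
          pp≡ : σ′ PAR (σ′ QUE (σ′ hd 0)) ≡ p
          pp≡ = trans (cong (σ′ PAR) uu≡) (trans (keep PAR refl _) (par≡ _))
          p~u : p ~ u
          p~u = par~ u<n u≢r
          du≡ : eval (degree (! uu)) σ₃ ≡ deg u
          du≡ = degree≡ L₃ {uu} uu≡ u<n
          dp≡ : eval (degree (! pp)) σ₃ ≡ deg p
          dp≡ = degree≡ L₃ {pp} pp≡ (~-< p~u)
          xx≡ : σ₄ xx 0 ≡ bucket Net Γ u
          xx≡ = clipped≡ {Net} dp≡ (trans (cong (σ′ VAL) uu≡) (keep VAL refl u))
          place≡ : eval (LOW at entry (! pp) (! xx) ⊕ RNK at ! uu) σ₄ ≡ place Net Γ u
          place≡ = cong₂ _+_
            (trans (cong (σ′ LOW) (cong₂ _+_ (trans (off≡ L₃ _) (cong off pp≡)) xx≡))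
              (trans (keep LOW refl _) (Gathering.lows G (~-< p~u) z≤n (clip< Net (D u) (deg>0 Net p~u)))))
            (trans (cong (σ′ RNK) uu≡) (keep RNK refl u))

          unset : ∀ {w} → w ≢ u → update (σ′ LABEL) (σ₃ uu 0) 0 w ≡ σ′ LABEL w
          unset w≢u = update-other (σ′ LABEL) 0 (λ eq → w≢u (trans (sym eq) uu≡))

          unset-u : update (σ′ LABEL) (σ₃ uu 0) 0 u ≡ 0
          unset-u = trans (cong (λ x → update (σ′ LABEL) x 0 u) uu≡) (update-same (σ′ LABEL) u 0)

          body : wp LabelStep (I (suc i)) σ′ (suc t)
          body =
            (λ ne → let le = subst₂ _≤_ dp≡ du≡ (leq-true ne) in
              (λ ne′ → let le′ = subst₂ _≤_ place≡ xx≡ (leq-true ne′) in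
                cong suc hd≡ ,
                settle (λ w≢u → trans (update-other (update (σ′ LABEL) (σ₃ uu 0) 0) _ (λ eq → w≢u (trans (sym eq) uu≡))) (unset w≢u))
                  ((λ _ → trans (trans (cong (λ x → update (update (σ′ LABEL) (σ₃ uu 0) 0) x value u) uu≡)
                                       (update-same (update (σ′ LABEL) (σ₃ uu 0) 0) u value)) (value≡ le′)) ,
                   (λ ¬fits → contradiction (le , le′) ¬fits)) ,
                later 9 9 t≤) ,
              (λ eq′ → cong suc hd≡ ,
                settle unset ((λ (_ , le′) → contradiction (subst₂ _≤_ (sym place≡) (sym xx≡) le′) (leq-false eq′)) , (λ _ → unset-u)) ,
                later 9 9 t≤)) ,
            (λ eq → cong suc hd≡ ,
              settle unset ((λ (le , _) → contradiction (subst₂ _≤_ (sym dp≡) (sym du≡) le) (leq-false eq)) , (λ _ → unset-u)) ,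
              later 8 9 t≤)
            where
            value : ℕ
            value = eval (minimum (! xx) (LOW at entry (! pp) (! xx) ⊕ RNK at ! uu)) σ₄
            value≡ : place Net Γ u ≤ bucket Net Γ u → value ≡ place Net Γ u
            value≡ le = trans (minimum≡ (σ₄ xx 0) _) (trans (cong₂ _⊓_ xx≡ place≡) (m≥n⇒m⊓n≡n le))

      label : Halts Label σ (λ σ′ t → Assigned Net Γ (σ′ LABEL) × t ≤ 3 + n * 9)
      label = verify Label (λ σ′ t → Assigned Net Γ (σ′ LABEL) × t ≤ 3 + n * 9) (
        -- The root, at position 0, has its label already; `n ∸ 1` vertices remain.
        let σ′ , t , r , (_ , (at-root , good) , t≤) = for-loop (n ∸ 1) I {σ₁} {2}
              (λ { {i} {σ′} i< keep (hd≡ , ok , t≤) →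
                let h<n = subst (suc (suc i) ≤_) n≡ (s≤s i<) in
                subst (λ x → x ∸ σ′ hd 0 ≢ 0) (sym (trans (keep N refl 0) (size L))) (m>n⇒m∸n≢0 (subst (_< n) (sym hd≡) h<n)) ,
                body h<n keep hd≡ ok t≤ })
              (λ keep (hd≡ , _) → trans (cong₂ _∸_ (trans (keep N refl 0) (size L)) (trans hd≡ n≡)) (n∸n≡0 n))
              (refl , (start-root , λ w<n w≢r lt → contradiction (root-only w<n lt) w≢r) , ≤-refl)
        in σ′ , suc t , r ,
           record { at-root = at-root
                  ; placed = λ w<n w≢r le h → proj₁ (good w<n w≢r (rank-all w<n)) (le , h)
                  ; unused = λ w<n w≢r → proj₂ (good w<n w≢r (rank-all w<n)) } ,
           s≤s (≤-trans t≤ (≤-trans (+-monoˡ-≤ 2 (*-monoˡ-≤ 9 (m∸n≤m n 1))) (≤-reflexive (+-comm _ 2)))))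
        where
        n≡ : suc (n ∸ 1) ≡ n
        n≡ = m+[n∸m]≡n (≤-<-trans z≤n root<n)
        rank-all : ∀ {w} → w < n → rank w < suc (n ∸ 1)
        rank-all w<n = subst (rank _ <_) (sym n≡) (rank<n w<n)
        root-only : ∀ {w} → w < n → rank w < 1 → w ≡ root
        root-only w<n lt = trans (sym (que-rank w<n)) (trans (cong que (n≤0⇒n≡0 (s≤s⁻¹ lt))) que-root)
        start-root : update (σ LABEL) (σ rt 0) (σ VAL (σ rt 0)) root ≡ D root
        start-root = trans (cong (λ x → update (σ LABEL) x (σ VAL x) root) rt≡) (update-same (σ LABEL) root _)

  module _ (treelike : Treelike Net) where

    record Passed (root : ℕ) (σ : Store) : Set where
      field
        {par} {que} : ℕ → ℕ
        traverse  : Traversal Net root par que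
        par≡      : ∀ v → σ PAR v ≡ par v
        que≡      : ∀ i → σ QUE i ≡ que i
        gathering : Gathering Lay treelike traverse 0 (σ CNT) (σ LOW) (σ VAL) (σ RNK)

      Γ : Gathered Net (tree Lay treelike traverse)
      Γ = gathered Lay treelike traverse gathering

    passTime : ℕ
    passTime = (3 + work Net 14 6) + ((5 + work Net 6 8) + ((2 + off n * 3) + (2 + n * 3)))

    pass : ∀ {σ root} → Loaded Lay σ → σ rt 0 ≡ root → root < n → ReachesAll Net root →
           Halts Pass σ (λ σ′ t → Passed root σ′ × t ≤ passTime)
    pass {σ} {root} L rt≡ r<n reach =
      case clear-marks Lay L of λ { (σ₁ , t₁ , r₁ , marks , t₁≤) →
      let L₁ = loaded-run Lay r₁ refl refl refl L in
      case clear-counts Lay L₁ of λ { (σ₂ , t₂ , r₂ , counts , t₂≤) →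
      let L₂ = loaded-run Lay r₂ refl refl refl L₁ in
      case bfs Lay L₂ (trans (frame r₂ rt refl 0) (trans (frame r₁ rt refl 0) rt≡)) r<n reach
               (λ v<n → trans (frame r₂ VIS refl _) (marks v<n)) of λ { (σ₃ , t₃ , r₃ , Tr , t₃≤) →
      let L₃ = loaded-run Lay r₃ refl refl refl L₂ in
      case gather Lay treelike Tr L₃ (λ _ → refl) (λ _ → refl) (λ i< → trans (frame r₃ CNT refl _) (counts i<))
        of λ { (σ₄ , t₄ , r₄ , G , t₄≤) →
      σ₄ , t₁ + (t₂ + (t₃ + t₄)) , seq r₁ (seq r₂ (seq r₃ r₄)) ,
      record { traverse = Tr ; par≡ = frame r₄ PAR refl ; que≡ = frame r₄ QUE refl ; gathering = G } ,
      ≤-trans (≤-reflexive (reverse t₁ t₂ t₃ t₄)) (+-mono-≤ t₄≤ (+-mono-≤ t₃≤ (+-mono-≤ t₂≤ t₁≤))) }}}}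
      where
      reverse : ∀ a b c d → a + (b + (c + d)) ≡ d + (c + (b + a))
      reverse = solve 4 (λ a b c d → a :+ (b :+ (c :+ d)) ⊜ d :+ (c :+ (b :+ a))) refl

    record Solved (σ : Store) : Set where
      field
        {peak}    : ℕ
        peak<n    : peak < n
        labelling : Labelling Net (σ LABEL)
        maximal   : ∀ {f} → Labelling Net f → ∀ {v} → v < n → f v ≤ σ LABEL peak
        order≡    : σ ORDER 0 ≡ suc (σ LABEL peak)

    mainTime : ℕ
    mainTime = 1 + (passTime + ((2 + work Net 18 6) + ((3 + n * 4) + (passTime + ((3 + n * 9) + 1)))))

    main : ∀ {σ} → Loaded Lay σ → 0 < n → (∀ {r} → r < n → ReachesAll Net r) →
           Halts Main σ (λ σ′ t → Solved σ′ × (∃[ par ] ∃[ que ] Traversal Net 0 par que) × t ≤ mainTime)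
    main {σ} L 0<n reach =
      let L₀ = loaded-keep Lay (λ _ → refl) (λ _ → refl) (λ _ → refl) L in
      case pass {write rt 0 0 σ} L₀ refl 0<n (reach 0<n) of λ { (σ₁ , t₁ , r₁ , P₁ , t₁≤) →
      let L₁ = loaded-run Lay r₁ refl refl refl L₀ in
      case spreading Lay treelike (traverse P₁) (Γ P₁) L₁ (par≡ P₁) (que≡ P₁) (λ _ → refl) (λ _ _ → refl)
        of λ { (σ₂ , t₂ , r₂ , P , t₂≤) →
      let L₂ = loaded-run Lay r₂ refl refl refl L₁ in
      case best-vertex L₂ 0<n of λ { (σ₃ , t₃ , r₃ , (b<n , max) , t₃≤) →
      let L₃ = loaded-run Lay r₃ refl refl refl L₂ in
      case pass L₃ refl b<n (reach b<n) of λ { (σ₄ , t₄ , r₄ , P₄ , t₄≤) →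
      let L₄ = loaded-run Lay r₄ refl refl refl L₃
          rt₄ = frame r₄ rt refl 0 in
      case label treelike (traverse P₄) L₄ rt₄ (par≡ P₄) (que≡ P₄) (gathering P₄) of λ { (σ₅ , t₅ , r₅ , A , t₅≤) →
      write ORDER 0 (1 + σ₅ VAL (σ₅ rt 0)) σ₅ , 1 + (t₁ + (t₂ + (t₃ + (t₄ + (t₅ + 1))))) ,
      seq assign (seq r₁ (seq r₂ (seq r₃ (seq r₄ (seq r₅ assign))))) ,
      solved P₁ (spread Lay treelike (traverse P₁) (Γ P₁) P) b<n max P₄ A
        (trans (frame r₅ VAL refl _) (cong (σ₄ VAL) (trans (frame r₅ rt refl 0) rt₄))) ,
      (_ , _ , traverse P₁) ,
      s≤s (+-mono-≤ t₁≤ (+-mono-≤ t₂≤ (+-mono-≤ t₃≤ (+-mono-≤ t₄≤ (+-monoˡ-≤ 1 t₅≤))))) }}}}}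
      where
      open Passed
      solved : ∀ {σ₁ σ₄ σ₅ b x} (P₁ : Passed 0 σ₁) (Sp : Spread Net (Γ P₁)) → b < n →
               (∀ {v} → v < n → Spread.M Sp v ≤ Spread.M Sp b) →
               (P₄ : Passed b σ₄) → Assigned Net (Γ P₄) (σ₅ LABEL) → x ≡ σ₄ VAL b →
               Solved (write ORDER 0 (suc x) σ₅)
      solved P₁ Sp b<n max P₄ A x≡ = record
        { peak<n = b<n
        ; labelling = assigned-labelling Net (Γ P₄) A
        -- The messages on the first tree bound every label by `M b`; the second pass, rooted at
        -- `b`, attains this value as the label of `b`.
        ; maximal = λ lf v<n → ≤-trans (label≤top Net (message Net Sp) (messages Net Sp) lf v<n)
            (≤-trans (≤-reflexive (top≡ Net Sp v<n)) (≤-trans (max v<n)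
            (≤-trans (≤-reflexive (sym (top≡ Net Sp b<n)))
                     (≤-reflexive (sym (trans (Assigned.at-root A) (gathered-root Net (messages Net Sp) (Γ P₄))))))))
        ; order≡ = cong suc (trans x≡ (sym (Assigned.at-root A)))
        }

-- Graphs and their adjacency lists

-- `sum` peels off its last term, whereas `tabulate` produces the first entry first.
sum-first : ∀ n f → sum (suc n) f ≡ f 0 + sum n (f ∘ suc)
sum-first zero    f = refl
sum-first (suc n) f = trans (cong (f (suc n) +_) (sum-first n f)) (x∙yz≈y∙xz +-commutativeSemigroup (f (suc n)) (f 0) _)

length-filter-tabulate : ∀ {A : Set} {P : A → Set} (P? : Decidable P) {n} (f : Fin n → A) g →
                         (∀ i → g (toℕ i) ≡ ind (P? (f i))) → length (filter P? (tabulate f)) ≡ sum n g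
length-filter-tabulate P? {zero}  f g g≡ = refl
length-filter-tabulate P? {suc n} f g g≡ with P? (f zero) | g≡ zero
... | yes _ | eq = trans (cong suc rest) (sym (trans (sum-first n g) (cong (_+ sum n (g ∘ suc)) eq)))
  where rest = length-filter-tabulate P? (f ∘ suc) (g ∘ suc) (g≡ ∘ suc)
... | no _  | eq = trans rest (sym (trans (sum-first n g) (cong (_+ sum n (g ∘ suc)) eq)))
  where rest = length-filter-tabulate P? (f ∘ suc) (g ∘ suc) (g≡ ∘ suc)

extend : ∀ {n} → (Fin n → ℕ) → ℕ → ℕ
extend {n} g u with u <? n
... | yes u<n = g (fromℕ< u<n)
... | no _    = 0

extend-toℕ : ∀ {n} (g : Fin n → ℕ) x → extend g (toℕ x) ≡ g x
extend-toℕ {n} g x with toℕ x <? n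
... | yes x<n = cong g (Fin.fromℕ<-toℕ x x<n)
... | no x≮n  = contradiction (Fin.toℕ<n x) x≮n

toℕ-onto : ∀ {n u} → u < n → ∃[ x ] toℕ {n} x ≡ u
toℕ-onto u<n = fromℕ< u<n , Fin.toℕ-fromℕ< u<n

cell-applyUpTo : ∀ f {m i} → i < m → cell (applyUpTo f m) i ≡ f i
cell-applyUpTo f {suc m} {zero}  i< = refl
cell-applyUpTo f {suc m} {suc i} i< = cell-applyUpTo (f ∘ suc) (s≤s⁻¹ i<)

cell-++ˡ : ∀ xs {ys i} → i < length xs → cell (xs ++ ys) i ≡ cell xs i
cell-++ˡ (x ∷ xs) {i = zero}  _  = refl
cell-++ˡ (x ∷ xs) {i = suc i} i< = cell-++ˡ xs (s≤s⁻¹ i<)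

cell-++ʳ : ∀ xs {ys i} → cell (xs ++ ys) (length xs + i) ≡ cell ys i
cell-++ʳ []       = refl
cell-++ʳ (x ∷ xs) = cell-++ʳ xs

cell-bounded : ∀ {m xs} → All (_≤ m) xs → ∀ i → cell xs i ≤ m
cell-bounded []       i       = z≤n
cell-bounded (x ∷ _)  zero    = x
cell-bounded (_ ∷ xs) (suc i) = cell-bounded xs i

module _ {A : Set} (f : A → ℕ) where

  cell-map-lookup : ∀ xs {i} → i < length xs → ∃[ x ] x ∈ₗ xs × cell (map f xs) i ≡ f x
  cell-map-lookup (x ∷ xs) {zero}  _  = x , here refl , refl
  cell-map-lookup (x ∷ xs) {suc i} i< = let y , y∈ , eq = cell-map-lookup xs (s≤s⁻¹ i<) in y , there y∈ , eq

  cell-map-index : ∀ {x xs} → x ∈ₗ xs → ∃[ i ] i < length xs × cell (map f xs) i ≡ f x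
  cell-map-index (here refl) = 0 , z<s , refl
  cell-map-index (there x∈)  = let i , i< , eq = cell-map-index x∈ in suc i , s≤s i< , eq

  cell-concat : ∀ {n} (rows : Fin n → List A) x {d} → d < length (rows x) →
                cell (map f (concat (tabulate rows))) (length (concat (take (toℕ x) (tabulate rows))) + d) ≡ cell (map f (rows x)) d
  cell-concat rows zero {d} d< = trans (cong (λ ys → cell ys d) (map-++ f (rows zero) _))
    (cell-++ˡ (map f (rows zero)) (subst (d <_) (sym (length-map f (rows zero))) d<))
  cell-concat rows (suc x) {d} d< = begin
    cell (map f (rows zero ++ rest)) (length (rows zero ++ before) + d)
      ≡⟨ cong₂ cell (map-++ f (rows zero) rest) (trans (cong (_+ d) (length-++ (rows zero))) (+-assoc (length (rows zero)) _ d)) ⟩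
    cell (map f (rows zero) ++ map f rest) (length (rows zero) + (length before + d))
      ≡⟨ cong (λ k → cell (map f (rows zero) ++ map f rest) (k + (length before + d))) (length-map f (rows zero)) ⟨
    cell (map f (rows zero) ++ map f rest) (length (map f (rows zero)) + (length before + d))
      ≡⟨ cell-++ʳ (map f (rows zero)) ⟩
    cell (map f rest) (length before + d)
      ≡⟨ cell-concat (rows ∘ suc) x d< ⟩
    cell (map f (rows (suc x))) d ∎
    where
    open ≡-Reasoning
    rest = concat (tabulate (rows ∘ suc))
    before = concat (take (toℕ x) (tabulate (rows ∘ suc)))

linked-snoc : ∀ {A : Set} {R : A → A → Set} xs {b c} → Linked R (xs ∷ʳ b) → R b c → Linked R (xs ∷ʳ b ∷ʳ c)
linked-snoc []           [-]      Rbc = Rbc ∷ [-]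
linked-snoc (x ∷ [])     (r ∷ rs) Rbc = r ∷ linked-snoc [] rs Rbc
linked-snoc (x ∷ y ∷ xs) (r ∷ rs) Rbc = r ∷ linked-snoc (y ∷ xs) rs Rbc

unique-snoc : ∀ {A : Set} {xs : List A} {c} → Unique xs → All (_≢ c) xs → Unique (xs ∷ʳ c)
unique-snoc u fresh = AllPairs.++⁺ u ([] ∷ []) (All.map (λ x≢c → x≢c ∷ []) fresh)

module _ (G : Graph) where
  open Graph G using (∣V∣; neighbours; ~-irrefl)
    renaming (_~_ to _≈_; _~?_ to _≈?_; ~-sym to ≈-sym; V to Vertex; deg to degreeOf)

  Adjacent : ℕ → ℕ → Set
  Adjacent u v = ∃[ x ] ∃[ y ] toℕ x ≡ u × toℕ y ≡ v × x ≈ y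

  adjacent : ∀ {x y} → x ≈ y → Adjacent (toℕ x) (toℕ y)
  adjacent e = _ , _ , refl , refl , e

  adjacent⁻ : ∀ {x y} → Adjacent (toℕ x) (toℕ y) → x ≈ y
  adjacent⁻ (x′ , y′ , ex , ey , e) = subst₂ _≈_ (Fin.toℕ-injective ex) (Fin.toℕ-injective ey) e

  adjacent? : ∀ u v → Dec (Adjacent u v)
  adjacent? u v with u <? ∣V∣ | v <? ∣V∣
  ... | no u≮ | _ = no λ { (x , _ , refl , _) → u≮ (Fin.toℕ<n x) }
  ... | yes _ | no v≮ = no λ { (_ , y , _ , refl , _) → v≮ (Fin.toℕ<n y) }
  ... | yes u< | yes v< with toℕ-onto u< | toℕ-onto v<
  ...   | x , refl | y , refl = map′ adjacent adjacent⁻ (x ≈? y)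

  network : Network
  network = record
    { n = ∣V∣
    ; _~_ = Adjacent
    ; _~?_ = adjacent?
    ; ~-sym = λ (x , y , ex , ey , e) → y , x , ey , ex , ≈-sym e
    ; ~-< = λ { (x , _ , refl , _) → Fin.toℕ<n x }
    ; deg = extend degreeOf
    ; deg≡ = degree≡count
    }
    where
    degree≡count : ∀ {u} → u < ∣V∣ → extend degreeOf u ≡ count ∣V∣ (adjacent? u)
    degree≡count u< with toℕ-onto u<
    ... | x , refl = trans (extend-toℕ degreeOf x) (length-filter-tabulate (x ≈?_) id _
      (λ y → ind-cong (adjacent? (toℕ x) (toℕ y)) (x ≈? y) adjacent⁻ adjacent))

  open Network network using (n; _~_; deg; ~-<)

  reaches-all : Connected G → ∀ {r} → r < n → ReachesAll network r
  reaches-all conn r<n P Pr closed v<n with toℕ-onto r<n | toℕ-onto v<n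
  ... | x , refl | y , refl = go (conn x y) Pr
    where
    go : ∀ {x y} → Star _≈_ x y → P (toℕ x) → P (toℕ y)
    go ε        p = p
    go (e ◅ es) p = go es (closed p (adjacent e))

  -- From an edge outside the tree, a path is extended by the parent of its end of
  -- larger rank until both ends meet. The interior of the path always has rank at
  -- least that of both ends, so that it is never hit.
  module _ (acyclic : ¬ Cycle G) (root : ℕ) (par rank : ℕ → ℕ) (par~ : ∀ {v} → v < n → v ≢ root → par v ~ v)
           (rank-par : ∀ {v} → v < n → v ≢ root → rank (par v) < rank v) where

    private
      rk : Vertex → ℕ
      rk x = rank (toℕ x)

      Parent : Vertex → Vertex → Set
      Parent x y = toℕ x ≢ root × par (toℕ x) ≡ toℕ y

      parent? : ∀ x y → Dec (Parent x y)
      parent? x y = ¬? (toℕ x ≟ root) ×-dec (par (toℕ x) ≟ toℕ y)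

      root-lowest : ∀ {v} → v < n → v ≢ root → rank root < rank v
      root-lowest {v} = go (<-wellFounded (rank v))
        where
        go : ∀ {v} → Acc _<_ (rank v) → v < n → v ≢ root → rank root < rank v
        go {v} (acc rs) v<n v≢r with par v ≟ root
        ... | yes eq = subst (λ p → rank p < rank v) eq (rank-par v<n v≢r)
        ... | no p≢r = <-trans (go (rs (rank-par v<n v≢r)) (~-< (par~ v<n v≢r)) p≢r) (rank-par v<n v≢r)

      parent : ∀ x → toℕ x ≢ root → ∃[ y ] Parent x y × y ≈ x × rk y < rk x
      parent x x≢r with toℕ-onto (~-< (par~ (Fin.toℕ<n x) x≢r))
      ... | y , eq = y , (x≢r , sym eq) , adjacent⁻ (subst (_~ toℕ x) (sym eq) (par~ (Fin.toℕ<n x) x≢r)) ,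
                     subst (λ p → rank p < rk x) (sym eq) (rank-par (Fin.toℕ<n x) x≢r)

      -- The root alone has the smallest rank. So of two distinct ends of a path, one whose rank is
      -- not the smaller has a parent by which the path can grow.
      not-root : ∀ {x y} → x ≢ y → rk y ≤ rk x → toℕ x ≢ root
      not-root {x} {y} x≢y y≤x refl =
        <⇒≱ (root-lowest (Fin.toℕ<n y) (λ eq → x≢y (Fin.toℕ-injective (sym eq)))) y≤x

      record Path (a : Vertex) (I : List Vertex) (b : Vertex) : Set where
        field
          linked   : Linked _≈_ (a ∷ I ∷ʳ b)
          distinct : Unique (a ∷ I ∷ʳ b)
          higher   : All (λ z → rk a ≤ rk z × rk b ≤ rk z) I
          -- Ensures that the closed path has at least three vertices: only the initial edge has no
          -- interior, and it is not a tree edge.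
          open-end : Parent a b ⊎ Parent b a → 1 ≤ length I

      ends≢ : ∀ {a : Vertex} {I b} → Unique (a ∷ I ∷ʳ b) → a ≢ b
      ends≢ {I = I} (fresh ∷ _) with All.++⁻ʳ I fresh
      ... | a≢b ∷ [] = a≢b

      close : ∀ {a I b} → Path a I b → Parent a b ⊎ Parent b a → a ≈ b → ⊥
      close {a} {I} {b} p ends e = acyclic record
        { start = a ; rest = I ∷ʳ b
        ; long = ≤-trans (s≤s (open-end ends)) (≤-reflexive (trans (+-comm 1 (length I)) (sym (length-++ I))))
        ; distinct = distinct
        ; closed = linked-snoc (a ∷ I) linked (≈-sym e)
        }
        where open Path p

      no-path : ∀ {a I b} → Acc _<_ (rk a + rk b) → Path a I b → ⊥
      no-path {a} {I} {b} (acc rs) p with ≤-total (rk b) (rk a)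
      ... | inj₁ b≤a = climb (parent a (not-root (ends≢ (Path.distinct p)) b≤a))
        where
        open Path p
        climb : ∃[ y ] Parent a y × y ≈ a × rk y < rk a → ⊥
        climb (y , a→y , e , y<a) with y Fin.≟ b
        ... | yes refl = close p (inj₁ a→y) (≈-sym e)
        ... | no y≢b   = no-path (rs (+-monoˡ-< (rk b) y<a)) record
          { linked = e ∷ linked
          ; distinct = ((λ { refl → <-irrefl refl y<a }) ∷
              All.++⁺ (All.map (λ { (a≤z , _) refl → <⇒≱ y<a a≤z }) higher) (y≢b ∷ [])) ∷ distinct
          ; higher = (<⇒≤ y<a , b≤a) ∷ All.map (λ (a≤z , b≤z) → ≤-trans (<⇒≤ y<a) a≤z , b≤z) higher
          ; open-end = λ _ → s≤s z≤n
          }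
      ... | inj₂ a≤b = climb (parent b (not-root (ends≢ (Path.distinct p) ∘ sym) a≤b))
        where
        open Path p
        climb : ∃[ y ] Parent b y × y ≈ b × rk y < rk b → ⊥
        climb (y , b→y , e , y<b) with y Fin.≟ a
        ... | yes refl = close p (inj₂ b→y) e
        ... | no y≢a   = no-path (rs (+-monoʳ-< (rk a) y<b)) record
          { linked = linked-snoc (a ∷ I) linked (≈-sym e)
          ; distinct = unique-snoc distinct ((λ eq → y≢a (sym eq)) ∷
              All.++⁺ (All.map (λ { (_ , b≤z) refl → <⇒≱ y<b b≤z }) higher) ((λ { refl → <-irrefl refl y<b }) ∷ []))
          ; higher = All.++⁺ (All.map (λ (a≤z , b≤z) → a≤z , ≤-trans (<⇒≤ y<b) b≤z) higher) ((a≤b , <⇒≤ y<b) ∷ [])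
          ; open-end = λ _ → ≤-trans (m≤n+m 1 (length I)) (≤-reflexive (sym (length-++ I)))
          }

    tree-edge : ∀ {u v} → u ~ v → (v ≢ root × par v ≡ u) ⊎ (u ≢ root × par u ≡ v)
    tree-edge (x , y , refl , refl , e) with parent? y x | parent? x y
    ... | yes y→x | _       = inj₁ y→x
    ... | no _    | yes x→y = inj₂ x→y
    ... | no ¬y→x | no ¬x→y = ⊥-elim (no-path {x} {[]} {y} (<-wellFounded _) record
      { linked = e ∷ [-]
      ; distinct = ((λ eq → ~-irrefl eq e) ∷ []) ∷ ([] ∷ [])
      ; higher = []
      ; open-end = λ { (inj₁ x→y) → contradiction x→y ¬x→y ; (inj₂ y→x) → contradiction y→x ¬y→x }
      })

  treelike : ¬ Cycle G → Treelike network
  treelike = tree-edge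

-- Sparsity of trees

count-≡ : ∀ n x → count n (x ≟_) ≤ 1
count-≡ zero    x = z≤n
count-≡ (suc n) x with x ≟ n
... | yes refl = s≤s (≤-reflexive (trans (sum-cong n (λ {u} u<n → ind-no (n ≟ u) (<⇒≢ u<n ∘ sym))) (sum-zero n)))
... | no _     = count-≡ n x

module _ {Net : Network} (treelike : Treelike Net) {root par que} (Tr : Traversal Net root par que) where
  open Network Net
  open RootedTree (spanning treelike Tr) using (Child; child?; edge)

  -- Every adjacent ordered pair is a parent and its child in one of the two orders, and a vertex
  -- has at most one parent.
  sparse : sum n deg ≤ 2 * n
  sparse = begin
    sum n deg
      ≡⟨ sum-cong n deg≡ ⟩
    sum n (λ u → count n (u ~?_))
      ≤⟨ sum-mono n (λ {u} _ → ≤-trans (sum-mono n (λ {v} _ → split u v)) (≤-reflexive (sum-+ n _ _))) ⟩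
    sum n (λ u → count n (child? u) + count n (λ v → child? v u))
      ≡⟨ sum-+ n _ _ ⟩
    sum n (λ u → count n (child? u)) + sum n (λ u → count n (λ v → child? v u))
      ≡⟨ cong (_+ parents) (sum-swap n n (λ u v → ind (child? u v))) ⟩
    parents + parents
      ≤⟨ +-mono-≤ parents≤ parents≤ ⟩
    n + n
      ≡⟨ cong (n +_) (+-identityʳ n) ⟨
    2 * n ∎
    where
    open ≤-Reasoning
    parents : ℕ
    parents = sum n (λ u → count n (λ v → child? v u))
    parents≤ : parents ≤ n
    parents≤ = ≤-trans (sum-mono n (λ {u} _ → ≤-trans (sum-mono n (λ {v} _ → ind-mono (child? v u) (par u ≟ v) proj₂)) (count-≡ n (par u))))
                       (≤-reflexive (trans (sum-const n 1) (*-identityʳ n)))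
    split : ∀ u v → ind (u ~? v) ≤ ind (child? u v) + ind (child? v u)
    split u v with u ~? v
    ... | no _  = z≤n
    ... | yes e with edge e
    ...   | inj₁ c = ≤-trans (≤-reflexive (sym (ind-yes (child? u v) c))) (m≤m+n _ _)
    ...   | inj₂ c = ≤-trans (≤-reflexive (sym (ind-yes (child? v u) c))) (m≤n+m _ _)

-- The input as a layout

module _ (G : Graph) (L : AdjacencyLists G) where
  open Graph G using (∣V∣; neighbours) renaming (_~_ to _≈_; _~?_ to _≈?_; V to Vertex; deg to degreeOf)
  open AdjacencyLists L renaming (adj to list)
  open Network (network G) using (n; deg)

  private
    rows : List (List Vertex)
    rows = tabulate list

    start : ℕ → ℕ
    start v = length (concat (take v rows))

    cut : ℕ → ℕ
    cut v = length (concat (take v (map list (allFin ∣V∣))))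

    cut≡ : ∀ v → cut v ≡ start v
    cut≡ v = cong (λ xs → length (concat (take v xs))) (map-tabulate id list)

    offsets≡ : ∀ {v} → v ≤ n → input L OFF v ≡ start v
    offsets≡ {v} v≤n = trans (cong (λ xs → cell xs v) (map-upTo cut (suc ∣V∣)))
                             (trans (cell-applyUpTo cut (s≤s v≤n)) (cut≡ v))

    length-list : ∀ x → length (list x) ≡ deg (toℕ x)
    length-list x = trans (↭-length (enumerates x)) (sym (extend-toℕ degreeOf x))

    start-suc : ∀ x → start (suc (toℕ x)) ≡ start (toℕ x) + deg (toℕ x)
    start-suc x = begin
      length (concat (take (suc (toℕ x)) rows))                    ≡⟨ cong (length ∘ concat) (take-suc-tabulate list x) ⟩
      length (concat (take (toℕ x) rows ∷ʳ list x))                ≡⟨ cong length (concat-++ (take (toℕ x) rows) _) ⟨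
      length (concat (take (toℕ x) rows) ++ (list x ++ []))        ≡⟨ length-++ (concat (take (toℕ x) rows)) ⟩
      start (toℕ x) + length (list x ++ [])                        ≡⟨ cong (λ xs → start (toℕ x) + length xs) (++-identityʳ (list x)) ⟩
      start (toℕ x) + length (list x)                              ≡⟨ cong (start (toℕ x) +_) (length-list x) ⟩
      start (toℕ x) + deg (toℕ x)                                  ∎
      where open ≡-Reasoning

    entry-cell : ∀ x {d} → d < deg (toℕ x) → input L ADJ (input L OFF (toℕ x) + d) ≡ cell (map toℕ (list x)) d
    entry-cell x {d} d< = trans
      (cong₂ (λ xs k → cell (map toℕ (concat xs)) (k + d)) (map-tabulate id list) (offsets≡ (<⇒≤ (Fin.toℕ<n x))))
      (cell-concat toℕ list x (subst (d <_) (sym (length-list x)) d<))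

  layout : Layout (network G) (input L OFF) (input L ADJ)
  layout = record
    { off-zero = offsets≡ z≤n
    ; off-suc = suc-case
    ; slot = slot-case
    ; slot-of = λ { (x , y , refl , refl , e) →
        let d , d< , eq = cell-map-index toℕ (∈-resp-↭ (↭-sym (enumerates x)) (∈-filter⁺ (x ≈?_) (∈-allFin y) e))
            d<deg = subst (d <_) (length-list x) d<
        in d , d<deg , trans (entry-cell x d<deg) eq }
    }
    where
    suc-case : ∀ {v} → v < n → input L OFF (suc v) ≡ input L OFF v + deg v
    suc-case v<n with toℕ-onto v<n
    ... | x , refl = trans (offsets≡ v<n) (trans (start-suc x) (cong (_+ deg (toℕ x)) (sym (offsets≡ (<⇒≤ v<n)))))
    slot-case : ∀ {v} → v < n → ∀ {d} → d < deg v → Adjacent G v (input L ADJ (input L OFF v + d))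
    slot-case v<n {d} d< with toℕ-onto v<n
    ... | x , refl = let y , y∈ , eq = cell-map-lookup toℕ (list x) (subst (d <_) (sym (length-list x)) d<)
                     in subst (Adjacent G (toℕ x)) (sym (trans (entry-cell x d<) eq))
                          (adjacent G (proj₂ (∈-filter⁻ (x ≈?_) {xs = allFin ∣V∣} (∈-resp-↭ (enumerates x) y∈))))

  loaded : Loaded layout (input L)
  loaded = record { size = refl ; off≡ = λ _ → refl ; adj≡ = λ _ → refl }

  -- The initial bound `m` for `fits`: vertices and their number are at most `n`, offsets at most
  -- the sum of the degrees.
  input-bounded : Bounded (n + sum n deg) (input L)
  input-bounded 0 i = cell-bounded (m≤m+n n _ ∷ []) i
  input-bounded 1 i = cell-bounded (subst (All _) (sym (map-upTo cut (suc ∣V∣))) (All.applyUpTo⁺₁ cut (suc ∣V∣) bound)) i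
    where
    bound : ∀ {v} → v < suc n → cut v ≤ n + sum n deg
    bound {v} (s≤s v≤n) = begin
      cut v             ≡⟨ trans (cut≡ v) (sym (offsets≡ v≤n)) ⟩
      input L OFF v     ≡⟨ Layout.off-total layout v≤n ⟩
      sum v deg         ≤⟨ sum-injection v n id deg (λ i< → <-≤-trans i< v≤n) (λ _ _ → id) ⟩
      sum n deg         ≤⟨ m≤n+m _ n ⟩
      n + sum n deg     ∎
      where open ≤-Reasoning
  input-bounded 2 i = cell-bounded
    (All.map⁺ (All.universal (λ x → ≤-trans (<⇒≤ (Fin.toℕ<n x)) (m≤m+n n _)) (concat (map list (allFin ∣V∣))))) i
  input-bounded (suc (suc (suc a))) i = z≤n

-- Labellings and strong transitive partitions

module _ (G : Graph) where
  open Graph G using (∣V∣) renaming (_~_ to _≈_; V to Vertex; deg to degreeOf)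
  open Network (network G) using (n; deg; _~_)

  Dominates : (Vertex → ℕ) → Set
  Dominates f = ∀ y {i} → i < f y → ∃[ x ] f x ≡ i × x ≈ y × degreeOf y ≤ degreeOf x

  partition-dominates : ∀ {k} (P : StrongTransitivePartition G k) → Dominates (toℕ ∘ StrongTransitivePartition.class P)
  partition-dominates {k} P y {i} i< =
    let i<k = <-trans i< (Fin.toℕ<n (class y))
        x , x∈ , e , le = dominates {i = fromℕ< i<k} (subst (_< toℕ (class y)) (sym (Fin.toℕ-fromℕ< i<k)) i<) {y} refl
    in x , trans (cong toℕ x∈) (Fin.toℕ-fromℕ< i<k) , e , le
    where open StrongTransitivePartition P

  dominates-labelling : ∀ {f} → Dominates f → Labelling (network G) (extend f)
  dominates-labelling {f} dom u<n i< with toℕ-onto u<n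
  ... | y , refl = let x , fx , e , le = dom y (subst (_ <_) (extend-toℕ f y) i<)
                   in toℕ x , adjacent G e , trans (extend-toℕ f x) fx ,
                      subst₂ _≤_ (sym (extend-toℕ degreeOf y)) (sym (extend-toℕ degreeOf x)) le

  labelling-dominates : ∀ {l} → Labelling (network G) l → Dominates (l ∘ toℕ)
  labelling-dominates lab y i< with lab (Fin.toℕ<n y) i<
  ... | w , (x , y′ , refl , ey , e) , lx , le with Fin.toℕ-injective ey
  ...   | refl = x , lx , e , subst₂ _≤_ (extend-toℕ degreeOf y) (extend-toℕ degreeOf x) le

  module _ {f : Vertex → ℕ} {top : Vertex} (dom : Dominates f) (f≤ : ∀ x → f x ≤ f top) where

    label-class : Vertex → Fin (suc (f top))
    label-class x = fromℕ< (s≤s (f≤ x))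

    toℕ-label-class : ∀ x → toℕ (label-class x) ≡ f x
    toℕ-label-class x = Fin.toℕ-fromℕ< (s≤s (f≤ x))

    label-partition : StrongTransitivePartition G (suc (f top))
    label-partition = record
      { class = label-class
      ; nonempty = onto
      ; dominates = λ { {i} i<j {y} refl →
          let x , fx , e , le = dom y (subst (toℕ i <_) (toℕ-label-class y) i<j)
          in x , Fin.toℕ-injective (trans (toℕ-label-class x) fx) , e , le }
      }
      where
      onto : ∀ i → ∃[ x ] label-class x ≡ i
      -- `top` has the largest label, and domination gives it neighbours of all smaller ones.
      onto i with m≤n⇒m<n∨m≡n (s≤s⁻¹ (Fin.toℕ<n i))
      ... | inj₁ i< = let x , fx , _ = dom top i< in x , Fin.toℕ-injective (trans (toℕ-label-class x) fx)
      ... | inj₂ i≡ = top , Fin.toℕ-injective (trans (toℕ-label-class top) (sym i≡))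

  optimal-partition : ∀ {l peak} → Labelling (network G) l → peak < n →
                      (∀ {f} → Labelling (network G) f → ∀ {v} → v < n → f v ≤ l peak) →
                      ∃[ S ] ∀ x →
                      l (toℕ x) ≡ toℕ (StrongTransitivePartition.class (IsStrongTransitivity.partition {G} {suc (l peak)} S) x)
  optimal-partition {l} lab peak<n maximal with toℕ-onto peak<n
  ... | top , refl = record { partition = label-partition (labelling-dominates lab) l≤ ; maximum = maximum } ,
                     λ x → sym (toℕ-label-class (labelling-dominates lab) l≤ x)
    where
    l≤ : ∀ x → l (toℕ x) ≤ l (toℕ top)
    l≤ x = maximal lab (Fin.toℕ<n x)
    maximum : ∀ {k} → StrongTransitivePartition G k → k ≤ suc (l (toℕ top))
    maximum {zero}  P = z≤n
    maximum {suc k} P =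
      let open StrongTransitivePartition P
          -- A vertex of the last part has label `k`.
          x , eq = nonempty (Fin.fromℕ k)
      in s≤s (begin
        k                              ≡⟨ trans (cong toℕ eq) (Fin.toℕ-fromℕ k) ⟨
        toℕ (class x)                  ≡⟨ extend-toℕ (toℕ ∘ class) x ⟨
        extend (toℕ ∘ class) (toℕ x)   ≤⟨ maximal (dominates-labelling (partition-dominates P)) (Fin.toℕ<n x) ⟩
        l (toℕ top)                    ∎)
      where open ≤-Reasoning

  solved⇒holds : ∀ {off adj} (Lay : Layout (network G) off adj) {tr σ} → Solved Lay tr σ → HoldsMaximumPartition G σ
  solved⇒holds Lay s = let opt , class≡ = optimal-partition labelling peak<n maximal in record
    { optimal = opt ; order-stored = order≡ ; class-stored = class≡ }
    where open Solved s

-- Running time and word size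

module _ {Net : Network} {off adj} (Lay : Layout Net off adj) (tl : Treelike Net) where
  open Network Net

  private
    S : ℕ
    S = sum n deg

  work≡ : ∀ α β → work Net α β ≡ n * α + β * S
  work≡ α β = trans (sum-+ n (λ _ → α) (λ v → β * deg v)) (cong₂ _+_ (sum-const n α) (scale n))
    where
    scale : ∀ k → sum k (λ v → β * deg v) ≡ β * sum k deg
    scale zero    = sym (*-zeroʳ β)
    scale (suc k) = trans (cong (β * deg k +_) (scale k)) (sym (*-distribˡ-+ β (deg k) _))

  mainTime≡ : mainTime Lay tl ≡ 34 + n * 77 + S * 40
  mainTime≡ rewrite work≡ 14 6 | work≡ 6 8 | work≡ 18 6 | Layout.off-total Lay {n} ≤-refl =
    solve 2 (λ n S →
      let pass = (con 3 :+ (n :* con 14 :+ con 6 :* S)) :+ ((con 5 :+ (n :* con 6 :+ con 8 :* S)) :+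
                 ((con 2 :+ S :* con 3) :+ (con 2 :+ n :* con 3)))
      in con 1 :+ (pass :+ ((con 2 :+ (n :* con 18 :+ con 6 :* S)) :+ ((con 3 :+ n :* con 4) :+
           (pass :+ ((con 3 :+ n :* con 9) :+ con 1)))))
         ⊜ con 34 :+ n :* con 77 :+ S :* con 40) refl n S

  module _ {root par que} (0<n : 0 < n) (Tr : Traversal Net root par que) {t} (t≤ : t ≤ mainTime Lay tl) where

    -- As `0 < n`, the constant 34 is at most `34 * n`, and `S` is at most `2 * n`: this gives 34 +
    -- 77 + 80.
    linear-time : t ≤ 191 * n
    linear-time = begin
      t                                  ≤⟨ t≤ ⟩
      mainTime Lay tl                    ≡⟨ mainTime≡ ⟩
      34 + n * 77 + S * 40               ≤⟨ +-mono-≤ (+-monoˡ-≤ (n * 77) (*-monoʳ-≤ 34 0<n)) (*-monoˡ-≤ 40 (sparse tl Tr)) ⟩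
      34 * n + n * 77 + 2 * n * 40       ≡⟨ solve 1 (λ n → con 34 :* n :+ n :* con 77 :+ con 2 :* n :* con 40 ⊜ con 191 :* n) refl n ⟩
      191 * n                            ∎
      where open ≤-Reasoning

    -- Stored numbers start at no more than `3 * n` and grow by at most 1 in each of `191 * n`
    -- steps; doubling for indices and adding 1 gives 389.
    linear-words : 2 * (n + S + t) + 1 ≤ 389 * n
    linear-words = begin
      2 * (n + S + t) + 1                ≤⟨ +-mono-≤ (*-monoʳ-≤ 2 (+-mono-≤ (+-monoʳ-≤ n (sparse tl Tr)) linear-time)) 0<n ⟩
      2 * (n + 2 * n + 191 * n) + n      ≡⟨ solve 1 (λ n → con 2 :* (n :+ con 2 :* n :+ con 191 :* n) :+ n ⊜ con 389 :* n) refl n ⟩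
      389 * n                            ∎
      where open ≤-Reasoning

module _ (G : Graph) (isTree : IsTree G) (L : AdjacencyLists G) where
  open Graph G using (∣V∣)
  open IsTree isTree

  main-solves : ∀ {W} → 389 * ∣V∣ ≤ W →
                ∃[ σ ] ∃[ t ] (W ⊢⟨ Main , input L ⟩⇓⟨ σ , t ⟩) × t ≤ W × HoldsMaximumPartition G σ
  main-solves {W} ≤W = conclude (main Lay tr (loaded G L) 0<n (reaches-all G connected))
    where
    Lay : Layout (network G) (input L OFF) (input L ADJ)
    Lay = layout G L
    tr : Treelike (network G)
    tr = treelike G acyclic
    0<n : 0 < ∣V∣
    0<n = >-nonZero⁻¹ ∣V∣ {{nonempty}}
    conclude : Halts Main (input L) (λ σ t →
                  Solved Lay tr σ × (∃[ par ] ∃[ que ] Traversal (network G) 0 par que) × t ≤ mainTime Lay tr) →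
               ∃[ σ ] ∃[ t ] (W ⊢⟨ Main , input L ⟩⇓⟨ σ , t ⟩) × t ≤ W × HoldsMaximumPartition G σ
    conclude (σ , t , r , solved , (_ , _ , Tr) , t≤) =
      σ , t ,
      proj₁ (fits _ r main-gentle (input-bounded G L) (≤-trans (linear-words Lay tr 0<n Tr t≤) ≤W)) ,
      ≤-trans (linear-time Lay tr 0<n Tr t≤) (≤-trans (*-monoˡ-≤ ∣V∣ (≤ᵇ⇒≤ 191 389 _)) ≤W) ,
      solved⇒holds G Lay solved

theorem8 : ∃[ p ] SolvesMSTPInLinearTimeOn IsTree p
-- The constant is dictated by the word size of `linear-words`; the time bound is smaller.
theorem8 = Main , 389 , λ G isTree L → main-solves G isTree L (*-monoʳ-≤ 389 (m≤m+n (Graph.∣V∣ G) (Graph.∣E∣ G)))
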